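{- There is an $O(m\,\alpha(m,n))$-time approximation algorithm for the minimum SCSS problem achieving a performance guarantee of $1.75$ on an $m$-edge, $n$-vertex graph; that is, given a strongly connected digraph $G$ with $n$ vertices and $m$ edges, the algorithm outputs in $O(m\,\alpha(m,n))$ time an SCSS of $G$ with at most $1.75\cdot\mathcal{OPT}(G)$ edges.
   Context: An SCSS (strongly connected spanning subgraph) of a strongly connected digraph $G$ is a subset of the edges that strongly connects all vertices of $G$; $\mathcal{OPT}(G)$ is the minimum number of edges in an SCSS of $G$. The minimum SCSS problem asks, given a strongly connected digraph $G$, for an SCSS of minimum size. Here $\alpha(m,n)$ is the inverse-Ackermann function associated with the union-find data structure (as in Tarjan's analysis). -}

module Defs where

open import Data.Bool using (Bool; true; false; if_then_else_)
open import Data.Fin as Fin using (Fin; toℕ; fromℕ<)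
open import Data.Fin.Properties as Finₚ using (all?)
open import Data.Fin.Subset using (Subset; inside; outside; _∈_; ⊤; ∣_∣)
open import Data.Fin.Subset.Properties using (anySubset?; ∣p∣≤n; drop-there)
open import Data.Nat
open import Data.Nat.DivMod using (_/_; m≥n⇒m/n>0)
open import Data.Nat.Logarithm using (⌊log₂_⌋; ⌊log₂⌋-mono-≤; ⌊log₂[2^n]⌋≡n)
open import Data.Nat.Properties
open import Data.Product using (∃; _×_; _,_; proj₁; proj₂)
open import Data.Sum using (_⊎_; inj₁; inj₂)
open import Data.Vec using (tabulate; _∷_; []; here; there)
open import Function.Definitions using (Injective)
open import Relation.Binary.Construct.Closure.ReflexiveTransitive
  using (Star; ε; _◅_; _◅◅_; gmap)
open import Relation.Binary.PropositionalEquality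
  using (_≡_; refl; sym; cong; subst)
open import Relation.Nullary using (Dec; yes; no; contradiction)
open import Relation.Nullary.Decidable using (map′; does; _×-dec_; _⊎-dec_)
open import Relation.Unary using (Decidable)

-- least P? i k is the least element of {i, …, i + k ∸ 1} satisfying P, and
-- i + k if there is none.
least : {P : ℕ → Set} → Decidable P → ℕ → ℕ → ℕ
least P? i zero    = i
least P? i (suc k) = if does (P? i) then i else least P? (suc i) k

record IsLeastFrom (P : ℕ → Set) (i l : ℕ) : Set where
  field
    lower    : i ≤ l
    holds    : P l
    minimal  : ∀ j → i ≤ j → P j → l ≤ j

least-isLeast : {P : ℕ → Set} (P? : Decidable P) (i k : ℕ) →
  (∃ λ j → i ≤ j × j < i + k × P j) → IsLeastFrom P i (least P? i k)
least-isLeast P? i zero (j , i≤j , j<i+0 , _) =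
  contradiction (<-≤-trans j<i+0 (≤-trans (≤-reflexive (+-identityʳ i)) i≤j)) (<-irrefl refl)
least-isLeast {P} P? i (suc k) (j , i≤j , j<i+k , Pj) with P? i
... | yes Pi = record { lower = ≤-refl ; holds = Pi ; minimal = λ _ i≤j _ → i≤j }
... | no ¬Pi = record
  { lower   = ≤-trans (n≤1+n i) lower
  ; holds   = holds
  ; minimal = λ j i≤j Pj → minimal j (next j i≤j Pj) Pj
  }
  where
  next : ∀ j → i ≤ j → P j → suc i ≤ j
  next j i≤j Pj = ≤∧≢⇒< i≤j λ { refl → ¬Pi Pj }
  open IsLeastFrom
    (least-isLeast P? (suc i) k (j , next j i≤j Pj , subst (j <_) (+-suc i k) j<i+k , Pj))

------------------------------------------------------------------------
-- Digraphs

-- A digraph on the vertex set Fin n whose m distinct edges are numbered by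
-- Fin m; a set of edges is thus a Subset m.
record Digraph (n m : ℕ) : Set where
  field
    ends     : Fin m → Fin n × Fin n
    distinct : Injective _≡_ _≡_ ends

open Digraph public

Edge : ∀ {n m} → (Fin m → Fin n × Fin n) → Subset m → Fin n → Fin n → Set
Edge f S u v = ∃ λ e → e ∈ S × f e ≡ (u , v)

Reachable : ∀ {n m} → (Fin m → Fin n × Fin n) → Subset m → Fin n → Fin n → Set
Reachable f S = Star (Edge f S)

SCSS : ∀ {n m} → Digraph n m → Subset m → Set
SCSS G S = ∀ u v → Reachable (ends G) S u v

StronglyConnected : ∀ {n m} → Digraph n m → Set
StronglyConnected G = SCSS G ⊤

private
  module _ {n m} (f : Fin (suc m) → Fin n × Fin n) (S : Subset m) where
    g : Fin m → Fin n × Fin n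
    g e = f (Fin.suc e)

    weaken : ∀ {b u v} → Reachable g S u v → Reachable f (b ∷ S) u v
    weaken = gmap (λ x → x) λ (e , e∈S , eq) → Fin.suc e , there e∈S , eq

    strengthen : ∀ {u v} → Reachable f (outside ∷ S) u v → Reachable g S u v
    strengthen = gmap (λ x → x) λ where
      (Fin.zero  , ()  , _)
      (Fin.suc e , e∈S , eq) → e , drop-there e∈S , eq

    Via : Fin n → Fin n → Set
    Via u v = Reachable g S u v
            ⊎ (Reachable g S u (proj₁ (f Fin.zero)) × Reachable g S (proj₂ (f Fin.zero)) v)

    join : ∀ {u v} → Via u v → Reachable f (inside ∷ S) u v
    join (inj₁ p)       = weaken p
    join (inj₂ (p , q)) = weaken p ◅◅ (Fin.zero , here , refl) ◅ weaken q

    split : ∀ {u v} → Reachable f (inside ∷ S) u v → Via u v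
    split ε = inj₁ ε
    split {u} {v} ((Fin.zero , _ , eq) ◅ p) =
      inj₂ (subst (Reachable g S u) (sym (cong proj₁ eq)) ε , tail (sym (cong proj₂ eq)) (split p))
      where
      tail : ∀ {w} → w ≡ proj₂ (f Fin.zero) → Via w v → Reachable g S (proj₂ (f Fin.zero)) v
      tail refl (inj₁ q)       = q
      tail _    (inj₂ (_ , q)) = q
    split ((Fin.suc e , e∈S , eq) ◅ p) with split p
    ... | inj₁ q       = inj₁ ((e , drop-there e∈S , eq) ◅ q)
    ... | inj₂ (q , r) = inj₂ ((e , drop-there e∈S , eq) ◅ q , r)

reachable? : ∀ {n m} (f : Fin m → Fin n × Fin n) (S : Subset m) u v → Dec (Reachable f S u v)
reachable? f [] u v = map′ (λ { refl → ε }) (λ { ε → refl ; ((() , _) ◅ _) }) (u Finₚ.≟ v)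
reachable? f (outside ∷ S) u v =
  map′ (weaken f S) (strengthen f S) (reachable? (λ e → f (Fin.suc e)) S u v)
reachable? f (inside ∷ S) u v =
  map′ (join f S) (split f S)
    (r u v ⊎-dec (r u (proj₁ (f Fin.zero)) ×-dec r (proj₂ (f Fin.zero)) v))
  where r = reachable? (λ e → f (Fin.suc e)) S

SCSS? : ∀ {n m} (G : Digraph n m) → Decidable (SCSS G)
SCSS? G S = all? λ u → all? λ v → reachable? (ends G) S u v

SCSSOfSize : ∀ {n m} → Digraph n m → ℕ → Set
SCSSOfSize G k = ∃ λ S → SCSS G S × ∣ S ∣ ≡ k

SCSSOfSize? : ∀ {n m} (G : Digraph n m) → Decidable (SCSSOfSize G)
SCSSOfSize? G k = anySubset? λ S → SCSS? G S ×-dec (∣ S ∣ ≟ k)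

-- Meaningful when G is strongly connected; see OPT-isLeast.
OPT : ∀ {n m} → Digraph n m → ℕ
OPT {m = m} G = least (SCSSOfSize? G) 0 (suc m)

OPT-isLeast : ∀ {n m} (G : Digraph n m) → StronglyConnected G →
  IsLeastFrom (SCSSOfSize G) 0 (OPT G)
OPT-isLeast {m = m} G sc =
  least-isLeast (SCSSOfSize? G) 0 (suc m)
    (∣ ⊤ {m} ∣ , z≤n , s≤s (∣p∣≤n (⊤ {m})) , ⊤ , sc , refl)

------------------------------------------------------------------------
-- The inverse Ackermann function

-- Tarjan's A(i, j), for i, j ≥ 1; the clauses for i = 0 and j = 0 are
-- arbitrary values outside that domain.
A : ℕ → ℕ → ℕ
A zero          _             = 0
A (suc zero)    j             = 2 ^ j
A (suc (suc i)) zero          = 0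
A (suc (suc i)) (suc zero)    = A (suc i) 2
A (suc (suc i)) (suc (suc j)) = A (suc i) (A (suc (suc i)) (suc j))

-- A(i, ⌊m/n⌋) > log₂ n; since the left-hand side is an integer, the real
-- logarithm may be replaced by its floor.
ExceedsLog : (m n : ℕ) → .{{NonZero n}} → ℕ → Set
ExceedsLog m n i = ⌊log₂ n ⌋ < A i (m / n)

ExceedsLog? : (m n : ℕ) .{{_ : NonZero n}} → Decidable (ExceedsLog m n)
ExceedsLog? m n i = ⌊log₂ n ⌋ <? A i (m / n)

-- α(m, n) = min { i ≥ 1 | A(i, ⌊m/n⌋) > log₂ n }, defined for m ≥ n ≥ 1, where
-- the minimum is at most n; see α-isLeast.
α : (m n : ℕ) → .{{NonZero n}} → ℕ
α m n = least (ExceedsLog? m n) 1 n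

private
  n<2^n : ∀ n → n < 2 ^ n
  n<2^n zero    = s≤s z≤n
  n<2^n (suc n) = begin-strict
    suc n             ≤⟨ n<2^n n ⟩
    2 ^ n             <⟨ m<m+n (2 ^ n) (m^n>0 2 n) ⟩
    2 ^ n + 2 ^ n     ≡⟨ cong (2 ^ n +_) (sym (+-identityʳ (2 ^ n))) ⟩
    2 ^ suc n         ∎
    where open ≤-Reasoning

  ⌊log₂n⌋≤n : ∀ n → ⌊log₂ n ⌋ ≤ n
  ⌊log₂n⌋≤n n =
    ≤-trans (⌊log₂⌋-mono-≤ (<⇒≤ (n<2^n n))) (≤-reflexive (⌊log₂[2^n]⌋≡n n))

  A-large : ∀ i j → suc i + suc j ≤ A (suc i) (suc j)
  A-large zero    j       = n<2^n (suc j)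
  A-large (suc i) zero    = ≤-trans (≤-reflexive (sym (+-suc (suc i) 1))) (A-large i 1)
  A-large (suc i) (suc j) = go (A (suc (suc i)) (suc j)) (A-large (suc i) j)
    where
    open ≤-Reasoning
    go : ∀ a → suc (suc i) + suc j ≤ a → suc (suc i) + suc (suc j) ≤ A (suc i) a
    go (suc a) le = begin
      suc (suc i) + suc (suc j) ≡⟨ +-suc (suc (suc i)) (suc j) ⟩
      1 + (suc (suc i) + suc j) ≤⟨ +-mono-≤ (s≤s (z≤n {i})) le ⟩
      suc i + suc a             ≤⟨ A-large i a ⟩
      A (suc i) (suc a)         ∎

α-isLeast : (m n : ℕ) .{{_ : NonZero n}} → n ≤ m → IsLeastFrom (ExceedsLog m n) 1 (α m n)
α-isLeast m n@(suc n′) n≤m =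
  least-isLeast (ExceedsLog? m n) 1 n (n , s≤s z≤n , n<1+n n , exceeds (m / n) (m≥n⇒m/n>0 n≤m))
  where
  exceeds : ∀ j → 0 < j → ⌊log₂ n ⌋ < A n j
  exceeds (suc j) _ = begin-strict
    ⌊log₂ n ⌋     ≤⟨ ⌊log₂n⌋≤n n ⟩
    n             <⟨ m<m+n n (s≤s z≤n) ⟩
    n + suc j     ≤⟨ A-large n′ j ⟩
    A n (suc j)   ∎
    where open ≤-Reasoning

------------------------------------------------------------------------
-- The machine model

-- A unit-cost random access machine with registers and arrays, each named and
-- indexed by ℕ (a program mentions only finitely many of them).  The only
-- arithmetic is ±1, so every value arising in t steps on a given program
-- exceeds the largest input value by at most t plus a constant: words of
-- O(log(t + m + n)) bits suffice, and nothing can be gained by computing with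
-- huge numbers.  Such successor RAMs are real-time equivalent to pointer
-- machines (Schönhage 1980), the model in which union-find is analysed.

data Exp : Set where
  lit  : ℕ → Exp
  reg  : ℕ → Exp
  _[_] : ℕ → Exp → Exp
  inc  : Exp → Exp
  dec  : Exp → Exp

data Test : Set where
  _==_ _<<_ : Exp → Exp → Test

infixr 5 _⨾_

data Program : Set where
  skip      : Program
  _≔_       : ℕ → Exp → Program
  _[_]≔_    : ℕ → Exp → Exp → Program
  _⨾_       : Program → Program → Program
  IF_THEN_ELSE_ : Test → Program → Program → Program
  WHILE_DO_ : Test → Program → Program

record State : Set where
  constructor state
  field
    regs : ℕ → ℕ
    arrs : ℕ → ℕ → ℕ

open State public

update : {X : Set} → (ℕ → X) → ℕ → X → ℕ → X
update f i x j = if i ≡ᵇ j then x else f j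

⟦_⟧ : Exp → State → ℕ
⟦ lit k ⟧   s = k
⟦ reg x ⟧   s = regs s x
⟦ a [ e ] ⟧ s = arrs s a (⟦ e ⟧ s)
⟦ inc e ⟧   s = suc (⟦ e ⟧ s)
⟦ dec e ⟧   s = pred (⟦ e ⟧ s)

⟦_⟧ᵗ : Test → State → Bool
⟦ e == e′ ⟧ᵗ s = ⟦ e ⟧ s ≡ᵇ ⟦ e′ ⟧ s
⟦ e << e′ ⟧ᵗ s = ⟦ e ⟧ s <ᵇ ⟦ e′ ⟧ s

setReg : ℕ → ℕ → State → State
setReg x v s = state (update (regs s) x v) (arrs s)

setCell : ℕ → ℕ → ℕ → State → State
setCell a i v s = state (regs s) (update (arrs s) a (update (arrs s a) i v))

cost : Exp → ℕ
cost (lit _)   = 1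
cost (reg _)   = 1
cost (_ [ e ]) = suc (cost e)
cost (inc e)   = suc (cost e)
cost (dec e)   = suc (cost e)

costᵗ : Test → ℕ
costᵗ (e == e′) = suc (cost e + cost e′)
costᵗ (e << e′) = suc (cost e + cost e′)

infix 4 ⟨_,_⟩⇓⟨_,_⟩

-- ⟨ p , s ⟩⇓⟨ s′ , t ⟩: started in s, the program p halts in s′ after t steps.
data ⟨_,_⟩⇓⟨_,_⟩ : Program → State → State → ℕ → Set where
  skip⇓ : ∀ {s} → ⟨ skip , s ⟩⇓⟨ s , 1 ⟩
  ≔⇓ : ∀ {x e s} → ⟨ x ≔ e , s ⟩⇓⟨ setReg x (⟦ e ⟧ s) s , suc (cost e) ⟩
  []≔⇓ : ∀ {a e e′ s} →
    ⟨ a [ e ]≔ e′ , s ⟩⇓⟨ setCell a (⟦ e ⟧ s) (⟦ e′ ⟧ s) s , suc (cost e + cost e′) ⟩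
  ⨾⇓ : ∀ {p q s s′ s″ t t′} →
    ⟨ p , s ⟩⇓⟨ s′ , t ⟩ → ⟨ q , s′ ⟩⇓⟨ s″ , t′ ⟩ → ⟨ p ⨾ q , s ⟩⇓⟨ s″ , t + t′ ⟩
  if-true⇓ : ∀ {b p q s s′ t} → ⟦ b ⟧ᵗ s ≡ true →
    ⟨ p , s ⟩⇓⟨ s′ , t ⟩ → ⟨ IF b THEN p ELSE q , s ⟩⇓⟨ s′ , costᵗ b + t ⟩
  if-false⇓ : ∀ {b p q s s′ t} → ⟦ b ⟧ᵗ s ≡ false →
    ⟨ q , s ⟩⇓⟨ s′ , t ⟩ → ⟨ IF b THEN p ELSE q , s ⟩⇓⟨ s′ , costᵗ b + t ⟩
  while-true⇓ : ∀ {b p s s′ s″ t t′} → ⟦ b ⟧ᵗ s ≡ true →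
    ⟨ p , s ⟩⇓⟨ s′ , t ⟩ → ⟨ WHILE b DO p , s′ ⟩⇓⟨ s″ , t′ ⟩ →
    ⟨ WHILE b DO p , s ⟩⇓⟨ s″ , costᵗ b + (t + t′) ⟩
  while-false⇓ : ∀ {b p s} → ⟦ b ⟧ᵗ s ≡ false →
    ⟨ WHILE b DO p , s ⟩⇓⟨ s , costᵗ b ⟩

fill : ∀ {m} → (Fin m → ℕ) → ℕ → ℕ
fill {m} f i with i <? m
... | yes i<m = f (fromℕ< i<m)
... | no  _   = 0

-- The input is an edge list: registers 0 and 1 hold n and m, and cells i of
-- arrays 0 and 1 hold the tail and the head of edge i.  All other memory is 0.
input : ∀ {n m} → Digraph n m → State
input {n} {m} G = state inputRegs inputArrs
  where
  inputRegs : ℕ → ℕ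
  inputRegs 0 = n
  inputRegs 1 = m
  inputRegs _ = 0
  inputArrs : ℕ → ℕ → ℕ
  inputArrs 0 = fill λ e → toℕ (proj₁ (ends G e))
  inputArrs 1 = fill λ e → toℕ (proj₂ (ends G e))
  inputArrs _ = λ _ → 0

-- The output is a set of edges, given by its characteristic vector in array 2.
output : ∀ m → State → Subset m
output m s = tabulate λ e → 0 <ᵇ arrs s 2 (toℕ e)

{-# OPTIONS --safe #-}

-- The algorithm runs in time O(m), so that α enters only through α ≥ 1.
--
-- Let T(v) be the subtree of v in a depth-first search tree rooted at vertex 0.
-- An arc leaving T(v) ends at a vertex preceding v in preorder; an arc entering
-- T(v) starts at a vertex following v in postorder.  In preorder, every vertex
-- v ≢ 0 that is on no ear yet starts one.  If an arc leaves T(v) from a proper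
-- descendant x of v, the ear is the tree path from v to x followed by that arc;
-- otherwise all arcs leaving T(v) start at v, and the ear is v followed by one
-- of them ("v is a singleton").  The solution consists of the n − 1 arcs of the
-- ears and of an entry for each ear, by default the tree arc into its first
-- vertex.  Two singletons can share one entry:
-- * If an arc enters T(z) at a vertex of T(v), where z is the closest singleton
--   above the singleton v, it serves as the entry of both.
-- * If x and z are singletons, and an arc from x leaves T(x) and enters T(z) at
--   a vertex whose closest singleton is z, it can be both the arc of the ear of
--   x and the entry of z.
-- Pairs are formed greedily; the F singletons that remain unpaired are "free".
-- All other ears and pairs balance-entry one entry on at least two vertices, so that
-- there are at most (n − 1 + F) / 2 entries, and 3 (n − 1) / 2 + F / 2 arcs.
-- Every solution has at least n − 1 arcs, and at least 2 F: it has an arc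
-- leaving T(z) and an arc entering T(z) for each free z, and these are
-- distinct because otherwise another pair would have been formed.
module Submission where

open import Defs
open import Data.Bool using (true; false; if_then_else_; T)
open import Data.Empty using (⊥)
open import Data.Fin using (Fin; toℕ; fromℕ<)
open import Data.Fin.Properties using (toℕ<n; toℕ-fromℕ<; fromℕ<-toℕ; toℕ-injective)
open import Data.Fin.Subset using (Subset; ∣_∣; _∈_)
open import Data.List using (List; []; _∷_)
open import Data.Nat
open import Data.Nat.Properties
open import Data.Nat.Solver using (module +-*-Solver)
open import Data.Product using (∃; ∃₂; Σ; _×_; _,_; proj₁; proj₂)
open import Data.Sum using (_⊎_; inj₁; inj₂)
open import Data.Unit using (⊤; tt)
open import Data.Vec using (tabulate; here; there) renaming ([] to []ᵥ; _∷_ to _∷ᵥ_)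
open import Data.Vec.Properties using (lookup∘tabulate; lookup⇒[]=)
open import Function using (_∘_)
open import Relation.Binary.Construct.Closure.ReflexiveTransitive using (Star; ε; _◅_; _◅◅_; gmap)
open import Relation.Binary.Definitions using (tri<; tri≈; tri>)
open import Relation.Binary.PropositionalEquality hiding ([_])
open import Relation.Nullary using (¬_; Dec; yes; no; does; contradiction)
open import Relation.Nullary.Decidable using (¬?; decidable-stable)
open import Relation.Unary using (Decidable)

-- Strong connectivity splits into two inductions. The last arc of an ear leads to an earlier vertex
-- in preorder, so every vertex reaches the root along ears; an entry comes from a later vertex in
-- postorder, so the root reaches every vertex. An entry of a singleton v may land anywhere in T(v):
-- the walk from there to the root must leave T(v), and it can do so only at v. This is why one arc
-- can serve two singletons. Greedy pairing suffices because no vertex becomes free again once it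
-- has been paired: each failed attempt to pair stays valid up to the lower bound. The closest
-- singleton is inherited from the parent in preorder, so each phase is a single pass and no set
-- union is involved. The constant is 3/2 + 1/4, from n - 1 ≤ OPT and F/2 ≤ OPT/4. All graph
-- arguments speak of functions on the natural numbers, as the arrays of the machine hold them.
-- Preserving an invariant under `update` is then literally the weakest precondition of a loop body.

≢0⇒>0 : ∀ {a} → a ≢ 0 → 0 < a
≢0⇒>0 {zero}  h = contradiction refl h
≢0⇒>0 {suc _} _ = s≤s z≤n

>0⇒≢0 : ∀ {a} → 0 < a → a ≢ 0
>0⇒≢0 (s≤s _) ()

-- Running times of loops with loop-free bodies

Holds Fails : Test → State → Set
Holds (e == e′) s = ⟦ e ⟧ s ≡ ⟦ e′ ⟧ s
Holds (e << e′) s = ⟦ e ⟧ s < ⟦ e′ ⟧ s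
Fails (e == e′) s = ⟦ e ⟧ s ≢ ⟦ e′ ⟧ s
Fails (e << e′) s = ⟦ e′ ⟧ s ≤ ⟦ e ⟧ s

decide : ∀ b s → (⟦ b ⟧ᵗ s ≡ true × Holds b s) ⊎ (⟦ b ⟧ᵗ s ≡ false × Fails b s)
decide (e == e′) s with ⟦ e ⟧ s ≡ᵇ ⟦ e′ ⟧ s in eq
... | true  = inj₁ (refl , ≡ᵇ⇒≡ _ _ (subst T (sym eq) tt))
... | false = inj₂ (refl , λ h → subst T eq (≡⇒≡ᵇ _ _ h))
decide (e << e′) s with ⟦ e ⟧ s <ᵇ ⟦ e′ ⟧ s in eq
... | true  = inj₁ (refl , <ᵇ⇒< _ _ (subst T (sym eq) tt))
... | false = inj₂ (refl , ≮⇒≥ (λ h → subst T eq (<⇒<ᵇ h)))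

-- For a concrete loop-free body this reduces to the postcondition at explicitly updated states, so
-- a proof about a body is a tuple with one component per branch.
wp : Program → (State → Set) → State → Set
wp skip                   Q s = Q s
wp (x ≔ e)                Q s = Q (setReg x (⟦ e ⟧ s) s)
wp (a [ e ]≔ e′)          Q s = Q (setCell a (⟦ e ⟧ s) (⟦ e′ ⟧ s) s)
wp (p ⨾ q)                Q s = wp p (wp q Q) s
wp (IF b THEN p ELSE q)   Q s = (Holds b s → wp p Q s) × (Fails b s → wp q Q s)
wp (WHILE _ DO _)         _ _ = ⊥

wp-mono : ∀ p {Q R : State → Set} {s} → (∀ {s′} → Q s′ → R s′) → wp p Q s → wp p R s
wp-mono skip                   f h = f h
wp-mono (_ ≔ _)                f h = f h
wp-mono (_ [ _ ]≔ _)           f h = f h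
wp-mono (p ⨾ q)                f h = wp-mono p (wp-mono q f) h
wp-mono (IF _ THEN p ELSE q)   f (h , h′) = (λ b → wp-mono p f (h b)) , (λ b → wp-mono q f (h′ b))

-- The value at WHILE is junk: wp excludes loops.
maxTime : Program → ℕ
maxTime skip                 = 1
maxTime (_ ≔ e)              = suc (cost e)
maxTime (_ [ e ]≔ e′)        = suc (cost e + cost e′)
maxTime (p ⨾ q)              = maxTime p + maxTime q
maxTime (IF b THEN p ELSE q) = costᵗ b + (maxTime p + maxTime q)
maxTime (WHILE _ DO _)       = 0

Run : Program → State → ℕ → (State → Set) → Set
Run p s k Q = ∃₂ λ s′ t → ⟨ p , s ⟩⇓⟨ s′ , t ⟩ × t ≤ k × Q s′

wp-sound : ∀ p {Q s} → wp p Q s → Run p s (maxTime p) Q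
wp-sound skip          h = _ , _ , skip⇓ , ≤-refl , h
wp-sound (x ≔ e)       h = _ , _ , ≔⇓ , ≤-refl , h
wp-sound (a [ e ]≔ e′) h = _ , _ , []≔⇓ , ≤-refl , h
wp-sound (p ⨾ q) h with wp-sound p h
... | _ , _ , r₁ , t₁ , h₁ with wp-sound q h₁
... | _ , _ , r₂ , t₂ , h₂ = _ , _ , ⨾⇓ r₁ r₂ , +-mono-≤ t₁ t₂ , h₂
wp-sound (IF b THEN p ELSE q) {s = s} (h , h′) with decide b s
... | inj₁ (eq , holds) with wp-sound p (h holds)
...   | _ , _ , r , t , h₁ =
  _ , _ , if-true⇓ eq r , +-monoʳ-≤ (costᵗ b) (≤-trans t (m≤m+n _ _)) , h₁
wp-sound (IF b THEN p ELSE q) {s = s} (h , h′) | inj₂ (eq , fails) with wp-sound q (h′ fails)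
...   | _ , _ , r , t , h₁ =
  _ , _ , if-false⇓ eq r , +-monoʳ-≤ (costᵗ b) (≤-trans t (m≤n+m _ (maxTime p))) , h₁

opaque
  -- Opaque, so that the costs of concrete loops remain symbolic constants.
  loopCost : Test → Program → ℕ
  loopCost b p = costᵗ b + maxTime p

  -- There are at most `k` iterations and one failing test at the end, each costing at most
  -- `loopCost b p`; the successor in `suc k` accounts for that last test.
  while-sound : ∀ b p (I : State → Set) (μ : State → ℕ) →
    (∀ {s} → I s → Holds b s → wp p (λ s′ → I s′ × μ s′ < μ s) s) →
    ∀ k {s} → I s → μ s ≤ k →
    Run (WHILE b DO p) s (loopCost b p * suc k) (λ s′ → I s′ × Fails b s′)
  while-sound b p I μ step k {s} Is μ≤k with decide b s
  ... | inj₂ (eq , fails) =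
    _ , _ , while-false⇓ eq ,
    ≤-trans (m≤m+n _ _) (m≤m*n (costᵗ b + maxTime p) (suc k)) , Is , fails
  ... | inj₁ (eq , holds) with wp-sound p (step Is holds)
  ...   | s₁ , t₁ , r₁ , t₁≤ , Is₁ , μ< with k
  ...     | zero   = contradiction (<-≤-trans μ< μ≤k) λ ()
  ...     | suc k′ with while-sound b p I μ step k′ Is₁ (s≤s⁻¹ (≤-trans μ< μ≤k))
  ...       | s₂ , t₂ , r₂ , t₂≤ , h =
    s₂ , _ , while-true⇓ eq r₁ r₂ , (begin
      costᵗ b + (t₁ + t₂)            ≡⟨ sym (+-assoc (costᵗ b) t₁ t₂) ⟩
      (costᵗ b + t₁) + t₂            ≤⟨ +-mono-≤ (+-monoʳ-≤ (costᵗ b) t₁≤) t₂≤ ⟩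
      c + c * suc k′                 ≡⟨ sym (*-suc c (suc k′)) ⟩
      c * suc (suc k′)               ∎) , h
    where
    open ≤-Reasoning
    c : ℕ
    c = costᵗ b + maxTime p

-- Padding by `suc K` gives every phase a cost of the form constant times the same number, so that
-- `run-then` only has to add constants.
run-straight : ∀ p {Q s} K → wp p Q s → Run p s (maxTime p * suc K) Q
run-straight p K h with wp-sound p h
... | s′ , t , r , t≤ , Q = s′ , t , r , ≤-trans t≤ (m≤m*n (maxTime p) (suc K)) , Q

run-then : ∀ {p q s} c d {K} {Q R : State → Set} → Run p s (c * K) Q → (∀ {s′} → Q s′ → Run q s′ (d * K) R) →
  Run (p ⨾ q) s ((c + d) * K) R
run-then c d {K} (_ , _ , r₁ , t₁ , h₁) f with f h₁
... | s₂ , _ , r₂ , t₂ , h₂ = s₂ , _ , ⨾⇓ r₁ r₂ ,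
  ≤-trans (+-mono-≤ t₁ t₂) (≤-reflexive (sym (*-distribʳ-+ K c d))) , h₂

run-map : ∀ {p s k} {Q R : State → Set} → (∀ {s′} → Q s′ → R s′) → Run p s k Q → Run p s k R
run-map f (s′ , t , r , t≤ , h) = s′ , t , r , t≤ , f h

-- Pointwise updates

update-≡ : ∀ {X : Set} (f : ℕ → X) i x → update f i x i ≡ x
update-≡ f i x with i ≡ᵇ i in eq
... | true  = refl
... | false = contradiction (subst T eq (≡⇒≡ᵇ i i refl)) λ ()

update-≢ : ∀ {X : Set} (f : ℕ → X) {i j} x → j ≢ i → update f i x j ≡ f j
update-≢ f {i} {j} x j≢i with i ≡ᵇ j in eq
... | true  = contradiction (sym (≡ᵇ⇒≡ i j (subst T (sym eq) tt))) j≢i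
... | false = refl

update-elim : ∀ {X : Set} (P : X → Set) (f : ℕ → X) i x j →
  (j ≡ i → P x) → (j ≢ i → P (f j)) → P (update f i x j)
update-elim P f i x j h h′ with j ≟ i
... | yes refl = subst P (sym (update-≡ f i x)) (h refl)
... | no j≢i   = subst P (sym (update-≢ f x j≢i)) (h′ j≢i)

-- Counting by sums

∑ : ℕ → (ℕ → ℕ) → ℕ
∑ zero    f = 0
∑ (suc k) f = ∑ k f + f k

[_≢0] : ℕ → ℕ
[ zero ≢0]  = 0
[ suc _ ≢0] = 1

[_≡0] : ℕ → ℕ
[ zero ≡0]  = 1
[ suc _ ≡0] = 0

[≢0]≤1 : ∀ a → [ a ≢0] ≤ 1
[≢0]≤1 zero    = z≤n
[≢0]≤1 (suc _) = ≤-refl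

[≢0]≡1 : ∀ {a} → a ≢ 0 → [ a ≢0] ≡ 1
[≢0]≡1 {zero}  h = contradiction refl h
[≢0]≡1 {suc _} _ = refl

∑-cong : ∀ k {f g} → (∀ j → j < k → f j ≡ g j) → ∑ k f ≡ ∑ k g
∑-cong zero    h = refl
∑-cong (suc k) h = cong₂ _+_ (∑-cong k λ j j<k → h j (m<n⇒m<1+n j<k)) (h k ≤-refl)

∑-mono : ∀ k {f g} → (∀ j → j < k → f j ≤ g j) → ∑ k f ≤ ∑ k g
∑-mono zero    h = z≤n
∑-mono (suc k) h = +-mono-≤ (∑-mono k λ j j<k → h j (m<n⇒m<1+n j<k)) (h k ≤-refl)

∑-mono-< : ∀ k {f g i} → i < k → (∀ j → j < k → f j ≤ g j) → f i < g i → ∑ k f < ∑ k g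
∑-mono-< (suc k) {i = i} i<k h lt with i ≟ k
... | yes refl = +-mono-≤-< (∑-mono k λ j j<k → h j (m<n⇒m<1+n j<k)) lt
... | no i≢k   = +-mono-<-≤
  (∑-mono-< k (≤∧≢⇒< (s≤s⁻¹ i<k) i≢k) (λ j j<k → h j (m<n⇒m<1+n j<k)) lt) (h k ≤-refl)

∑-0 : ∀ k → ∑ k (λ _ → 0) ≡ 0
∑-0 zero    = refl
∑-0 (suc k) = trans (+-identityʳ _) (∑-0 k)

∑-1 : ∀ k → ∑ k (λ _ → 1) ≡ k
∑-1 zero    = refl
∑-1 (suc k) = trans (+-comm _ 1) (cong suc (∑-1 k))

-- Comparing crosswise avoids truncated subtraction when a single summand changes.
∑-agree : ∀ k {f g i} → i < k → (∀ j → j ≢ i → g j ≡ f j) → ∑ k g + f i ≡ ∑ k f + g i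
∑-agree (suc k) {f} {g} {i} i<k h with i ≟ k
... | yes refl = begin
  ∑ k g + g k + f k   ≡⟨ cong (λ a → a + g k + f k) (∑-cong k λ j j<k → h j (<⇒≢ j<k)) ⟩
  ∑ k f + g k + f k   ≡⟨ +-assoc (∑ k f) (g k) (f k) ⟩
  ∑ k f + (g k + f k) ≡⟨ cong (∑ k f +_) (+-comm (g k) (f k)) ⟩
  ∑ k f + (f k + g k) ≡⟨ sym (+-assoc (∑ k f) (f k) (g k)) ⟩
  ∑ k f + f k + g k   ∎
  where open ≡-Reasoning
... | no i≢k = begin
  ∑ k g + g k + f i   ≡⟨ +-assoc (∑ k g) (g k) (f i) ⟩
  ∑ k g + (g k + f i) ≡⟨ cong (∑ k g +_) (+-comm (g k) (f i)) ⟩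
  ∑ k g + (f i + g k) ≡⟨ sym (+-assoc (∑ k g) (f i) (g k)) ⟩
  ∑ k g + f i + g k   ≡⟨ cong₂ _+_ (∑-agree k (≤∧≢⇒< (s≤s⁻¹ i<k) i≢k) h) (h k (≢-sym i≢k)) ⟩
  ∑ k f + g i + f k   ≡⟨ +-assoc (∑ k f) (g i) (f k) ⟩
  ∑ k f + (g i + f k) ≡⟨ cong (∑ k f +_) (+-comm (g i) (f k)) ⟩
  ∑ k f + (f k + g i) ≡⟨ sym (+-assoc (∑ k f) (f k) (g i)) ⟩
  ∑ k f + f k + g i   ∎
  where open ≡-Reasoning

∑-update : ∀ (w : ℕ → ℕ) k f {i} x → i < k →
  ∑ k (w ∘ update f i x) + w (f i) ≡ ∑ k (w ∘ f) + w x
∑-update w k f {i} x i<k = trans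
  (∑-agree k {w ∘ f} {w ∘ update f i x} i<k λ j j≢i → cong w (update-≢ f x j≢i))
  (cong (λ a → ∑ k (w ∘ f) + w a) (update-≡ f i x))

∑-set : ∀ k f {i} x → i < k → f i ≡ 0 → x ≢ 0 →
  ∑ k ([_≢0] ∘ update f i x) ≡ suc (∑ k ([_≢0] ∘ f))
∑-set k f {i} x i<k fi≡0 x≢0 = begin
  ∑ k (w ∘ update f i x)           ≡⟨ sym (+-identityʳ _) ⟩
  ∑ k (w ∘ update f i x) + 0       ≡⟨ cong (λ a → ∑ k (w ∘ update f i x) + w a) (sym fi≡0) ⟩
  ∑ k (w ∘ update f i x) + w (f i) ≡⟨ ∑-update w k f x i<k ⟩
  ∑ k (w ∘ f) + w x                ≡⟨ cong (∑ k (w ∘ f) +_) ([≢0]≡1 x≢0) ⟩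
  ∑ k (w ∘ f) + 1                  ≡⟨ +-comm _ 1 ⟩
  suc (∑ k (w ∘ f))                ∎
  where open ≡-Reasoning ; w = [_≢0]

∑-clear : ∀ k f {i} → i < k → f i ≢ 0 →
  suc (∑ k ([_≢0] ∘ update f i 0)) ≡ ∑ k ([_≢0] ∘ f)
∑-clear k f {i} i<k fi≢0 = begin
  suc (∑ k (w ∘ update f i 0))     ≡⟨ +-comm 1 _ ⟩
  ∑ k (w ∘ update f i 0) + 1       ≡⟨ cong (∑ k (w ∘ update f i 0) +_) (sym ([≢0]≡1 fi≢0)) ⟩
  ∑ k (w ∘ update f i 0) + w (f i) ≡⟨ ∑-update w k f 0 i<k ⟩
  ∑ k (w ∘ f) + 0                  ≡⟨ +-identityʳ _ ⟩
  ∑ k (w ∘ f)                      ∎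
  where open ≡-Reasoning ; w = [_≢0]

∑-reset : ∀ k f {i} x → i < k → f i ≢ 0 → x ≢ 0 →
  ∑ k ([_≢0] ∘ update f i x) ≡ ∑ k ([_≢0] ∘ f)
∑-reset k f {i} x i<k fi≢0 x≢0 = +-cancelʳ-≡ 1 _ _ (begin
  ∑ k (w ∘ update f i x) + 1       ≡⟨ cong (∑ k (w ∘ update f i x) +_) (sym ([≢0]≡1 fi≢0)) ⟩
  ∑ k (w ∘ update f i x) + w (f i) ≡⟨ ∑-update w k f x i<k ⟩
  ∑ k (w ∘ f) + w x                ≡⟨ cong (∑ k (w ∘ f) +_) ([≢0]≡1 x≢0) ⟩
  ∑ k (w ∘ f) + 1                  ∎)
  where open ≡-Reasoning ; w = [_≢0]

∑-update-≤ : ∀ k f i x → ∑ k ([_≢0] ∘ update f i x) ≤ suc (∑ k ([_≢0] ∘ f))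
∑-update-≤ k f i x with i <? k
... | no i≮k = m≤n⇒m≤1+n (≤-reflexive
  (∑-cong k λ j j<k → cong [_≢0] (update-≢ f {i} x λ j≡i → i≮k (subst (_< k) j≡i j<k))))
... | yes i<k = begin
  ∑ k (w ∘ update f i x)           ≤⟨ m≤m+n _ _ ⟩
  ∑ k (w ∘ update f i x) + w (f i) ≡⟨ ∑-update w k f x i<k ⟩
  ∑ k (w ∘ f) + w x                ≤⟨ +-monoʳ-≤ _ ([≢0]≤1 x) ⟩
  ∑ k (w ∘ f) + 1                  ≡⟨ +-comm _ 1 ⟩
  suc (∑ k (w ∘ f))                ∎
  where
  open ≤-Reasoning
  w = [_≢0]

-- Q′ is what remains of Q after taking out one element for each member of P.
pigeonhole : ∀ N (P Q : ℕ → ℕ) m (R : ℕ → ℕ → Set) →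
  (∀ i → i < N → P i ≢ 0 → ∃ λ e → e < m × Q e ≢ 0 × R i e) →
  (∀ i j e → R i e → R j e → i ≡ j) →
  ∃ λ Q′ → ∑ N ([_≢0] ∘ P) + ∑ m ([_≢0] ∘ Q′) ≡ ∑ m ([_≢0] ∘ Q) ×
           (∀ e → Q e ≢ 0 → (∀ i → i < N → P i ≢ 0 → ¬ R i e) → Q′ e ≢ 0)
pigeonhole zero    P Q m R h inj = Q , refl , λ _ q _ → q
pigeonhole (suc N) P Q m R h inj
  with pigeonhole N P Q m R (λ i i<N → h i (m<n⇒m<1+n i<N)) inj
... | Q′ , eq , keep with P N in PN
...   | zero = Q′ , trans (cong (_+ ∑ m ([_≢0] ∘ Q′)) (+-identityʳ (∑ N ([_≢0] ∘ P)))) eq ,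
  λ e q ne → keep e q λ i i<N → ne i (m<n⇒m<1+n i<N)
...   | suc _ with h N ≤-refl (λ p → contradiction (trans (sym PN) p) λ ())
...     | a , a<m , Qa , Ra = update Q′ a 0 , eq′ , λ e q ne → update-elim (_≢ 0) Q′ a 0 e
    (λ e≡ _ → ne N ≤-refl PN≢0 (subst (R N) (sym e≡) Ra)) (λ _ → keep e q λ i i<N → ne i (m<n⇒m<1+n i<N))
  where
  PN≢0 : P N ≢ 0
  PN≢0 p = contradiction (trans (sym PN) p) λ ()
  Q′a : Q′ a ≢ 0
  Q′a = keep a Qa λ i i<N _ Ri → <⇒≢ i<N (inj i N a Ri Ra)
  eq′ = begin
    ∑ N ([_≢0] ∘ P) + 1 + ∑ m ([_≢0] ∘ update Q′ a 0)   ≡⟨ +-assoc (∑ N ([_≢0] ∘ P)) 1 _ ⟩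
    ∑ N ([_≢0] ∘ P) + suc (∑ m ([_≢0] ∘ update Q′ a 0)) ≡⟨ cong (∑ N ([_≢0] ∘ P) +_) (∑-clear m Q′ a<m Q′a) ⟩
    ∑ N ([_≢0] ∘ P) + ∑ m ([_≢0] ∘ Q′)                  ≡⟨ eq ⟩
    ∑ m ([_≢0] ∘ Q)                                     ∎
    where open ≡-Reasoning

-- Depth-first search

Arc : (m : ℕ) (tl hd : ℕ → ℕ) → (ℕ → Set) → ℕ → ℕ → Set
Arc m tl hd S u v = ∃ λ e → e < m × S e × tl e ≡ u × hd e ≡ v

-- With `P` a subtree, or the complement of a subtree or of a vertex, this produces the arcs that
-- any strongly connected solution must contain.
crossing : ∀ {m} {tl hd : ℕ → ℕ} {S : ℕ → Set} {P : ℕ → Set} → Decidable P → ∀ {u v} →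
  Star (Arc m tl hd S) u v → P u → ¬ P v → ∃ λ e → e < m × S e × P (tl e) × ¬ P (hd e)
crossing P? ε Pu ¬Pv = contradiction Pu ¬Pv
crossing {hd = hd} P? ((e , e<m , Se , refl , refl) ◅ w) Pu ¬Pv with P? (hd e)
... | yes Ph = crossing P? w Ph ¬Pv
... | no ¬Ph = e , e<m , Se , Pu , ¬Ph

record Graph (n m : ℕ) (tl hd : ℕ → ℕ) : Set where
  field
    n>0       : 0 < n
    tl<n      : ∀ e → e < m → tl e < n
    hd<n      : ∀ e → e < m → hd e < n
    connected : ∀ u v → u < n → v < n → Star (Arc m tl hd λ _ → ⊤) u v

vertices≤arcs : ∀ {n m tl hd} → Graph n m tl hd → (X : ℕ → ℕ) →
  (∀ u v → u < n → v < n → Star (Arc m tl hd λ e → X e ≢ 0) u v) → n ≤ suc (∑ m ([_≢0] ∘ X))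
vertices≤arcs {zero}      G X conn = z≤n
-- The identity serves as the indicator of the vertices other than the root; each of them is the
-- head of an arc of its own.
vertices≤arcs {n@(suc k)} {m} {tl} {hd} G X conn with pigeonhole n (λ v → v) X m (λ v e → hd e ≡ v) in-arc
                                             (λ i j e a b → trans (sym a) b)
  where
  in-arc : ∀ v → v < n → v ≢ 0 → ∃ λ e → e < m × X e ≢ 0 × hd e ≡ v
  in-arc v v<n v≢0 with crossing (λ x → ¬? (x ≟ v)) (conn 0 v (Graph.n>0 G) v<n) (≢-sym v≢0) (λ ne → ne refl)
  ... | e , e<m , Xe , _ , ¬ne = e , e<m , Xe , decidable-stable (hd e ≟ v) ¬ne
... | X′ , eq , _ = s≤s (subst (_≤ ∑ m ([_≢0] ∘ X)) (nonzero k) (subst (∑ n [_≢0] ≤_) eq (m≤m+n _ _)))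
  where
  nonzero : ∀ k → ∑ (suc k) [_≢0] ≡ k
  nonzero zero    = refl
  nonzero (suc k) = trans (cong (_+ 1) (nonzero k)) (+-comm k 1)

-- Each list is in decreasing order of arc numbers, stored one too high. Inequalities therefore
-- replace list membership: `e < first (tl e)` puts arc `e` in the list from `first` onwards, and
-- `next-above` says that following a link skips no arc with the same tail.
record Lists (tl : ℕ → ℕ) (i : ℕ) (first next : ℕ → ℕ) : Set where
  field
    first-above : ∀ e → e < i → e < first (tl e)
    first-arc   : ∀ v p → first v ≡ suc p → p < i × tl p ≡ v
    next-above  : ∀ e e′ → e < i → e′ < e → tl e′ ≡ tl e → e′ < next e
    next-arc    : ∀ e p → e < i → next e ≡ suc p → p < e × tl p ≡ tl e

lists-step : ∀ {tl i first next} → Lists tl i first next →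
  Lists tl (suc i) (update first (tl i) (suc i)) (update next i (first (tl i)))
lists-step {tl} {i} {first} {next} L = record
  { first-above = λ e e≤i → update-elim (e <_) first (tl i) (suc i) (tl e)
      (λ _ → e≤i)
      (λ ne → first-above e (≤∧≢⇒< (s≤s⁻¹ e≤i) λ e≡i → ne (cong tl e≡i)))
  ; first-arc = λ v p → update-elim (λ x → x ≡ suc p → p < suc i × tl p ≡ v) first (tl i) (suc i) v
      (λ v≡ eq → subst (λ x → x < suc i × tl x ≡ v) (suc-injective eq) (≤-refl , sym v≡))
      (λ _ eq → let (lt , t) = first-arc v p eq in m<n⇒m<1+n lt , t)
  ; next-above = λ e e′ e≤i e′<e t → update-elim (e′ <_) next i (first (tl i)) e
      (λ e≡i → subst (λ x → e′ < first x) (trans t (cong tl e≡i))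
        (first-above e′ (subst (e′ <_) e≡i e′<e)))
      (λ ne → next-above e e′ (≤∧≢⇒< (s≤s⁻¹ e≤i) ne) e′<e t)
  ; next-arc = λ e p e≤i → update-elim (λ x → x ≡ suc p → p < e × tl p ≡ tl e) next i (first (tl i)) e
      (λ e≡i eq → let (lt , t) = first-arc (tl i) p eq
        in subst (p <_) (sym e≡i) lt , trans t (cong tl (sym e≡i)))
      (λ ne eq → next-arc e p (≤∧≢⇒< (s≤s⁻¹ e≤i) ne) eq)
  }
  where open Lists L

lists-start : ∀ {tl first next} → (∀ v → first v ≡ 0) → Lists tl 0 first next
lists-start z = record
  { first-above = λ _ ()
  ; first-arc = λ v p eq → contradiction (trans (sym (z v)) eq) λ ()
  ; next-above = λ _ _ ()
  ; next-arc = λ _ _ ()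
  }

-- A vertex is undiscovered if `pre v ≡ 0`, closed if `post v ≢ 0`, and open otherwise. By `gap`,
-- whatever is numbered between a parent and its child has closed; `contiguous` makes subtrees
-- intervals of the preorder. Together with `par-open` they take the place of a recursion stack.
-- `current` is conditional because `c` is meaningless once the root has closed.
record Search (n m : ℕ) (tl hd first pre ord par post : ℕ → ℕ) (count fin c : ℕ) : Set where
  field
    pre≤count  : ∀ v → v < n → pre v ≤ count
    count+     : count + ∑ n ([_≡0] ∘ pre) ≡ n
    ord-pre    : ∀ v → v < n → pre v ≢ 0 → ord (pre v) ≡ v
    ord<n      : ∀ k → 0 < k → k ≤ count → ord k < n
    pre-ord    : ∀ k → 0 < k → k ≤ count → pre (ord k) ≡ k
    pre-root   : pre 0 ≡ 1
    post≤fin   : ∀ v → v < n → post v ≤ fin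
    post⇒pre   : ∀ v → v < n → post v ≢ 0 → pre v ≢ 0
    par-arc    : ∀ v → v < n → pre v ≢ 0 → v ≢ 0 → par v < m × hd (par v) ≡ v
    par-pre    : ∀ v → v < n → pre v ≢ 0 → v ≢ 0 → pre (tl (par v)) ≢ 0
    par-<      : ∀ v → v < n → pre v ≢ 0 → v ≢ 0 → pre (tl (par v)) < pre v
    par-open   : ∀ v → v < n → pre v ≢ 0 → v ≢ 0 → post v ≡ 0 → post (tl (par v)) ≡ 0
    gap        : ∀ v z → v < n → pre v ≢ 0 → v ≢ 0 → z < n → pre (tl (par v)) < pre z → pre z < pre v →
                 post z ≢ 0 × (post v ≢ 0 → post z < post v)
    contiguous : ∀ v u x → v < n → u < n → x < n → post v ≢ 0 → post x ≢ 0 →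
                 pre v < pre u → pre u ≤ pre x → post x ≤ post v → post u ≢ 0 × post u < post v
    closed     : ∀ e → e < m → post (tl e) ≢ 0 → pre (hd e) ≢ 0 ×
                 (pre (tl e) < pre (hd e) → post (hd e) ≢ 0 × post (hd e) < post (tl e))
    first-arc  : ∀ v p → first v ≡ suc p → p < m × tl p ≡ v
    scanned    : ∀ e → e < m → first (tl e) ≤ e → pre (hd e) ≢ 0
    current    : post 0 ≡ 0 → c < n × pre c ≢ 0 × post c ≡ 0 ×
                 (∀ x → x < n → pre c < pre x → post x ≢ 0)

  pre-injective : ∀ u v → u < n → v < n → pre u ≢ 0 → pre u ≡ pre v → u ≡ v
  pre-injective u v u<n v<n pu eq =
    trans (sym (ord-pre u u<n pu)) (trans (cong ord eq) (ord-pre v v<n (subst (_≢ 0) eq pu)))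

module _ {n m tl hd} (G : Graph n m tl hd) where
  open Graph G

  search-finish : ∀ {first pre ord par post count fin c} →
    Search n m tl hd first pre ord par post count fin c → post 0 ≡ 0 → first c ≡ 0 →
    Search n m tl hd first pre ord par (update post c (suc fin)) count (suc fin) (tl (par c))
  search-finish {first} {pre} {ord} {par} {post} {count} {fin} {c} S open₀ first-c = record
    { pre≤count = pre≤count ; count+ = count+ ; ord-pre = ord-pre ; ord<n = ord<n
    ; pre-ord = pre-ord ; pre-root = pre-root
    ; post≤fin = λ v v<n → el (_≤ suc fin) v (λ _ → ≤-refl) (λ _ → m≤n⇒m≤1+n (post≤fin v v<n))
    ; post⇒pre = λ v v<n → el (λ x → x ≢ 0 → pre v ≢ 0) v
        (λ v≡c _ → subst (λ x → pre x ≢ 0) (sym v≡c) pre-c) (λ _ → post⇒pre v v<n)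
    ; par-arc = par-arc ; par-pre = par-pre ; par-< = par-<
    ; par-open = λ v v<n pv v≢0 → el (λ x → x ≡ 0 → post′ (tl (par v)) ≡ 0) v
        (λ _ ())
        (λ _ open-v → el (_≡ 0) (tl (par v))
          (λ eq → contradiction open-v
            (largest v v<n (subst (λ x → pre x < pre v) eq (par-< v v<n pv v≢0))))
          (λ _ → par-open v v<n pv v≢0 open-v))
    ; gap = λ v z v<n pv v≢0 z<n lt lt′ →
        let (fz , q) = gap v z v<n pv v≢0 z<n lt lt′
            z≢c = closed⇒≢c fz
        in subst (_≢ 0) (sym (post′-≢ z≢c)) fz ,
           subst (λ x → post′ v ≢ 0 → x < post′ v) (sym (post′-≢ z≢c))
             (el (λ x → x ≢ 0 → post z < x) v (λ _ _ → s≤s (post≤fin z z<n)) (λ _ → q))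
    ; contiguous = contig
    ; closed = closed′
    ; first-arc = first-arc ; scanned = scanned
    ; current = cur
    }
    where
    open Search S
    post′ = update post c (suc fin)
    el : ∀ (P : ℕ → Set) j → (j ≡ c → P (suc fin)) → (j ≢ c → P (post j)) → P (post′ j)
    el P j = update-elim P post c (suc fin) j
    c<n = proj₁ (current open₀)
    pre-c = proj₁ (proj₂ (current open₀))
    open-c = proj₁ (proj₂ (proj₂ (current open₀)))
    largest = proj₂ (proj₂ (proj₂ (current open₀)))
    closed⇒≢c : ∀ {z} → post z ≢ 0 → z ≢ c
    closed⇒≢c fz z≡c = fz (trans (cong post z≡c) open-c)
    post′-≢ : ∀ {z} → z ≢ c → post′ z ≡ post z
    post′-≢ = update-≢ post (suc fin)
    post′-c : post′ c ≡ suc fin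
    post′-c = update-≡ post c (suc fin)
    lift-closed : ∀ {u k} → post u ≢ 0 × post u < k → post′ u ≢ 0 × post′ u < k
    lift-closed {u} {k} h = subst (λ x → x ≢ 0 × x < k) (sym (post′-≢ (closed⇒≢c (proj₁ h)))) h
    contig : ∀ v u x → v < n → u < n → x < n → post′ v ≢ 0 → post′ x ≢ 0 →
      pre v < pre u → pre u ≤ pre x → post′ x ≤ post′ v → post′ u ≢ 0 × post′ u < post′ v
    contig v u x v<n u<n x<n fv fx v<u u≤x x≤v with v ≟ c
    -- Everything after `c` in preorder has closed already, and `c` gets the largest postorder
    -- number so far.
    ... | yes refl = lift-closed (largest u u<n v<u ,
      subst (post u <_) (sym post′-c) (s≤s (post≤fin u u<n)))
    ... | no v≢c with x ≟ c
    ...   | yes refl = contradiction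
      (≤-trans (subst₂ _≤_ post′-c (post′-≢ v≢c) x≤v) (post≤fin v v<n)) (<-irrefl refl)
    ...   | no x≢c = lift-closed (subst (λ y → post u ≢ 0 × post u < y) (sym (post′-≢ v≢c))
      (contiguous v u x v<n u<n x<n (subst (_≢ 0) (post′-≢ v≢c) fv) (subst (_≢ 0) (post′-≢ x≢c) fx)
        v<u u≤x (subst₂ _≤_ (post′-≢ x≢c) (post′-≢ v≢c) x≤v)))
    closed′ : ∀ e → e < m → post′ (tl e) ≢ 0 → pre (hd e) ≢ 0 ×
      (pre (tl e) < pre (hd e) → post′ (hd e) ≢ 0 × post′ (hd e) < post′ (tl e))
    closed′ e e<m ft with tl e ≟ c
    ... | yes eq = scanned e e<m (subst (_≤ e) (sym (trans (cong first eq) first-c)) z≤n) ,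
      λ lt → lift-closed (largest (hd e) (hd<n e e<m) (subst (λ x → pre x < pre (hd e)) eq lt) ,
        subst (post (hd e) <_) (sym (trans (cong post′ eq) post′-c)) (s≤s (post≤fin (hd e) (hd<n e e<m))))
    ... | no ne =
      let (ph , h) = closed e e<m (subst (_≢ 0) (post′-≢ ne) ft)
      in ph , λ lt → lift-closed (subst (λ y → post (hd e) ≢ 0 × post (hd e) < y) (sym (post′-≢ ne)) (h lt))
    cur : post′ 0 ≡ 0 → tl (par c) < n × pre (tl (par c)) ≢ 0 × post′ (tl (par c)) ≡ 0 ×
      (∀ x → x < n → pre (tl (par c)) < pre x → post′ x ≢ 0)
    cur open₀′ = tl<n (par c) (proj₁ (par-arc c c<n pre-c c≢0)) , par-pre c c<n pre-c c≢0 ,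
      trans (post′-≢ p≢c) (par-open c c<n pre-c c≢0 open-c) , done
      where
      -- Closing the root would end the search, so `c` has a parent to return to.
      c≢0 : c ≢ 0
      c≢0 c≡0 = contradiction (trans (sym (trans (cong post′ (sym c≡0)) post′-c)) open₀′) λ ()
      p≢c : tl (par c) ≢ c
      p≢c eq = <-irrefl (cong pre eq) (par-< c c<n pre-c c≢0)
      -- Vertices between the parent and `c` have closed by `gap`, those after `c` by `largest`, and
      -- `c` closes now.
      done : ∀ x → x < n → pre (tl (par c)) < pre x → post′ x ≢ 0
      done x x<n lt with <-cmp (pre x) (pre c)
      ... | tri< x<c _ _ = el (_≢ 0) x (λ _ ()) (λ _ → proj₁ (gap c x c<n pre-c c≢0 x<n lt x<c))
      ... | tri≈ _ x≈c _ = el (_≢ 0) x (λ _ ())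
        (λ x≢c → contradiction (pre-injective x c x<n c<n (>0⇒≢0 (≤-<-trans z≤n lt)) x≈c) x≢c)
      ... | tri> _ _ c<x = el (_≢ 0) x (λ _ ()) (λ _ → largest x x<n c<x)

  module _ {first next next₀ pre ord par post count fin c}
    (L : Lists tl m next₀ next) (S : Search n m tl hd first pre ord par post count fin c)
    (open₀ : post 0 ≡ 0) (first-c : first c ≢ 0) where
    private
      p = pred (first c)
      first-c≡ : first c ≡ suc p
      first-c≡ = sym (suc-pred (first c) {{≢-nonZero first-c}})
    open Search S
    private
      p<m = proj₁ (first-arc c p first-c≡)
      tl-p = proj₂ (first-arc c p first-c≡)
      y = hd p
      first′ = update first c (next p)

    search-first-arc : ∀ v q → first′ v ≡ suc q → q < m × tl q ≡ v
    search-first-arc v q = update-elim (λ x → x ≡ suc q → q < m × tl q ≡ v) first c (next p) v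
      (λ v≡c eq → let (lt , t) = Lists.next-arc L p q p<m eq
        in <-trans lt p<m , trans t (trans tl-p (sym v≡c)))
      (λ _ → first-arc v q)

    -- No arc with tail `c` has a number from `next p` up to but excluding `p`, so advancing the
    -- pointer passes only `p`.
    search-scanned : ∀ e → e < m → first′ (tl e) ≤ e → e ≢ p → pre (hd e) ≢ 0
    search-scanned e e<m = update-elim (λ x → x ≤ e → e ≢ p → pre (hd e) ≢ 0) first c (next p) (tl e)
      (λ t le e≢p → scanned e e<m (subst (_≤ e) (sym (trans (cong first t) first-c≡))
        (≤∧≢⇒< (≮⇒≥ λ e<p → <⇒≱ (Lists.next-above L p e p<m e<p (trans t (sym tl-p))) le) (≢-sym e≢p))))
      (λ _ le _ → scanned e e<m le)

    search-skip : pre (hd (pred (first c))) ≢ 0 →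
      Search n m tl hd (update first c (next (pred (first c)))) pre ord par post count fin c
    search-skip py = record
      { pre≤count = pre≤count ; count+ = count+ ; ord-pre = ord-pre ; ord<n = ord<n
      ; pre-ord = pre-ord ; pre-root = pre-root ; post≤fin = post≤fin ; post⇒pre = post⇒pre
      ; par-arc = par-arc ; par-pre = par-pre ; par-< = par-< ; par-open = par-open ; gap = gap
      ; contiguous = contiguous ; closed = closed
      ; first-arc = search-first-arc
      ; scanned = λ e e<m le → scan e e<m le
      ; current = current
      }
      where
      scan : ∀ e → e < m → first′ (tl e) ≤ e → pre (hd e) ≢ 0
      scan e e<m le with e ≟ p
      ... | yes refl = py
      ... | no e≢p   = search-scanned e e<m le e≢p

    -- The new vertex gets the largest preorder number and is open, so the conditions on closed
    -- vertices persist; whatever lies between its parent `c` and itself in preorder is closed by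
    -- `largest`.
    search-discover : pre (hd (pred (first c))) ≡ 0 →
      Search n m tl hd (update first c (next (pred (first c))))
        (update pre (hd (pred (first c))) (suc count)) (update ord (suc count) (hd (pred (first c))))
        (update par (hd (pred (first c))) (pred (first c))) post (suc count) fin (hd (pred (first c)))
    search-discover py = record
      { pre≤count = λ v v<n → el (_≤ suc count) v (λ _ → ≤-refl) (λ _ → m≤n⇒m≤1+n (pre≤count v v<n))
      ; count+ = count+′
      ; ord-pre = λ v v<n → el (λ x → x ≢ 0 → ord′ x ≡ v) v
          (λ v≡y _ → trans (update-≡ ord (suc count) y) (sym v≡y))
          (λ _ pv → trans (update-≢ ord y (<⇒≢ (s≤s (pre≤count v v<n)))) (ord-pre v v<n pv))
      ; ord<n = λ k k>0 k≤ → update-elim (_< n) ord (suc count) y k (λ _ → y<n)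
          (λ ne → ord<n k k>0 (s≤s⁻¹ (≤∧≢⇒< k≤ ne)))
      ; pre-ord = λ k k>0 k≤ → update-elim (λ x → pre′ x ≡ k) ord (suc count) y k
          (λ k≡ → trans pre′-y (sym k≡))
          (λ ne → let k≤c = s≤s⁻¹ (≤∧≢⇒< k≤ ne) in
            trans (pre′-old (subst (_≢ 0) (sym (pre-ord k k>0 k≤c)) (>0⇒≢0 k>0))) (pre-ord k k>0 k≤c))
      ; pre-root = trans (pre′-old (subst (_≢ 0) (sym pre-root) λ ())) pre-root
      ; post≤fin = post≤fin
      ; post⇒pre = λ v v<n fv → mono (post⇒pre v v<n fv)
      ; par-arc = λ v v<n pv v≢0 → elp (λ x → x < m × hd x ≡ v) v
          (λ v≡y → p<m , sym v≡y) (λ v≢y → par-arc v v<n (old v≢y pv) v≢0)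
      ; par-pre = λ v v<n pv v≢0 → elp (λ x → pre′ (tl x) ≢ 0) v
          (λ _ → subst (λ x → pre′ x ≢ 0) (sym tl-p) (mono pre-c))
          (λ v≢y → mono (par-pre v v<n (old v≢y pv) v≢0))
      ; par-< = λ v v<n pv v≢0 → elp (λ x → pre′ (tl x) < pre′ v) v
          (λ v≡y → subst₂ _<_ (sym (trans (cong pre′ tl-p) (pre′-old pre-c)))
             (sym (trans (cong pre′ v≡y) pre′-y)) (s≤s (pre≤count c c<n)))
          (λ v≢y → subst₂ _<_ (sym (pre′-old (par-pre v v<n (old v≢y pv) v≢0))) (sym (pre′-≢ v≢y))
             (par-< v v<n (old v≢y pv) v≢0))
      ; par-open = λ v v<n pv v≢0 ov → elp (λ x → post (tl x) ≡ 0) v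
          (λ _ → trans (cong post tl-p) open-c)
          (λ v≢y → par-open v v<n (old v≢y pv) v≢0 ov)
      ; gap = gap′
      ; contiguous = λ v u x v<n u<n x<n fv fx v<u u≤x →
          let pv = pre′-old (post⇒pre v v<n fv)
              px = pre′-old (post⇒pre x x<n fx)
              u≢y = λ u≡y → <⇒≱ (s≤s (pre≤count x x<n))
                      (subst₂ _≤_ (trans (cong pre′ u≡y) pre′-y) px u≤x)
              pu = pre′-≢ u≢y
          in contiguous v u x v<n u<n x<n fv fx (subst₂ _<_ pv pu v<u) (subst₂ _≤_ pu px u≤x)
      ; closed = λ e e<m ft → let (ph , h) = closed e e<m ft in mono ph ,
          λ lt → h (subst₂ _<_ (pre′-old (post⇒pre (tl e) (tl<n e e<m) ft)) (pre′-old ph) lt)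
      ; first-arc = search-first-arc
      ; scanned = scan
      ; current = λ _ → y<n , subst (_≢ 0) (sym pre′-y) (λ ()) , open-y ,
          λ x x<n lt → contradiction (subst (_< pre′ x) pre′-y lt) (≤⇒≯ (el (_≤ suc count) x (λ _ → ≤-refl)
            (λ _ → m≤n⇒m≤1+n (pre≤count x x<n))))
      }
      where
      pre′ = update pre y (suc count)
      ord′ = update ord (suc count) y
      par′ = update par y p
      y<n = hd<n p p<m
      c<n = proj₁ (current open₀)
      pre-c = proj₁ (proj₂ (current open₀))
      open-c = proj₁ (proj₂ (proj₂ (current open₀)))
      largest = proj₂ (proj₂ (proj₂ (current open₀)))
      open-y : post y ≡ 0
      open-y with post y ≟ 0
      ... | yes eq = eq
      ... | no ne  = contradiction py (post⇒pre y y<n ne)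
      el : ∀ (P : ℕ → Set) j → (j ≡ y → P (suc count)) → (j ≢ y → P (pre j)) → P (pre′ j)
      el P j = update-elim P pre y (suc count) j
      elp : ∀ (P : ℕ → Set) j → (j ≡ y → P p) → (j ≢ y → P (par j)) → P (par′ j)
      elp P j = update-elim P par y p j
      pre′-y : pre′ y ≡ suc count
      pre′-y = update-≡ pre y (suc count)
      pre′-≢ : ∀ {v} → v ≢ y → pre′ v ≡ pre v
      pre′-≢ = update-≢ pre (suc count)
      pre′-old : ∀ {v} → pre v ≢ 0 → pre′ v ≡ pre v
      pre′-old pv = pre′-≢ λ v≡y → pv (trans (cong pre v≡y) py)
      old : ∀ {v} → v ≢ y → pre′ v ≢ 0 → pre v ≢ 0
      old v≢y = subst (_≢ 0) (pre′-≢ v≢y)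
      mono : ∀ {v} → pre v ≢ 0 → pre′ v ≢ 0
      mono pv = subst (_≢ 0) (sym (pre′-old pv)) pv
      count+′ : suc count + ∑ n ([_≡0] ∘ pre′) ≡ n
      count+′ = trans (sym (+-suc count _)) (trans (cong (count +_) (begin
        suc (∑ n (w ∘ pre′))      ≡⟨ +-comm 1 _ ⟩
        ∑ n (w ∘ pre′) + 1        ≡⟨ cong (λ a → ∑ n (w ∘ pre′) + w a) (sym py) ⟩
        ∑ n (w ∘ pre′) + w (pre y) ≡⟨ ∑-update w n pre (suc count) y<n ⟩
        ∑ n (w ∘ pre) + 0         ≡⟨ +-identityʳ _ ⟩
        ∑ n (w ∘ pre)             ∎)) count+)
        where open ≡-Reasoning ; w = [_≡0]
      scan : ∀ e → e < m → first′ (tl e) ≤ e → pre′ (hd e) ≢ 0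
      scan e e<m le with e ≟ p
      ... | yes refl = subst (_≢ 0) (sym pre′-y) λ ()
      ... | no e≢p   = mono (search-scanned e e<m le e≢p)
      gap′ : ∀ v z → v < n → pre′ v ≢ 0 → v ≢ 0 → z < n → pre′ (tl (par′ v)) < pre′ z → pre′ z < pre′ v →
        post z ≢ 0 × (post v ≢ 0 → post z < post v)
      gap′ v z v<n pv v≢0 z<n lt lt′ with z ≟ y
      ... | yes refl = contradiction (subst (_< pre′ v) pre′-y lt′)
        (≤⇒≯ (el (_≤ suc count) v (λ _ → ≤-refl) (λ _ → m≤n⇒m≤1+n (pre≤count v v<n))))
      ... | no z≢y with v ≟ y
      ...   | yes refl = largest z z<n
        (subst₂ _<_ (trans (cong (pre′ ∘ tl) (update-≡ par y p)) (trans (cong pre′ tl-p) (pre′-old pre-c)))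
          (pre′-≢ z≢y) lt) , contradiction open-y
      ...   | no v≢y = gap v z v<n (old v≢y pv) v≢0 z<n
        (subst₂ _<_ (trans (cong (pre′ ∘ tl) (update-≢ par p v≢y)) (pre′-old (par-pre v v<n (old v≢y pv) v≢0)))
          (pre′-≢ z≢y) lt)
        (subst₂ _<_ (pre′-≢ z≢y) (pre′-≢ v≢y) lt′)

record Tree (n m : ℕ) (tl hd pre ord par post : ℕ → ℕ) (count : ℕ) : Set where
  field
    pre>0      : ∀ v → v < n → 0 < pre v
    pre≤count  : ∀ v → v < n → pre v ≤ count
    count≤n    : count ≤ n
    ord-pre    : ∀ v → v < n → ord (pre v) ≡ v
    ord<n      : ∀ k → 0 < k → k ≤ count → ord k < n
    pre-ord    : ∀ k → 0 < k → k ≤ count → pre (ord k) ≡ k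
    pre-root   : pre 0 ≡ 1
    par<m      : ∀ v → v < n → v ≢ 0 → par v < m
    hd-par     : ∀ v → v < n → v ≢ 0 → hd (par v) ≡ v
    par-<      : ∀ v → v < n → v ≢ 0 → pre (tl (par v)) < pre v
    gap        : ∀ v z → v < n → v ≢ 0 → z < n → pre (tl (par v)) < pre z → pre z < pre v → post z < post v
    contiguous : ∀ v u x → v < n → u < n → x < n →
                 pre v < pre u → pre u ≤ pre x → post x ≤ post v → post u < post v
    arc        : ∀ e → e < m → pre (tl e) < pre (hd e) → post (hd e) < post (tl e)

search-tree : ∀ {n m tl hd first pre ord par post count fin c} → Graph n m tl hd →
  Search n m tl hd first pre ord par post count fin c → post 0 ≢ 0 →
  Tree n m tl hd pre ord par post count
search-tree {n} {m} {tl} {hd} {pre = pre} {par = par} {post} {count} G S done = record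
  { pre>0 = λ v v<n → ≢0⇒>0 (visited v v<n)
  ; pre≤count = pre≤count
  ; count≤n = subst (count ≤_) count+ (m≤m+n count _)
  ; ord-pre = λ v v<n → ord-pre v v<n (visited v v<n)
  ; ord<n = ord<n ; pre-ord = pre-ord ; pre-root = pre-root
  ; par<m = λ v v<n v≢0 → proj₁ (par-arc v v<n (visited v v<n) v≢0)
  ; hd-par = λ v v<n v≢0 → proj₂ (par-arc v v<n (visited v v<n) v≢0)
  ; par-< = λ v v<n → par-< v v<n (visited v v<n)
  ; gap = λ v z v<n v≢0 z<n lt lt′ →
      proj₂ (gap v z v<n (visited v v<n) v≢0 z<n lt lt′) (finished v v<n)
  ; contiguous = λ v u x v<n u<n x<n lt le le′ →
      proj₂ (contiguous v u x v<n u<n x<n (finished v v<n) (finished x x<n) lt le le′)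
  ; arc = λ e e<m lt → proj₂ (proj₂ (closed e e<m (finished (tl e) (tl<n e e<m))) lt)
  }
  where
  open Search S
  open Graph G
  -- An open vertex has an open parent and, climbing on, an open root, which `done` rules out.
  -- Preorder numbers fall along the climb, and `k` bounds them.
  visited⇒finished : ∀ k v → pre v ≤ k → v < n → pre v ≢ 0 → post v ≢ 0
  visited⇒finished zero    v le v<n pv = contradiction (n≤0⇒n≡0 le) pv
  visited⇒finished (suc k) v le v<n pv open-v with v ≟ 0
  ... | yes refl = done open-v
  ... | no v≢0 = visited⇒finished k (tl (par v)) (s≤s⁻¹ (≤-trans (par-< v v<n pv v≢0) le))
    (tl<n _ (proj₁ (par-arc v v<n pv v≢0))) (par-pre v v<n pv v≢0) (par-open v v<n pv v≢0 open-v)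
  reach : ∀ {u v} → Star (Arc m tl hd λ _ → ⊤) u v → u < n → pre u ≢ 0 → pre v ≢ 0
  reach ε _ pu = pu
  reach ((e , e<m , _ , refl , refl) ◅ w) u<n pu = reach w (hd<n e e<m)
    (proj₁ (closed e e<m (visited⇒finished _ _ ≤-refl u<n pu)))
  visited : ∀ v → v < n → pre v ≢ 0
  visited v v<n = reach (connected 0 v n>0 v<n) n>0 (subst (_≢ 0) (sym pre-root) λ ())
  finished : ∀ v → v < n → post v ≢ 0
  finished v v<n = visited⇒finished _ v ≤-refl v<n (visited v v<n)

-- Subtrees described by preorder and postorder

module Subtrees {n m tl hd pre ord par post count}
  (G : Graph n m tl hd) (T : Tree n m tl hd pre ord par post count) where
  open Graph G public
  open Tree T public

  parent : ℕ → ℕ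
  parent v = tl (par v)

  -- D v x: x lies in the subtree of v.
  D : ℕ → ℕ → Set
  D v x = pre v ≤ pre x × post x ≤ post v

  D? : ∀ v x → Dec (D v x)
  D? v x with pre v ≤? pre x | post x ≤? post v
  ... | yes a | yes b = yes (a , b)
  ... | no ¬a | _     = no λ (a , _) → ¬a a
  ... | _     | no ¬b = no λ (_ , b) → ¬b b

  pre-injective : ∀ {u v} → u < n → v < n → pre u ≡ pre v → u ≡ v
  pre-injective u<n v<n eq = trans (sym (ord-pre _ u<n)) (trans (cong ord eq) (ord-pre _ v<n))

  parent<n : ∀ {v} → v < n → v ≢ 0 → parent v < n
  parent<n v<n v≢0 = tl<n _ (par<m _ v<n v≢0)

  post-parent : ∀ {v} → v < n → v ≢ 0 → post v < post (parent v)
  post-parent {v} v<n v≢0 = subst (λ x → post x < post (parent v)) (hd-par v v<n v≢0)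
    (arc (par v) (par<m v v<n v≢0)
      (subst (λ x → pre (parent v) < pre x) (sym (hd-par v v<n v≢0)) (par-< v v<n v≢0)))

  D-refl : ∀ {v} → D v v
  D-refl = ≤-refl , ≤-refl

  D-trans : ∀ {u v w} → D u v → D v w → D u w
  D-trans (a , b) (c , d) = ≤-trans a c , ≤-trans d b

  D-child : ∀ {v} → v < n → v ≢ 0 → D (parent v) v
  D-child v<n v≢0 = <⇒≤ (par-< _ v<n v≢0) , <⇒≤ (post-parent v<n v≢0)

  pre-root-least : ∀ {v} → v < n → v ≢ 0 → 1 < pre v
  pre-root-least {v} v<n v≢0 = ≤∧≢⇒< (pre>0 v v<n) λ eq →
    v≢0 (pre-injective v<n n>0 (trans (sym eq) (sym pre-root)))

  pre>1⇒≢0 : ∀ {v} → 1 < pre v → v ≢ 0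
  pre>1⇒≢0 lt v≡0 = <-irrefl (sym (trans (cong pre v≡0) pre-root)) lt

  ¬D-root : ∀ {v} → v < n → v ≢ 0 → ¬ D v 0
  ¬D-root {v} v<n v≢0 (le , _) = <⇒≱ (pre-root-least v<n v≢0) (subst (pre v ≤_) pre-root le)

  D-strict : ∀ {v x} → v < n → x < n → D v x → x ≢ v → pre v < pre x
  D-strict v<n x<n (le , _) x≢v = ≤∧≢⇒< le λ eq → x≢v (sym (pre-injective v<n x<n eq))

  -- Were `parent x` numbered before `v`, then `v` would lie in the gap between `x` and its parent
  -- and close before `x`. This ties the numerical definition of `D` to chains of parents, on which
  -- later inductions run.
  D-up : ∀ {v x} → v < n → x < n → D v x → x ≢ v → x ≢ 0 × D v (parent x)
  D-up {v} {x} v<n x<n d x≢v = x≢0 , le , le′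
    where
    lt = D-strict v<n x<n d x≢v
    x≢0 = pre>1⇒≢0 (≤-<-trans (pre>0 v v<n) lt)
    p<n = parent<n x<n x≢0
    le : pre v ≤ pre (parent x)
    le = ≮⇒≥ λ p<v → <⇒≱ (gap x v x<n x≢0 v<n p<v lt) (proj₂ d)
    le′ : post (parent x) ≤ post v
    le′ with m≤n⇒m<n∨m≡n le
    ... | inj₁ v<p = <⇒≤ (contiguous v (parent x) x v<n p<n x<n v<p (<⇒≤ (par-< x x<n x≢0)) (proj₂ d))
    ... | inj₂ v≡p = ≤-reflexive (cong post (pre-injective p<n v<n (sym v≡p)))

  -- A head not before `v` would close no later than `v`: on a forward arc since it closes before
  -- its tail, otherwise by contiguity, as it then lies between `v` and the tail in preorder.
  leaving : ∀ {v e} → v < n → e < m → D v (tl e) → ¬ D v (hd e) → pre (hd e) < pre v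
  leaving {v} {e} v<n e<m d ¬d = ≰⇒> λ v≤h → ¬d (v≤h , post-le v≤h)
    where
    post-le : pre v ≤ pre (hd e) → post (hd e) ≤ post v
    post-le v≤h with pre (tl e) <? pre (hd e)
    ... | yes lt = ≤-trans (<⇒≤ (arc e e<m lt)) (proj₂ d)
    ... | no ≮ with m≤n⇒m<n∨m≡n v≤h
    ...   | inj₁ v<h = <⇒≤ (contiguous v (hd e) (tl e) v<n (hd<n e e<m) (tl<n e e<m) v<h (≮⇒≥ ≮) (proj₂ d))
    ...   | inj₂ v≡h = ≤-reflexive (cong post (pre-injective (hd<n e e<m) v<n (sym v≡h)))

  -- A tail closing no later than `v` would precede `v` in preorder, so the arc would be forward and
  -- its head would close before the tail. Contiguity then places `v` strictly below the tail, and
  -- `v` closes first.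
  entering : ∀ {v e} → v < n → e < m → D v (hd e) → ¬ D v (tl e) → post v < post (tl e)
  entering {v} {e} v<n e<m d ¬d = ≰⇒> λ t≤v →
    let t<v = ≰⇒> (λ v≤t → ¬d (v≤t , t≤v))
        h<t = arc e e<m (<-≤-trans t<v (proj₁ d))
    in <⇒≱ (contiguous (tl e) v (hd e) (tl<n e e<m) v<n (hd<n e e<m) t<v (proj₁ d) (<⇒≤ h<t)) t≤v

  -- The walk is cut at its first arc out of the subtree, which starts at `z`.
  exit-root : ∀ {S : ℕ → Set} {z} →
    (∀ e → e < m → D z (tl e) → ¬ D z (hd e) → tl e ≡ z) → ∀ {u v} →
    Star (Arc m tl hd S) u v → D z u → ¬ D z v → Star (Arc m tl hd S) u z
  exit-root exits ε d ¬d = contradiction d ¬d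
  exit-root {z = z} exits (a@(e , e<m , Se , refl , refl) ◅ w) d ¬d with D? z (hd e)
  ... | yes dh = a ◅ exit-root exits w dh ¬d
  ... | no ¬dh = subst (Star _ _) (exits e e<m d ¬dh) ε

-- Extreme arcs leaving and entering subtrees

module Extremes {n m tl hd pre ord par post count}
  (G : Graph n m tl hd) (T : Tree n m tl hd pre ord par post count) where
  open Subtrees G T

  -- The default value par v of lo v and ch v has the key pre v, which marks
  -- the absence of an arc leaving the subtree of v.
  record Low (i : ℕ) (lo : ℕ → ℕ) : Set where
    field
      lo-arc   : ∀ v → v < n → v ≢ 0 →
                 lo v < m × pre (hd (lo v)) ≤ pre v × (pre (hd (lo v)) < pre v → tl (lo v) ≡ v)
      lo-least : ∀ e → e < i → e < m → pre (hd (lo (tl e))) ≤ pre (hd e)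

  -- The two indices belong to two successive loops: the first `i` arcs have been recorded at their
  -- heads, and the vertices numbered above `k` have passed their arc on to their parents. The
  -- default `par v` is itself an arc into the subtree.
  record High (i k : ℕ) (hi : ℕ → ℕ) : Set where
    field
      hi-arc  : ∀ v → v < n → v ≢ 0 → hi v < m × D v (hd (hi v))
      hi-most : ∀ e → e < i → e < m → post (tl e) ≤ post (tl (hi (hd e)))
      hi-par  : ∀ v → v < n → v ≢ 0 → k < pre v → post (tl (hi v)) ≤ post (tl (hi (parent v)))

  low-start : ∀ {lo} → (∀ v → v < n → lo v ≡ par v) → Low 0 lo
  low-start eq = record
    { lo-arc = λ v v<n v≢0 → subst (λ x → x < m × pre (hd x) ≤ pre v × (pre (hd x) < pre v → tl x ≡ v))
        (sym (eq v v<n)) (par<m v v<n v≢0 , ≤-reflexive (cong pre (hd-par v v<n v≢0)) ,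
          λ lt → contradiction lt (<-irrefl (cong pre (hd-par v v<n v≢0))))
    ; lo-least = λ _ () }

  low-keep : ∀ {i lo} → Low i lo → pre (hd (lo (tl i))) ≤ pre (hd i) → Low (suc i) lo
  low-keep {i} {lo} L le = record { lo-arc = lo-arc ; lo-least = least′ }
    where
    open Low L
    least′ : ∀ e → e < suc i → e < m → pre (hd (lo (tl e))) ≤ pre (hd e)
    least′ e e≤i e<m with e ≟ i
    ... | yes refl = le
    ... | no ne    = lo-least e (≤∧≢⇒< (s≤s⁻¹ e≤i) ne) e<m

  low-set : ∀ {i lo} → i < m → Low i lo → pre (hd i) < pre (hd (lo (tl i))) →
    Low (suc i) (update lo (tl i) i)
  low-set {i} {lo} i<m L lt = low-keep (record
    { lo-arc = λ v v<n v≢0 → update-elim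
        (λ x → x < m × pre (hd x) ≤ pre v × (pre (hd x) < pre v → tl x ≡ v)) lo (tl i) i v
        (λ v≡ → i<m , <⇒≤ (<-≤-trans lt (subst (λ u → pre (hd (lo u)) ≤ pre v) v≡
          (proj₁ (proj₂ (lo-arc v v<n v≢0))))) , λ _ → sym v≡)
        (λ _ → lo-arc v v<n v≢0)
    ; lo-least = λ e e<i e<m → update-elim (λ x → pre (hd x) ≤ pre (hd e)) lo (tl i) i (tl e)
        (λ eq → ≤-trans (<⇒≤ lt) (subst (λ u → pre (hd (lo u)) ≤ pre (hd e)) eq (lo-least e e<i e<m)))
        (λ _ → lo-least e e<i e<m)
    }) (≤-reflexive (cong (pre ∘ hd) (update-≡ lo (tl i) i)))
    where open Low L

  high-start : ∀ {hi} → (∀ v → v < n → hi v ≡ par v) → High 0 count hi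
  high-start eq = record
    { hi-arc = λ v v<n v≢0 → subst (λ x → x < m × D v (hd x)) (sym (eq v v<n))
        (par<m v v<n v≢0 , subst (D v) (sym (hd-par v v<n v≢0)) D-refl)
    ; hi-most = λ _ ()
    ; hi-par = λ v v<n _ lt → contradiction (pre≤count v v<n) (<⇒≱ lt)
    }

  high-keep : ∀ {i hi} → High i count hi → post (tl i) ≤ post (tl (hi (hd i))) → High (suc i) count hi
  high-keep {i} {hi} H le = record { hi-arc = hi-arc ; hi-most = most′ ; hi-par = hi-par }
    where
    open High H
    most′ : ∀ e → e < suc i → e < m → post (tl e) ≤ post (tl (hi (hd e)))
    most′ e e≤i e<m with e ≟ i
    ... | yes refl = le
    ... | no ne    = hi-most e (≤∧≢⇒< (s≤s⁻¹ e≤i) ne) e<m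

  high-set : ∀ {i hi} → i < m → High i count hi → post (tl (hi (hd i))) < post (tl i) →
    High (suc i) count (update hi (hd i) i)
  high-set {i} {hi} i<m H lt = high-keep (record
    { hi-arc = λ v v<n v≢0 → update-elim (λ x → x < m × D v (hd x)) hi (hd i) i v
        (λ v≡ → i<m , subst (D v) v≡ D-refl) (λ _ → hi-arc v v<n v≢0)
    ; hi-most = λ e e<i e<m → update-elim (λ x → post (tl e) ≤ post (tl x)) hi (hd i) i (hd e)
        (λ eq → ≤-trans (subst (λ u → post (tl e) ≤ post (tl (hi u))) eq (hi-most e e<i e<m)) (<⇒≤ lt))
        (λ _ → hi-most e e<i e<m)
    ; hi-par = λ v v<n _ lt → contradiction (pre≤count v v<n) (<⇒≱ lt)
    }) (≤-reflexive (cong (post ∘ tl) (sym (update-≡ hi (hd i) i))))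
    where open High H

  high-up-keep : ∀ {k hi v} → v < n → pre v ≡ suc k → High m (suc k) hi →
    post (tl (hi v)) ≤ post (tl (hi (parent v))) → High m k hi
  high-up-keep {k} {hi} {v} v<n pv H le =
    record { hi-arc = hi-arc ; hi-most = hi-most ; hi-par = par′ }
    where
    open High H
    par′ : ∀ u → u < n → u ≢ 0 → k < pre u → post (tl (hi u)) ≤ post (tl (hi (parent u)))
    par′ u u<n u≢0 lt with u ≟ v
    ... | yes refl = le
    ... | no ne    = hi-par u u<n u≢0
      (≤∧≢⇒< lt λ eq → ne (pre-injective u<n v<n (trans (sym eq) (sym pv))))

  -- Vertices are handled in decreasing preorder. The parent of `v` is numbered below `v`, so no
  -- vertex that has already passed on its arc is changed.
  high-up-set : ∀ {k hi v} → v < n → v ≢ 0 → pre v ≡ suc k → High m (suc k) hi →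
    post (tl (hi (parent v))) < post (tl (hi v)) → High m k (update hi (parent v) (hi v))
  high-up-set {k} {hi} {v} v<n v≢0 pv H lt = high-up-keep v<n pv (record
    { hi-arc = λ u u<n u≢0 → update-elim (λ x → x < m × D u (hd x)) hi (parent v) (hi v) u
        (λ u≡ → proj₁ (hi-arc v v<n v≢0) ,
          D-trans (subst (λ x → D x v) (sym u≡) (D-child v<n v≢0)) (proj₂ (hi-arc v v<n v≢0)))
        (λ _ → hi-arc u u<n u≢0)
    ; hi-most = λ e e<m _ → ≤-trans (hi-most e e<m e<m) (grow (hd e))
    ; hi-par = λ u u<n u≢0 lt → subst (λ x → post (tl x) ≤ post (tl (hi′ (parent u))))
        (sym (update-≢ hi (hi v) λ u≡ → <⇒≱ (subst (λ x → suc k < pre x) u≡ lt)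
          (subst (pre (parent v) ≤_) pv (<⇒≤ (par-< v v<n v≢0)))))
        (≤-trans (hi-par u u<n u≢0 lt) (grow (parent u)))
    }) (≤-reflexive (cong (post ∘ tl) (trans (update-≢ hi (hi v) v≢p) (sym (update-≡ hi (parent v) (hi v))))))
    where
    open High H
    hi′ = update hi (parent v) (hi v)
    v≢p : v ≢ parent v
    v≢p eq = <-irrefl (cong pre (sym eq)) (par-< v v<n v≢0)
    grow : ∀ u → post (tl (hi u)) ≤ post (tl (hi′ u))
    grow u = update-elim (λ x → post (tl (hi u)) ≤ post (tl x)) hi (parent v) (hi v) u
      (λ eq → subst (λ x → post (tl (hi x)) ≤ post (tl (hi v))) (sym eq) (<⇒≤ lt)) (λ _ → ≤-refl)

  -- `ch-child` is recursive: the arc either starts at the child `bc v` or is also the one chosen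
  -- for `bc v`, so an ear can descend along `bc` with a fixed last arc. The clause `k ≤ pre (bc v)`
  -- protects this equation, because later updates concern vertices numbered below `k`.
  record Child (lo : ℕ → ℕ) (k : ℕ) (ch bc : ℕ → ℕ) : Set where
    field
      ch-le    : ∀ v → v < n → v ≢ 0 → ch v < m × pre (hd (ch v)) ≤ pre v
      ch-child : ∀ v → v < n → v ≢ 0 → pre (hd (ch v)) < pre v →
                 bc v < n × bc v ≢ 0 × parent (bc v) ≡ v × k ≤ pre (bc v) ×
                 pre v < pre (tl (ch v)) × (tl (ch v) ≡ bc v ⊎ ch v ≡ ch (bc v))
      ch-lo    : ∀ v → v < n → v ≢ 0 → k < pre v → pre (hd (ch (parent v))) ≤ pre (hd (lo v))
      ch-ch    : ∀ v → v < n → v ≢ 0 → k < pre v → pre (hd (ch (parent v))) ≤ pre (hd (ch v))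

  child-start : ∀ {lo ch bc} → (∀ v → v < n → ch v ≡ par v) → Child lo count ch bc
  child-start {ch = ch} eq = record
    { ch-le = λ v v<n v≢0 → subst (_< m) (sym (eq v v<n)) (par<m v v<n v≢0) , ≤-reflexive (key v<n v≢0)
    ; ch-child = λ v v<n v≢0 lt → contradiction lt (<-irrefl (key v<n v≢0))
    ; ch-lo = λ v v<n _ lt → contradiction (pre≤count v v<n) (<⇒≱ lt)
    ; ch-ch = λ v v<n _ lt → contradiction (pre≤count v v<n) (<⇒≱ lt)
    }
    where
    key : ∀ {v} → v < n → v ≢ 0 → pre (hd (ch v)) ≡ pre v
    key {v} v<n v≢0 = trans (cong (pre ∘ hd) (eq v v<n)) (cong pre (hd-par v v<n v≢0))

  module _ {k lo ch bc v} (v<n : v < n) (v≢0 : v ≢ 0) (pv : pre v ≡ suc k) (C : Child lo (suc k) ch bc) where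
    open Child C

    -- The default of `ch` at the root is arbitrary, as the root has no tree arc; hence the offered
    -- arc is constrained only if the parent is not the root.
    child-offer : ∀ x → pre (hd x) < pre (hd (ch (parent v))) →
      (parent v ≢ 0 → x < m × pre (parent v) < pre (tl x) × (tl x ≡ v ⊎ x ≡ ch v)) →
      Child lo (suc k) (update ch (parent v) x) (update bc (parent v) v)
    child-offer x lt ok = record { ch-le = le ; ch-child = child ; ch-lo = lo′ ; ch-ch = ch″ }
      where
      ch′ = update ch (parent v) x
      bc′ = update bc (parent v) v
      above⇒≢p : ∀ {u} → suc k ≤ pre u → u ≢ parent v
      above⇒≢p k≤u u≡ = <⇒≱ (subst (pre (parent v) <_) pv (par-< v v<n v≢0)) (subst (λ y → suc k ≤ pre y) u≡ k≤u)
      shrink : ∀ u → pre (hd (ch′ u)) ≤ pre (hd (ch u))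
      shrink u = update-elim (λ y → pre (hd y) ≤ pre (hd (ch u))) ch (parent v) x u
        (λ eq → subst (λ y → pre (hd x) ≤ pre (hd (ch y))) (sym eq) (<⇒≤ lt)) (λ _ → ≤-refl)
      le : ∀ u → u < n → u ≢ 0 → ch′ u < m × pre (hd (ch′ u)) ≤ pre u
      le u u<n u≢0 =
        update-elim (_< m) ch (parent v) x u (λ u≡ → proj₁ (ok (subst (_≢ 0) u≡ u≢0))) (λ _ → proj₁ (ch-le u u<n u≢0)) ,
        ≤-trans (shrink u) (proj₂ (ch-le u u<n u≢0))
      child : ∀ u → u < n → u ≢ 0 → pre (hd (ch′ u)) < pre u →
        bc′ u < n × bc′ u ≢ 0 × parent (bc′ u) ≡ u × suc k ≤ pre (bc′ u) ×
        pre u < pre (tl (ch′ u)) × (tl (ch′ u) ≡ bc′ u ⊎ ch′ u ≡ ch′ (bc′ u))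
      child u u<n u≢0 lt with u ≟ parent v
      ... | yes refl rewrite update-≡ ch (parent v) x | update-≡ bc (parent v) v
                           | update-≢ ch x (above⇒≢p (≤-reflexive (sym pv))) =
        v<n , v≢0 , refl , ≤-reflexive (sym pv) , proj₂ (ok u≢0)
      ... | no u≢p rewrite update-≢ ch x u≢p | update-≢ bc v u≢p with ch-child u u<n u≢0 lt
      ...   | b<n , b≢0 , pb , k≤b , lt′ , or rewrite update-≢ ch x (above⇒≢p k≤b) =
        b<n , b≢0 , pb , k≤b , lt′ , or
      lo′ : ∀ u → u < n → u ≢ 0 → suc k < pre u → pre (hd (ch′ (parent u))) ≤ pre (hd (lo u))
      lo′ u u<n u≢0 lt = ≤-trans (shrink (parent u)) (ch-lo u u<n u≢0 lt)
      ch″ : ∀ u → u < n → u ≢ 0 → suc k < pre u → pre (hd (ch′ (parent u))) ≤ pre (hd (ch′ u))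
      ch″ u u<n u≢0 lt = subst (λ y → pre (hd (ch′ (parent u))) ≤ pre (hd y))
        (sym (update-≢ ch x (above⇒≢p (<⇒≤ lt)))) (≤-trans (shrink (parent u)) (ch-ch u u<n u≢0 lt))

    child-offer-lo : Low m lo → pre (hd (lo v)) < pre (hd (ch (parent v))) →
      Child lo (suc k) (update ch (parent v) (lo v)) (update bc (parent v) v)
    child-offer-lo L lt = child-offer (lo v) lt λ p≢0 →
      let (l<m , _ , tl-l) = Low.lo-arc L v v<n v≢0
          p<v = par-< v v<n v≢0
          t≡v = tl-l (<-trans (<-≤-trans lt (proj₂ (ch-le (parent v) (parent<n v<n v≢0) p≢0))) p<v)
      in l<m , subst (λ y → pre (parent v) < pre y) (sym t≡v) p<v , inj₁ t≡v

    child-offer-ch : pre (hd (ch v)) < pre (hd (ch (parent v))) →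
      Child lo (suc k) (update ch (parent v) (ch v)) (update bc (parent v) v)
    child-offer-ch lt = child-offer (ch v) lt λ p≢0 →
      let p<v = par-< v v<n v≢0
          (_ , _ , _ , _ , v<t , _) = ch-child v v<n v≢0
            (<-trans (<-≤-trans lt (proj₂ (ch-le (parent v) (parent<n v<n v≢0) p≢0))) p<v)
      in proj₁ (ch-le v v<n v≢0) , <-trans p<v v<t , inj₂ refl

    child-next : pre (hd (ch (parent v))) ≤ pre (hd (lo v)) → pre (hd (ch (parent v))) ≤ pre (hd (ch v)) →
      Child lo k ch bc
    child-next le-lo le-ch = record
      { ch-le = ch-le
      ; ch-child = λ u u<n u≢0 lt → let (a , b , c , d , e) = ch-child u u<n u≢0 lt
          in a , b , c , <⇒≤ d , e
      ; ch-lo = λ u u<n u≢0 → ext (λ u → pre (hd (ch (parent u))) ≤ pre (hd (lo u))) le-lo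
          (ch-lo u u<n u≢0) u<n
      ; ch-ch = λ u u<n u≢0 → ext (λ u → pre (hd (ch (parent u))) ≤ pre (hd (ch u))) le-ch
          (ch-ch u u<n u≢0) u<n
      }
      where
      ext : ∀ (P : ℕ → Set) → P v → ∀ {u} → (suc k < pre u → P u) → u < n → k < pre u → P u
      ext P Pv {u} h u<n lt with u ≟ v
      ... | yes refl = Pv
      ... | no ne    = h (≤∧≢⇒< lt λ eq → ne (pre-injective u<n v<n (trans (sym eq) (sym pv))))

  module _ {lo ch bc} (L : Low m lo) (C : Child lo 1 ch bc) where
    open Low L
    open Child C

    -- The comparisons `ch-lo` and `ch-ch` of a vertex with its parent are chained along the path
    -- from `x` up to `v`.
    ch-least : ∀ {v} → v < n → v ≢ 0 → ∀ k x → pre x ≤ k → x < n → D v x → x ≢ v →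
      pre (hd (ch v)) ≤ pre (hd (lo x)) × pre (hd (ch v)) ≤ pre (hd (ch x))
    ch-least v<n v≢0 zero    x le x<n _ _ = contradiction (pre>0 x x<n) (≤⇒≯ le)
    ch-least {v} v<n v≢0 (suc k) x le x<n d x≢v with D-up v<n x<n d x≢v
    ... | x≢0 , d′ with parent x ≟ v
    ...   | yes refl = ch-lo x x<n x≢0 (pre-root-least x<n x≢0) , ch-ch x x<n x≢0 (pre-root-least x<n x≢0)
    ...   | no p≢v with ch-least v<n v≢0 k (parent x) (s≤s⁻¹ (≤-trans (par-< x x<n x≢0) le))
                          (parent<n x<n x≢0) d′ p≢v
    ...     | _ , le′ = ≤-trans le′ (ch-lo x x<n x≢0 (pre-root-least x<n x≢0)) ,
                        ≤-trans le′ (ch-ch x x<n x≢0 (pre-root-least x<n x≢0))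

    leaving-root : ∀ {v e} → v < n → v ≢ 0 → pre v ≤ pre (hd (ch v)) → e < m →
      D v (tl e) → ¬ D v (hd e) → tl e ≡ v
    leaving-root {v} {e} v<n v≢0 none e<m d ¬d with tl e ≟ v
    ... | yes eq = eq
    ... | no ne  = contradiction (leaving v<n e<m d ¬d) (≤⇒≯ (≤-trans none (≤-trans
      (proj₁ (ch-least v<n v≢0 _ (tl e) ≤-refl (tl<n e e<m) d ne)) (lo-least e e<m e<m))))

    -- Strong connectivity forces some arc out of the subtree, and by `leaving-root` it starts at
    -- `v`.
    lo-leaves : ∀ {v} → v < n → v ≢ 0 → pre v ≤ pre (hd (ch v)) → pre (hd (lo v)) < pre v
    lo-leaves {v} v<n v≢0 none
      with crossing (D? v) (connected v 0 v<n n>0) D-refl (¬D-root v<n v≢0)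
    ... | e , e<m , _ , d , ¬d = ≤-<-trans
      (subst (λ x → pre (hd (lo x)) ≤ pre (hd e)) (leaving-root v<n v≢0 none e<m d ¬d) (lo-least e e<m e<m))
      (leaving v<n e<m d ¬d)

  module _ {hi} (H : High m 1 hi) where
    open High H

    hi-greatest : ∀ {v} → v < n → ∀ k x → pre x ≤ k → x < n → D v x →
      post (tl (hi x)) ≤ post (tl (hi v))
    hi-greatest v<n zero    x le x<n _ = contradiction (pre>0 x x<n) (≤⇒≯ le)
    hi-greatest {v} v<n (suc k) x le x<n d with x ≟ v
    ... | yes refl = ≤-refl
    ... | no x≢v with D-up v<n x<n d x≢v
    ...   | x≢0 , d′ = ≤-trans (hi-par x x<n x≢0 (pre-root-least x<n x≢0))
      (hi-greatest v<n k (parent x) (s≤s⁻¹ (≤-trans (par-< x x<n x≢0) le)) (parent<n x<n x≢0) d′)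

    hi-bound : ∀ {v e} → v < n → e < m → D v (hd e) → post (tl e) ≤ post (tl (hi v))
    hi-bound {v} {e} v<n e<m d =
      ≤-trans (hi-most e e<m e<m) (hi-greatest v<n _ (hd e) ≤-refl (hd<n e e<m) d)

-- Ears

module Cover {n m tl hd pre ord par post count lo hi ch bc}
  (G : Graph n m tl hd) (T : Tree n m tl hd pre ord par post count)
  (L : Extremes.Low G T m lo) (H : Extremes.High G T m 1 hi) (C : Extremes.Child G T lo 1 ch bc) where
  open Subtrees G T
  open Extremes G T
  open Child C

  -- Arc `e` enters `v` or, if `v` is a singleton, its subtree; `u` is the vertex that makes the
  -- solution contain `e`, as its entry or as its last ear arc. An owner other than `v` must not be
  -- free: pairing changes the data of free vertices only, so such a witness is never overwritten.
  Witness : (k : ℕ) (tgt entry free top : ℕ → ℕ) (v u e : ℕ) → Set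
  Witness k tgt entry free top v u e =
    (u < n × u ≢ 0 × pre u < k) × (e < m × post v < post (tl e)) ×
    (entry u ≡ suc e ⊎ (tgt u ≡ e × tl e ≡ u)) × (u ≡ v ⊎ free u ≡ 0) ×
    (hd e ≡ v ⊎ (top v ≡ v × D v (hd e)))

  -- The ear of the parent continues to `v`, so the tree arc into `v` is an ear arc and no entry is
  -- required.
  Inner : (tgt : ℕ → ℕ) → ℕ → Set
  Inner tgt v = parent v ≢ 0 × tl (tgt (parent v)) ≢ parent v × bc (parent v) ≡ v

  Entry : (k : ℕ) (tgt entry free top : ℕ → ℕ) (v : ℕ) → Set
  Entry k tgt entry free top v =
    Inner tgt v ⊎ ∃₂ λ u e → Witness k tgt entry free top v u e

  -- The vertices v ≢ 0 with pre v < k have been processed; x is the one whose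
  -- ear may still have to be extended, or 0.  The slack d is 1 in the meantime,
  -- since an ear with several vertices pays for its entry with the first two.
  record Ears (k x d : ℕ) (mark tgt entry free top : ℕ → ℕ) : Set where
    field
      mark-root : mark 0 ≡ 0
      marked    : ∀ v → v < n → v ≢ 0 → pre v < k → mark v ≢ 0
      pending   : ∀ v → v < n → k ≤ pre v → mark v ≢ 0 →
                  Inner tgt v × pre (parent v) < k × tgt v < m ×
                  pre (hd (tgt v)) < pre (parent v) × (tl (tgt v) ≡ v ⊎ tgt v ≡ ch v)
      tgt-ok    : ∀ v → v < n → v ≢ 0 → pre v < k → tgt v < m × pre (hd (tgt v)) < pre v
      tgt-child : ∀ v → v < n → v ≢ 0 → pre v < k → v ≢ x → tl (tgt v) ≢ v →
                  bc v < n × bc v ≢ 0 × parent (bc v) ≡ v × tgt (bc v) ≡ tgt v ×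
                  mark (bc v) ≢ 0 × free (bc v) ≡ 0
      entries   : ∀ v → v < n → v ≢ 0 → pre v < k → Entry k tgt entry free top v
      top-root  : top 0 ≡ 0
      top-D     : ∀ v → v < n → pre v < k → top v < n × D (top v) v
      top-none  : ∀ v → v < n → v ≢ 0 → pre v < k → top v ≡ v → pre v ≤ pre (hd (ch v))
      top-cases : ∀ v → v < n → v ≢ 0 → pre v < k → top v ≡ v ⊎ top v ≡ top (parent v)
      freed     : ∀ v → v < n → free v ≢ 0 →
                  v ≢ 0 × pre v < k × top v ≡ v × tl (tgt v) ≡ v × entry v ≢ 0
      entry-0   : ∀ v → v < n → k ≤ pre v → entry v ≡ 0
      unpaired  : ∀ v → v < n → v ≢ 0 → pre v < k → top v ≡ v → free (top (parent v)) ≢ 0 →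
                  post (tl (hi v)) ≤ post (top (parent v))
      balance   : 2 * ∑ n ([_≢0] ∘ entry) ≤ d + (∑ n ([_≢0] ∘ mark) + ∑ n ([_≢0] ∘ free))

  ears-start : ∀ {mark tgt entry free top} → (∀ v → mark v ≡ 0) → (∀ v → entry v ≡ 0) →
    (∀ v → free v ≡ 0) → (∀ v → top v ≡ 0) → Ears 2 0 0 mark tgt entry free top
  ears-start {entry = entry} m0 e0 f0 t0 = record
    { mark-root = m0 0
    ; marked = λ _ v<n v≢0 lt → none v<n v≢0 lt
    ; pending = λ v _ _ mv → contradiction (m0 v) mv
    ; tgt-ok = λ _ v<n v≢0 lt → none v<n v≢0 lt
    ; tgt-child = λ _ v<n v≢0 lt → none v<n v≢0 lt
    ; entries = λ _ v<n v≢0 lt → none v<n v≢0 lt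
    ; top-root = t0 0
    ; top-D = λ v v<n lt → subst (λ x → x < n × D x v) (sym (t0 v))
        (n>0 , subst (λ x → D x v) (pre-injective v<n n>0 (trans (≤-antisym (s≤s⁻¹ lt) (pre>0 v v<n)) (sym pre-root))) D-refl)
    ; top-none = λ _ v<n v≢0 lt → none v<n v≢0 lt
    ; top-cases = λ _ v<n v≢0 lt → none v<n v≢0 lt
    ; freed = λ v _ fv → contradiction (f0 v) fv
    ; entry-0 = λ v _ _ → e0 v
    ; unpaired = λ _ v<n v≢0 lt → none v<n v≢0 lt
    ; balance = ≤-trans (≤-reflexive (cong (2 *_) (trans (∑-cong n λ j _ → cong [_≢0] (e0 j)) (∑-0 n)))) z≤n
    }
    where
    none : ∀ {A : Set} {v} → v < n → v ≢ 0 → pre v < 2 → A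
    none v<n v≢0 lt = contradiction lt (≤⇒≯ (pre-root-least v<n v≢0))

  module _ {k v mark tgt entry free top} {mark′ tgt′ entry′ free′ top′ : ℕ → ℕ}
    (E : Ears k 0 0 mark tgt entry free top) (v<n : v < n) (v≢0 : v ≢ 0) (pv : pre v ≡ k) where
    open Ears E

    private
      done⇒≢v : ∀ {u} → pre u < k → u ≢ v
      done⇒≢v lt u≡v = <-irrefl (trans (cong pre u≡v) pv) lt
      earlier : ∀ {u} → u < n → pre u < suc k → u ≢ v → pre u < k
      earlier u<n lt u≢v = ≤∧≢⇒< (s≤s⁻¹ lt) λ eq → u≢v (pre-injective u<n v<n (trans eq (sym pv)))
      p<k : pre (parent v) < k
      p<k = subst (pre (parent v) <_) pv (par-< v v<n v≢0)

    -- Common frame of the four cases below. Away from `v`, marks, last arcs and `top` are kept; a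
    -- vertex may lose its free flag, and an entry may change only at a free vertex, for which a new
    -- witness must be supplied.
    classify :
      (∀ u → u ≢ v → mark′ u ≡ mark u) → mark′ v ≢ 0 →
      (∀ u → u ≢ v → tgt′ u ≡ tgt u) → tgt′ v < m × pre (hd (tgt′ v)) < pre v →
      (mark v ≢ 0 → tgt′ v ≡ tgt v × free′ v ≡ 0) →
      (∀ u → u ≢ v → top′ u ≡ top u) →
      (top′ v ≡ v × pre v ≤ pre (hd (ch v))) ⊎ top′ v ≡ top (parent v) →
      (∀ u → u ≢ v → free′ u ≡ free u ⊎ free′ u ≡ 0) →
      (free′ v ≢ 0 → top′ v ≡ v × tl (tgt′ v) ≡ v × entry′ v ≢ 0) →
      (∀ u → u < n → u ≢ v → entry′ u ≡ entry u ⊎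
        (free u ≢ 0 × entry′ u ≢ 0 × Entry (suc k) tgt′ entry′ free′ top′ u)) →
      Entry (suc k) tgt′ entry′ free′ top′ v →
      (top′ v ≡ v → free′ (top (parent v)) ≢ 0 → post (tl (hi v)) ≤ post (top (parent v))) →
      2 * ∑ n ([_≢0] ∘ entry′) ≤ 1 + (∑ n ([_≢0] ∘ mark′) + ∑ n ([_≢0] ∘ free′)) →
      Ears (suc k) v 1 mark′ tgt′ entry′ free′ top′
    classify mark-≢ mark-v tgt-≢ tgt-v keep top-≢ top-v free-≢ free-v entry-≢ entry-v pair-v bal = record
      { mark-root = trans (mark-≢ 0 (≢-sym v≢0)) mark-root
      ; marked = λ u u<n u≢0 → split (λ u → mark′ u ≢ 0) mark-v
          (λ u≢v lt → subst (_≢ 0) (sym (mark-≢ u u≢v)) (marked u u<n u≢0 lt)) u<n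
      ; pending = pending′
      ; tgt-ok = λ u u<n u≢0 → split (λ u → tgt′ u < m × pre (hd (tgt′ u)) < pre u) tgt-v
          (λ u≢v lt → subst (λ x → x < m × pre (hd x) < pre u) (sym (tgt-≢ u u≢v)) (tgt-ok u u<n u≢0 lt)) u<n
      ; tgt-child = child
      ; entries = λ u u<n u≢0 → split (Entry (suc k) tgt′ entry′ free′ top′) entry-v
          (λ _ lt → old-entry u<n u≢0 lt (entries u u<n u≢0 lt)) u<n
      ; top-root = trans (top-≢ 0 (≢-sym v≢0)) top-root
      ; top-D = λ u u<n → split (λ u → top′ u < n × D (top′ u) u) (top-D-v top-v)
          (λ u≢v lt → subst (λ x → x < n × D x u) (sym (top-≢ u u≢v)) (top-D u u<n lt)) u<n
      ; top-none = λ u u<n u≢0 → split (λ u → top′ u ≡ u → pre u ≤ pre (hd (ch u))) (top-none-v top-v)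
          (λ u≢v lt eq → top-none u u<n u≢0 lt (trans (sym (top-≢ u u≢v)) eq)) u<n
      ; top-cases = λ u u<n u≢0 → split (λ u → top′ u ≡ u ⊎ top′ u ≡ top′ (parent u)) (top-cases-v top-v)
          (λ u≢v lt → subst₂ (λ x y → x ≡ u ⊎ x ≡ y) (sym (top-≢ u u≢v))
            (sym (top-≢ (parent u) (done⇒≢v (<-trans (par-< u u<n u≢0) lt)))) (top-cases u u<n u≢0 lt)) u<n
      ; freed = freed′
      ; entry-0 = entry-0′
      ; unpaired = λ u u<n u≢0 → split
          (λ u → top′ u ≡ u → free′ (top′ (parent u)) ≢ 0 → post (tl (hi u)) ≤ post (top′ (parent u)))
          (λ t f → subst (λ x → post (tl (hi v)) ≤ post x) (sym (top-≢ (parent v) (done⇒≢v p<k)))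
            (pair-v t (subst (λ x → free′ x ≢ 0) (top-≢ (parent v) (done⇒≢v p<k)) f)))
          (old-unpaired u u<n u≢0) u<n
      ; balance = bal
      }
      where
      split : ∀ (P : ℕ → Set) → P v → ∀ {u} → (u ≢ v → pre u < k → P u) → u < n → pre u < suc k → P u
      split P Pv {u} h u<n lt with u ≟ v
      ... | yes refl = Pv
      ... | no u≢v   = h u≢v (earlier u<n lt u≢v)
      inner : ∀ {u} → parent u ≢ v → Inner tgt u → Inner tgt′ u
      inner {u} p≢v (a , b , c) = a , subst (λ x → tl x ≢ parent u) (sym (tgt-≢ (parent u) p≢v)) b , c
      pending′ : ∀ u → u < n → suc k ≤ pre u → mark′ u ≢ 0 →
        Inner tgt′ u × pre (parent u) < suc k × tgt′ u < m ×
        pre (hd (tgt′ u)) < pre (parent u) × (tl (tgt′ u) ≡ u ⊎ tgt′ u ≡ ch u)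
      pending′ u u<n lt mu with pending u u<n (<⇒≤ lt) (subst (_≢ 0) (mark-≢ u u≢v) mu)
        where
        u≢v : u ≢ v
        u≢v u≡v = <-irrefl (sym (trans (cong pre u≡v) pv)) lt
      ... | i , p<k , rest = inner (done⇒≢v p<k) i , m<n⇒m<1+n p<k ,
        subst (λ x → x < m × pre (hd x) < pre (parent u) × (tl x ≡ u ⊎ x ≡ ch u)) (sym (tgt-≢ u u≢v)) rest
        where
        u≢v : u ≢ v
        u≢v u≡v = <-irrefl (sym (trans (cong pre u≡v) pv)) lt
      child : ∀ u → u < n → u ≢ 0 → pre u < suc k → u ≢ v → tl (tgt′ u) ≢ u →
        bc u < n × bc u ≢ 0 × parent (bc u) ≡ u × tgt′ (bc u) ≡ tgt′ u × mark′ (bc u) ≢ 0 × free′ (bc u) ≡ 0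
      child u u<n u≢0 lt u≢v mid
        with tgt-child u u<n u≢0 (earlier u<n lt u≢v) u≢0 (subst (λ x → tl x ≢ u) (tgt-≢ u u≢v) mid)
      ... | a , b , c , d , e , f with bc u ≟ v
      ...   | yes refl = a , b , c , trans (proj₁ (keep e)) (trans d (sym (tgt-≢ u u≢v))) , mark-v , proj₂ (keep e)
      ...   | no b≢v   = a , b , c , trans (tgt-≢ (bc u) b≢v) (trans d (sym (tgt-≢ u u≢v))) ,
        subst (_≢ 0) (sym (mark-≢ (bc u) b≢v)) e , zero-free (free-≢ (bc u) b≢v)
        where
        zero-free : free′ (bc u) ≡ free (bc u) ⊎ free′ (bc u) ≡ 0 → free′ (bc u) ≡ 0
        zero-free (inj₁ eq) = trans eq f
        zero-free (inj₂ eq) = eq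
      still-0 : ∀ {u} → pre u < k → free u ≡ 0 → free′ u ≡ 0
      still-0 {u} lt f with free-≢ u (done⇒≢v lt)
      ... | inj₁ eq = trans eq f
      ... | inj₂ eq = eq
      old-entry : ∀ {u} → u < n → u ≢ 0 → pre u < k → Entry k tgt entry free top u →
        Entry (suc k) tgt′ entry′ free′ top′ u
      old-entry {u} u<n u≢0 lt (inj₁ i) = inj₁ (inner (done⇒≢v (<-trans (par-< u u<n u≢0) lt)) i)
      old-entry {u} u<n u≢0 lt (inj₂ (w , e , (w<n , w≢0 , w<k) , ok , src , who , at))
        with entry-≢ w w<n (done⇒≢v w<k) | who
      ... | inj₁ eq | _ = inj₂ (w , e , (w<n , w≢0 , m<n⇒m<1+n w<k) , ok ,
        subst₂ (λ x y → x ≡ suc e ⊎ (y ≡ e × tl e ≡ w)) (sym eq) (sym (tgt-≢ w (done⇒≢v w<k))) src ,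
        who′ who , subst (λ x → hd e ≡ u ⊎ (x ≡ u × D u (hd e))) (sym (top-≢ u (done⇒≢v lt))) at)
        where
        who′ : w ≡ u ⊎ free w ≡ 0 → w ≡ u ⊎ free′ w ≡ 0
        who′ (inj₁ w≡u) = inj₁ w≡u
        who′ (inj₂ f)   = inj₂ (still-0 w<k f)
      ... | inj₂ (_ , _ , new) | inj₁ refl = new
      ... | inj₂ (f , _)       | inj₂ f0   = contradiction f0 f
      top-D-v : (top′ v ≡ v × pre v ≤ pre (hd (ch v))) ⊎ top′ v ≡ top (parent v) → top′ v < n × D (top′ v) v
      top-D-v (inj₁ (eq , _)) = subst (λ x → x < n × D x v) (sym eq) (v<n , D-refl)
      top-D-v (inj₂ eq) = subst (λ x → x < n × D x v) (sym eq)
        (let (a , b) = top-D (parent v) (parent<n v<n v≢0) p<k in a , D-trans b (D-child v<n v≢0))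
      top-none-v : (top′ v ≡ v × pre v ≤ pre (hd (ch v))) ⊎ top′ v ≡ top (parent v) →
        top′ v ≡ v → pre v ≤ pre (hd (ch v))
      top-none-v (inj₁ (_ , le)) _ = le
      top-none-v (inj₂ eq) eq′ = contradiction
        (subst (λ x → pre x ≤ pre (parent v)) (trans (sym eq) eq′)
          (proj₁ (proj₂ (top-D (parent v) (parent<n v<n v≢0) p<k)))) (<⇒≱ (par-< v v<n v≢0))
      top-cases-v : (top′ v ≡ v × pre v ≤ pre (hd (ch v))) ⊎ top′ v ≡ top (parent v) →
        top′ v ≡ v ⊎ top′ v ≡ top′ (parent v)
      top-cases-v (inj₁ (eq , _)) = inj₁ eq
      top-cases-v (inj₂ eq) = inj₂ (trans eq (sym (top-≢ (parent v) (done⇒≢v p<k))))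
      freed′ : ∀ u → u < n → free′ u ≢ 0 →
        u ≢ 0 × pre u < suc k × top′ u ≡ u × tl (tgt′ u) ≡ u × entry′ u ≢ 0
      freed′ u u<n fu with u ≟ v
      ... | yes refl = v≢0 , ≤-reflexive (cong suc pv) , free-v fu
      ... | no u≢v with free-≢ u u≢v
      ...   | inj₂ f0 = contradiction f0 fu
      ...   | inj₁ eq with freed u u<n (subst (_≢ 0) eq fu)
      ...     | a , b , c , d , e = a , m<n⇒m<1+n b , trans (top-≢ u u≢v) c ,
        trans (cong tl (tgt-≢ u u≢v)) d , nonzero (entry-≢ u u<n u≢v)
        where
        nonzero : entry′ u ≡ entry u ⊎ (free u ≢ 0 × entry′ u ≢ 0 × _) → entry′ u ≢ 0
        nonzero (inj₁ eq′)        = subst (_≢ 0) (sym eq′) e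
        nonzero (inj₂ (_ , e′ , _)) = e′
      entry-0′ : ∀ u → u < n → suc k ≤ pre u → entry′ u ≡ 0
      entry-0′ u u<n lt with entry-≢ u u<n (λ u≡v → <-irrefl (sym (trans (cong pre u≡v) pv)) lt)
      ... | inj₁ eq      = trans eq (entry-0 u u<n (<⇒≤ lt))
      ... | inj₂ (f , _) = contradiction (proj₁ (proj₂ (freed u u<n f))) (<⇒≯ lt)
      old-unpaired : ∀ u → u < n → u ≢ 0 → u ≢ v → pre u < k → top′ u ≡ u →
        free′ (top′ (parent u)) ≢ 0 → post (tl (hi u)) ≤ post (top′ (parent u))
      old-unpaired u u<n u≢0 u≢v lt t f = subst (λ x → post (tl (hi u)) ≤ post x) (sym tp)
        (unpaired u u<n u≢0 lt (trans (sym (top-≢ u u≢v)) t) λ f0 →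
          subst (λ x → free′ x ≢ 0) tp f
            (still-0 (≤-<-trans (proj₁ (proj₂ (top-D (parent u) (parent<n u<n u≢0) pp<k))) pp<k) f0))
        where
        pp<k = <-trans (par-< u u<n u≢0) lt
        tp = top-≢ (parent u) (done⇒≢v pp<k)

  -- v has been put on an ear, whose next vertex is yet to be determined.
  record Classified (k v : ℕ) (mark tgt entry free top : ℕ → ℕ) : Set where
    field
      stage : Ears (suc k) v 1 mark tgt entry free top
      v<n   : v < n
      v≢0   : v ≢ 0
      pre-v : pre v ≡ k
      via   : tl (tgt v) ≢ v → tgt v ≡ ch v
      tight : tl (tgt v) ≡ v → 2 * ∑ n ([_≢0] ∘ entry) ≤ ∑ n ([_≢0] ∘ mark) + ∑ n ([_≢0] ∘ free)
      fresh : ∀ w → w < n → w ≢ 0 → parent w ≡ v → mark w ≡ 0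

  module _ {k v mark tgt entry free top}
    (E : Ears k 0 0 mark tgt entry free top) (v<n : v < n) (v≢0 : v ≢ 0) (pv : pre v ≡ k) where
    open Ears E

    private
      Z = top (parent v)
      p<n = parent<n v<n v≢0
      p<k : pre (parent v) < k
      p<k = subst (pre (parent v) <_) pv (par-< v v<n v≢0)
      undone : ¬ pre v < k
      undone lt = <-irrefl pv lt
      free-v : free v ≡ 0
      free-v with free v ≟ 0
      ... | yes eq = eq
      ... | no ne  = contradiction (proj₁ (proj₂ (freed v v<n ne))) undone
      entry-v : entry v ≡ 0
      entry-v = entry-0 v v<n (≤-reflexive (sym pv))
      Z<n : Z < n
      Z<n = proj₁ (top-D (parent v) p<n p<k)
      D-Z : D Z v
      D-Z = D-trans (proj₂ (top-D (parent v) p<n p<k)) (D-child v<n v≢0)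
      Z<k : pre Z < k
      Z<k = ≤-<-trans (proj₁ (proj₂ (top-D (parent v) p<n p<k))) p<k
      Z≢v : Z ≢ v
      Z≢v eq = undone (subst (λ x → pre x < k) eq Z<k)
      post-Z : post v < post Z
      post-Z = <-≤-trans (post-parent v<n v≢0) (proj₂ (proj₂ (top-D (parent v) p<n p<k)))
      fresh : ∀ w → w < n → w ≢ 0 → parent w ≡ v → mark w ≡ 0
      fresh w w<n w≢0 pw with mark w ≟ 0
      ... | yes eq = eq
      ... | no ne  = contradiction (subst (λ x → pre x < k) pw (proj₁ (proj₂ (pending w w<n
        (<⇒≤ (subst (_< pre w) (trans (cong pre pw) pv) (par-< w w<n w≢0))) ne)))) undone
      fresh′ : ∀ w → w < n → w ≢ 0 → parent w ≡ v → update mark v 1 w ≡ 0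
      fresh′ w w<n w≢0 pw = trans (update-≢ mark 1 (λ w≡v → <-irrefl
        (cong pre (trans pw (sym w≡v))) (par-< w w<n w≢0))) (fresh w w<n w≢0 pw)
      par-entry : ∀ {tgt entry free top} → entry v ≡ suc (par v) → Entry (suc k) tgt entry free top v
      par-entry eq = inj₂ (v , par v , (v<n , v≢0 , ≤-reflexive (cong suc pv)) ,
        (par<m v v<n v≢0 , post-parent v<n v≢0) , inj₁ eq , inj₁ refl , inj₁ (hd-par v v<n v≢0))
      -- A new entry weighs two: the mark of `v` pays for one unit, the slack for the other.
      balance-entry : mark v ≡ 0 → ∀ x → 2 * ∑ n ([_≢0] ∘ update entry v (suc x)) ≤
        1 + (∑ n ([_≢0] ∘ update mark v 1) + ∑ n ([_≢0] ∘ free))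
      balance-entry mv x = begin
        2 * ∑ n ([_≢0] ∘ update entry v (suc x))    ≡⟨ cong (2 *_) (∑-set n entry (suc x) v<n entry-v λ ()) ⟩
        2 * suc (∑ n ([_≢0] ∘ entry))               ≡⟨ *-suc 2 _ ⟩
        2 + 2 * ∑ n ([_≢0] ∘ entry)                 ≤⟨ +-monoʳ-≤ 2 balance ⟩
        2 + (∑ n ([_≢0] ∘ mark) + ∑ n ([_≢0] ∘ free)) ≡⟨ cong (λ a → suc (a + ∑ n ([_≢0] ∘ free))) (sym (∑-set n mark 1 v<n mv λ ())) ⟩
        1 + (∑ n ([_≢0] ∘ update mark v 1) + ∑ n ([_≢0] ∘ free)) ∎
        where open ≤-Reasoning

    classify-head : mark v ≡ 0 → pre (hd (ch v)) < pre v →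
      Classified k v (update mark v 1) (update tgt v (ch v)) (update entry v (suc (par v))) free
        (update top v (top (parent v)))
    classify-head mv lt = record
      { stage = classify E v<n v≢0 pv
          (λ u → update-≢ mark 1) (subst (_≢ 0) (sym (update-≡ mark v 1)) λ ())
          (λ u → update-≢ tgt (ch v))
          (subst (λ x → x < m × pre (hd x) < pre v) (sym tgt′) (proj₁ (ch-le v v<n v≢0) , lt))
          (λ mv′ → contradiction mv mv′)
          (λ u → update-≢ top (top (parent v))) (inj₂ (update-≡ top v (top (parent v))))
          (λ _ _ → inj₁ refl) (contradiction free-v)
          (λ u _ u≢v → inj₁ (update-≢ entry (suc (par v)) u≢v))
          (par-entry {top = update top v (top (parent v))} (update-≡ entry v (suc (par v))))
          (λ t → contradiction (trans (sym (update-≡ top v (top (parent v)))) t) Z≢v)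
          (balance-entry mv (par v))
      ; v<n = v<n ; v≢0 = v≢0 ; pre-v = pv
      ; via = λ _ → tgt′
      ; tight = λ end → contradiction (subst (pre v <_) (cong pre (trans (cong tl (sym tgt′)) end))
          (proj₁ (proj₂ (proj₂ (proj₂ (proj₂ (ch-child v v<n v≢0 lt))))))) (<-irrefl refl)
      ; fresh = fresh′
      }
      where
      tgt′ : update tgt v (ch v) v ≡ ch v
      tgt′ = update-≡ tgt v (ch v)

    private module _ (mv : mark v ≡ 0) (none : pre v ≤ pre (hd (ch v))) where
      lo-ok = Low.lo-arc L v v<n v≢0
      lo-lt = lo-leaves L C v<n v≢0 none
      tgt′ : update tgt v (lo v) v ≡ lo v
      tgt′ = update-≡ tgt v (lo v)
      end : tl (update tgt v (lo v) v) ≡ v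
      end = trans (cong tl tgt′) (proj₂ (proj₂ lo-ok) lo-lt)
      top′ : update top v v v ≡ v
      top′ = update-≡ top v v

    classify-free : mark v ≡ 0 → pre v ≤ pre (hd (ch v)) →
      (free (top (parent v)) ≢ 0 → post (tl (hi v)) ≤ post (top (parent v))) →
      Classified k v (update mark v 1) (update tgt v (lo v)) (update entry v (suc (par v)))
        (update free v 1) (update top v v)
    classify-free mv none alone = record
      { stage = classify E v<n v≢0 pv
          (λ u → update-≢ mark 1) (subst (_≢ 0) (sym (update-≡ mark v 1)) λ ())
          (λ u → update-≢ tgt (lo v))
          (subst (λ x → x < m × pre (hd x) < pre v) (sym (tgt′ mv none)) (proj₁ (lo-ok mv none) , lo-lt mv none))
          (λ mv′ → contradiction mv mv′)
          (λ u → update-≢ top v) (inj₁ (top′ mv none , none))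
          (λ u u≢v → inj₁ (update-≢ free 1 u≢v))
          (λ _ → top′ mv none , end mv none , subst (_≢ 0) (sym (update-≡ entry v (suc (par v)))) λ ())
          (λ u _ u≢v → inj₁ (update-≢ entry (suc (par v)) u≢v))
          (par-entry {top = update top v v} (update-≡ entry v (suc (par v))))
          (λ _ f → alone (subst (_≢ 0) (update-≢ free 1 Z≢v) f))
          (m≤n⇒m≤1+n bal)
      ; v<n = v<n ; v≢0 = v≢0 ; pre-v = pv
      ; via = λ mid → contradiction (end mv none) mid
      ; tight = λ _ → bal
      ; fresh = fresh′
      }
      where
      bal : 2 * ∑ n ([_≢0] ∘ update entry v (suc (par v))) ≤
        ∑ n ([_≢0] ∘ update mark v 1) + ∑ n ([_≢0] ∘ update free v 1)
      bal = ≤-trans (balance-entry mv (par v)) (≤-reflexive (trans (sym (+-suc _ _))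
        (cong (∑ n ([_≢0] ∘ update mark v 1) +_) (sym (∑-set n free 1 v<n free-v λ ())))))

    -- The tail of `hi v` closes after `Z`, hence lies outside the subtree of `Z`, while the head
    -- lies in that of `v`. The arc overwrites the entry of `Z` and serves both. The number of
    -- entries is unchanged, and the mark of `v` makes up for the lost free flag.
    classify-pair : mark v ≡ 0 → pre v ≤ pre (hd (ch v)) →
      free (top (parent v)) ≢ 0 → post (top (parent v)) < post (tl (hi v)) →
      Classified k v (update mark v 1) (update tgt v (lo v)) (update entry (top (parent v)) (suc (hi v)))
        (update free (top (parent v)) 0) (update top v v)
    classify-pair mv none fZ above = record
      { stage = classify E v<n v≢0 pv
          (λ u → update-≢ mark 1) (subst (_≢ 0) (sym (update-≡ mark v 1)) λ ())
          (λ u → update-≢ tgt (lo v))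
          (subst (λ x → x < m × pre (hd x) < pre v) (sym (tgt′ mv none)) (proj₁ (lo-ok mv none) , lo-lt mv none))
          (λ mv′ → contradiction mv mv′)
          (λ u → update-≢ top v) (inj₁ (top′ mv none , none))
          (λ u _ → update-elim (λ x → x ≡ free u ⊎ x ≡ 0) free Z 0 u (λ _ → inj₂ refl) (λ _ → inj₁ refl))
          (λ f → contradiction (trans (update-≢ free 0 (≢-sym Z≢v)) free-v) f)
          entry-≢
          (inj₂ (Z , hi v , (Z<n , Z≢0 , m<n⇒m<1+n Z<k) , (proj₁ hi-ok , <-trans post-Z above) ,
            inj₁ entry-Z , inj₂ (update-≡ free Z 0) , inj₂ (top′ mv none , proj₂ hi-ok)))
          (λ _ f → contradiction (update-≡ free Z 0) f)
          (m≤n⇒m≤1+n bal)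
      ; v<n = v<n ; v≢0 = v≢0 ; pre-v = pv
      ; via = λ mid → contradiction (end mv none) mid
      ; tight = λ _ → bal
      ; fresh = fresh′
      }
      where
      Z≢0 = proj₁ (freed Z Z<n fZ)
      hi-ok = High.hi-arc H v v<n v≢0
      entry-Z : update entry Z (suc (hi v)) Z ≡ suc (hi v)
      entry-Z = update-≡ entry Z (suc (hi v))
      entry-≢ : ∀ u → u < n → u ≢ v → update entry Z (suc (hi v)) u ≡ entry u ⊎
        (free u ≢ 0 × update entry Z (suc (hi v)) u ≢ 0 ×
         Entry (suc k) (update tgt v (lo v)) (update entry Z (suc (hi v))) (update free Z 0) (update top v v) u)
      entry-≢ u u<n u≢v with u ≟ Z
      ... | no u≢Z   = inj₁ (update-≢ entry (suc (hi v)) u≢Z)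
      ... | yes refl = inj₂ (fZ , subst (_≢ 0) (sym entry-Z) (λ ()) ,
        inj₂ (Z , hi v , (Z<n , Z≢0 , m<n⇒m<1+n Z<k) , (proj₁ hi-ok , above) , inj₁ entry-Z , inj₁ refl ,
          inj₂ (trans (update-≢ top v Z≢v) (proj₁ (proj₂ (proj₂ (freed Z Z<n fZ)))) , D-trans D-Z (proj₂ hi-ok))))
      bal : 2 * ∑ n ([_≢0] ∘ update entry Z (suc (hi v))) ≤
        ∑ n ([_≢0] ∘ update mark v 1) + ∑ n ([_≢0] ∘ update free Z 0)
      bal = begin
        2 * ∑ n ([_≢0] ∘ update entry Z (suc (hi v)))   ≡⟨ cong (2 *_) (∑-reset n entry (suc (hi v)) Z<n (proj₂ (proj₂ (proj₂ (proj₂ (freed Z Z<n fZ))))) λ ()) ⟩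
        2 * ∑ n ([_≢0] ∘ entry)                         ≤⟨ balance ⟩
        M + ∑ n ([_≢0] ∘ free)                          ≡⟨ cong (M +_) (sym (∑-clear n free Z<n fZ)) ⟩
        M + suc (∑ n ([_≢0] ∘ update free Z 0))         ≡⟨ +-suc M _ ⟩
        suc M + ∑ n ([_≢0] ∘ update free Z 0)           ≡⟨ cong (_+ ∑ n ([_≢0] ∘ update free Z 0)) (sym (∑-set n mark 1 v<n mv λ ())) ⟩
        ∑ n ([_≢0] ∘ update mark v 1) + ∑ n ([_≢0] ∘ update free Z 0) ∎
        where open ≤-Reasoning ; M = ∑ n ([_≢0] ∘ mark)

    classify-inner : mark v ≢ 0 → Classified k v mark tgt entry free (update top v (top (parent v)))
    classify-inner mv with pending v v<n (≤-reflexive (sym pv)) mv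
    ... | inner , _ , t<m , key , or = record
      { stage = classify E v<n v≢0 pv
          (λ _ _ → refl) mv (λ _ _ → refl) (t<m , <-trans key (par-< v v<n v≢0))
          (λ _ → refl , free-v)
          (λ u → update-≢ top (top (parent v))) (inj₂ (update-≡ top v (top (parent v))))
          (λ _ _ → inj₁ refl) (contradiction free-v)
          (λ _ _ _ → inj₁ refl) (inj₁ inner)
          (λ t → contradiction (trans (sym (update-≡ top v (top (parent v)))) t) Z≢v)
          (m≤n⇒m≤1+n balance)
      ; v<n = v<n ; v≢0 = v≢0 ; pre-v = pv
      ; via = λ mid → choose or mid
      ; tight = λ _ → balance
      ; fresh = fresh
      }
      where
      choose : tl (tgt v) ≡ v ⊎ tgt v ≡ ch v → tl (tgt v) ≢ v → tgt v ≡ ch v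
      choose (inj₁ end) mid = contradiction end mid
      choose (inj₂ eq)  _   = eq

  module _ {k v mark tgt entry free top}
    (Cl : Classified k v mark tgt entry free top) where
    open Classified Cl renaming (pre-v to pv ; via to t≡ch)
    open Ears stage

    ear-ends : tl (tgt v) ≡ v → Ears (suc k) 0 0 mark tgt entry free top
    ear-ends end = record
      { mark-root = mark-root ; marked = marked ; pending = pending ; tgt-ok = tgt-ok
      ; tgt-child = child ; entries = entries ; top-root = top-root ; top-D = top-D
      ; top-none = top-none ; top-cases = top-cases ; freed = freed ; entry-0 = entry-0
      ; unpaired = unpaired ; balance = tight end }
      where
      child : ∀ u → u < n → u ≢ 0 → pre u < suc k → u ≢ 0 → tl (tgt u) ≢ u → _
      child u u<n u≢0 lt _ mid with u ≟ v
      ... | yes refl = contradiction end mid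
      ... | no u≢v   = tgt-child u u<n u≢0 lt u≢v mid

    -- The next vertex inherits the last arc of the ear, and its mark pays off the slack.
    ear-continues : tl (tgt v) ≢ v →
      Ears (suc k) 0 0 (update mark (bc v) 1) (update tgt (bc v) (tgt v)) entry free top
    ear-continues mid = record
      { mark-root = trans (update-≢ mark 1 (≢-sym b≢0)) mark-root
      ; marked = λ u u<n u≢0 lt → update-elim (_≢ 0) mark w 1 u (λ _ ()) (λ _ → marked u u<n u≢0 lt)
      ; pending = pending′
      ; tgt-ok = λ u u<n u≢0 lt → subst (λ x → x < m × pre (hd x) < pre u) (sym (tgt′-≢ (done⇒≢w lt)))
          (tgt-ok u u<n u≢0 lt)
      ; tgt-child = child
      ; entries = λ u u<n u≢0 lt → entry′ u<n u≢0 lt (entries u u<n u≢0 lt)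
      ; top-root = top-root ; top-D = top-D ; top-none = top-none ; top-cases = top-cases
      ; freed = λ u u<n fu → let (a , b , c , d , e) = freed u u<n fu in
          a , b , c , trans (cong tl (tgt′-≢ (done⇒≢w b))) d , e
      ; entry-0 = entry-0 ; unpaired = unpaired ; balance = bal }
      where
      w = bc v
      v<k : pre v < suc k
      v<k = ≤-reflexive (cong suc pv)
      t<m = proj₁ (tgt-ok v v<n v≢0 v<k)
      key : pre (hd (tgt v)) < pre v
      key = proj₂ (tgt-ok v v<n v≢0 v<k)
      bc-child = ch-child v v<n v≢0 (subst (λ x → pre (hd x) < pre v) (t≡ch mid) key)
      b<n = proj₁ bc-child
      b≢0 = proj₁ (proj₂ bc-child)
      pb = proj₁ (proj₂ (proj₂ bc-child))
      k<w : suc k ≤ pre w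
      k<w = subst₂ _<_ (trans (cong pre pb) pv) refl (par-< w b<n b≢0)
      done⇒≢w : ∀ {u} → pre u < suc k → u ≢ w
      done⇒≢w lt u≡w = <⇒≱ lt (subst (λ x → suc k ≤ pre x) (sym u≡w) k<w)
      tgt′ = update tgt w (tgt v)
      tgt′-≢ : ∀ {u} → u ≢ w → tgt′ u ≡ tgt u
      tgt′-≢ = update-≢ tgt (tgt v)
      mark′ = update mark w 1
      bal : 2 * ∑ n ([_≢0] ∘ entry) ≤ ∑ n ([_≢0] ∘ mark′) + ∑ n ([_≢0] ∘ free)
      bal = ≤-trans balance (≤-reflexive (cong (_+ ∑ n ([_≢0] ∘ free))
        (sym (∑-set n mark 1 b<n (fresh w b<n b≢0 pb) λ ()))))
      inner : ∀ {u} → parent u ≢ w → Inner tgt u → Inner tgt′ u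
      inner {u} p≢w (a , b , c) = a , subst (λ x → tl x ≢ parent u) (sym (tgt′-≢ p≢w)) b , c
      inner-w : Inner tgt′ w
      inner-w rewrite pb = v≢0 , subst (λ x → tl x ≢ v) (sym (tgt′-≢ (done⇒≢w v<k))) mid , refl
      pending′ : ∀ u → u < n → suc k ≤ pre u → mark′ u ≢ 0 →
        Inner tgt′ u × pre (parent u) < suc k × tgt′ u < m ×
        pre (hd (tgt′ u)) < pre (parent u) × (tl (tgt′ u) ≡ u ⊎ tgt′ u ≡ ch u)
      pending′ u u<n le mu with u ≟ w
      ... | yes refl = inner-w , subst (λ x → pre x < suc k) (sym pb) v<k ,
        subst (λ x → x < m × pre (hd x) < pre (parent w) × (tl x ≡ w ⊎ x ≡ ch w)) (sym (update-≡ tgt w (tgt v)))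
          (t<m , subst (λ x → pre (hd (tgt v)) < pre x) (sym pb) key ,
            subst (λ x → tl x ≡ w ⊎ x ≡ ch w) (sym (t≡ch mid)) (proj₂ (proj₂ (proj₂ (proj₂ (proj₂ bc-child))))))
      ... | no u≢w with pending u u<n le (subst (_≢ 0) (update-≢ mark 1 u≢w) mu)
      ...   | i , p<k , rest = inner (done⇒≢w p<k) i , p<k ,
        subst (λ x → x < m × pre (hd x) < pre (parent u) × (tl x ≡ u ⊎ x ≡ ch u)) (sym (tgt′-≢ u≢w)) rest
      child : ∀ u → u < n → u ≢ 0 → pre u < suc k → u ≢ 0 → tl (tgt′ u) ≢ u →
        bc u < n × bc u ≢ 0 × parent (bc u) ≡ u × tgt′ (bc u) ≡ tgt′ u × mark′ (bc u) ≢ 0 × free (bc u) ≡ 0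
      child u u<n u≢0 lt _ mid′ with u ≟ v
      ... | yes refl = b<n , b≢0 , pb , trans (update-≡ tgt w (tgt v)) (sym (tgt′-≢ (done⇒≢w lt))) ,
        subst (_≢ 0) (sym (update-≡ mark w 1)) (λ ()) , free-w
        where
        free-w : free w ≡ 0
        free-w with free w ≟ 0
        ... | yes eq = eq
        ... | no ne  = contradiction (proj₁ (proj₂ (freed w b<n ne))) (≤⇒≯ k<w)
      ... | no u≢v with tgt-child u u<n u≢0 lt u≢v (subst (λ x → tl x ≢ u) (tgt′-≢ (done⇒≢w lt)) mid′)
      ...   | a , b , c , d , e , f = a , b , c ,
        trans (tgt′-≢ bu≢w) (trans d (sym (tgt′-≢ (done⇒≢w lt)))) ,
        subst (_≢ 0) (sym (update-≢ mark 1 bu≢w)) e , f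
        where
        bu≢w : bc u ≢ w
        bu≢w eq = u≢v (trans (sym c) (trans (cong parent eq) pb))
      entry′ : ∀ {u} → u < n → u ≢ 0 → pre u < suc k → Entry (suc k) tgt entry free top u →
        Entry (suc k) tgt′ entry free top u
      entry′ {u} u<n u≢0 lt (inj₁ i) = inj₁ (inner (done⇒≢w (<-trans (par-< u u<n u≢0) lt)) i)
      entry′ {u} u<n u≢0 lt (inj₂ (x , e , done@(_ , _ , x<k) , ok , src , rest)) = inj₂ (x , e , done , ok ,
        subst (λ y → entry x ≡ suc e ⊎ (y ≡ e × tl e ≡ x)) (sym (tgt′-≢ (done⇒≢w x<k))) src , rest)

-- Pairs that share an ear arc and an entry

module Result {n m tl hd pre ord par post count lo hi ch bc}
  (G : Graph n m tl hd) (T : Tree n m tl hd pre ord par post count)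
  (L : Extremes.Low G T m lo) (H : Extremes.High G T m 1 hi) (C : Extremes.Child G T lo 1 ch bc) where
  open Subtrees G T
  open Extremes G T
  open Cover G T L H C

  -- `separated` records that none of the first `i` arcs can still form a pair. The preorder
  -- condition means that the arc leaves the subtree of its tail; a larger `post (tl e)` would mean
  -- that it comes from outside the subtree of `top (hd e)`.
  record Pairs (i : ℕ) (mark tgt entry free top : ℕ → ℕ) : Set where
    field
      ears      : Ears (suc count) 0 0 mark tgt entry free top
      separated : ∀ e → e < i → e < m → free (tl e) ≢ 0 → free (top (hd e)) ≢ 0 →
                  pre (hd e) < pre (tl e) → post (tl e) ≤ post (top (hd e))

  pairs-start : ∀ {mark tgt entry free top} → Ears (suc count) 0 0 mark tgt entry free top →
    Pairs 0 mark tgt entry free top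
  pairs-start E = record { ears = E ; separated = λ _ () }

  module _ {i mark tgt entry free top} (P : Pairs i mark tgt entry free top) where
    open Pairs P
    open Ears ears

    pairs-skip : (free (tl i) ≢ 0 → free (top (hd i)) ≢ 0 →
      pre (hd i) < pre (tl i) → post (tl i) ≤ post (top (hd i))) → Pairs (suc i) mark tgt entry free top
    pairs-skip h = record { ears = ears ; separated = sep }
      where
      sep : ∀ e → e < suc i → e < m → free (tl e) ≢ 0 → free (top (hd e)) ≢ 0 →
        pre (hd e) < pre (tl e) → post (tl e) ≤ post (top (hd e))
      sep e e≤i e<m with e ≟ i
      ... | yes refl = h
      ... | no ne    = separated e (≤∧≢⇒< (s≤s⁻¹ e≤i) ne) e<m

    -- Arc `i` becomes the last arc of the ear of `x` and replaces the entry of `z`. Dropping one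
    -- entry saves two units, exactly the two free flags that are lost.
    pairs-join : i < m → free (tl i) ≢ 0 → free (top (hd i)) ≢ 0 → pre (hd i) < pre (tl i) →
      post (top (hd i)) < post (tl i) →
      Pairs (suc i) mark (update tgt (tl i) i) (update entry (top (hd i)) 0)
        (update (update free (tl i) 0) (top (hd i)) 0) top
    pairs-join i<m fx fz back below = record { ears = ears′ ; separated = sep }
      where
      x = tl i
      z = top (hd i)
      tgt′ = update tgt x i
      entry′ = update entry z 0
      freeₓ = update free x 0
      free′ = update freeₓ z 0
      x<n = tl<n i i<m
      all : ∀ {v} → v < n → pre v < suc count
      all {v} v<n = s≤s (pre≤count v v<n)
      z<n = proj₁ (top-D (hd i) (hd<n i i<m) (all (hd<n i i<m)))
      D-z = proj₂ (top-D (hd i) (hd<n i i<m) (all (hd<n i i<m)))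
      x≢0 = proj₁ (freed x x<n fx)
      z≢0 = proj₁ (freed z z<n fz)
      x≢z : x ≢ z
      x≢z eq = <-irrefl (cong post (sym eq)) below
      end-x : tl (tgt x) ≡ x
      end-x = proj₁ (proj₂ (proj₂ (proj₂ (freed x x<n fx))))
      tgt′-≢ : ∀ {u} → u ≢ x → tgt′ u ≡ tgt u
      tgt′-≢ = update-≢ tgt i
      free-0 : ∀ u → free u ≡ 0 → free′ u ≡ 0
      free-0 u f = update-elim (_≡ 0) freeₓ z 0 u (λ _ → refl)
        (λ _ → update-elim (_≡ 0) free x 0 u (λ _ → refl) (λ _ → f))
      free⁻ : ∀ {u} → free′ u ≢ 0 → u ≢ x × u ≢ z × free u ≢ 0
      free⁻ {u} f = u≢x , u≢z , λ f0 → f (free-0 u f0)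
        where
        u≢z : u ≢ z
        u≢z u≡z = f (trans (cong free′ u≡z) (update-≡ freeₓ z 0))
        u≢x : u ≢ x
        u≢x u≡x = f (trans (update-≢ freeₓ 0 u≢z) (trans (cong freeₓ u≡x) (update-≡ free x 0)))
      free-x : free′ x ≡ 0
      free-x = trans (update-≢ freeₓ 0 x≢z) (update-≡ free x 0)
      sep : ∀ e → e < suc i → e < m → free′ (tl e) ≢ 0 → free′ (top (hd e)) ≢ 0 →
        pre (hd e) < pre (tl e) → post (tl e) ≤ post (top (hd e))
      sep e e≤i e<m f f′ with e ≟ i
      ... | yes refl = contradiction refl (proj₁ (free⁻ f))
      ... | no ne    = separated e (≤∧≢⇒< (s≤s⁻¹ e≤i) ne) e<m (proj₂ (proj₂ (free⁻ f))) (proj₂ (proj₂ (free⁻ f′)))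
      child : ∀ u → u < n → u ≢ 0 → pre u < suc count → u ≢ 0 → tl (tgt′ u) ≢ u →
        bc u < n × bc u ≢ 0 × parent (bc u) ≡ u × tgt′ (bc u) ≡ tgt′ u × mark (bc u) ≢ 0 × free′ (bc u) ≡ 0
      child u u<n u≢0 lt _ mid = cont (tgt-child u u<n u≢0 lt u≢0 (subst (λ y → tl y ≢ u) (tgt′-≢ u≢x) mid))
        where
        u≢x : u ≢ x
        u≢x refl = mid (cong tl (update-≡ tgt x i))
        cont : _ → _
        -- The vertex continuing an ear is not free and so differs from `x`: the last arc replaced
        -- at `x` was not inherited from another vertex.
        cont (a , b , c , d , e , f) = a , b , c ,
          trans (tgt′-≢ λ eq → fx (trans (cong free (sym eq)) f)) (trans d (sym (tgt′-≢ u≢x))) , e , free-0 (bc u) f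
      old-entry : ∀ u → u < n → u ≢ 0 → Entry (suc count) tgt entry free top u →
        Entry (suc count) tgt′ entry′ free′ top u
      old-entry u u<n u≢0 (inj₁ (a , b , c)) = inj₁ (a ,
        subst (λ y → tl y ≢ parent u) (sym (tgt′-≢ λ eq → b (trans (cong (tl ∘ tgt) eq) (trans end-x (sym eq))))) b , c)
      old-entry u u<n u≢0 (inj₂ (w , e , bounds , ok , src , who , at)) with u ≟ z
      ... | yes refl = inj₂ (x , i , (x<n , x≢0 , all x<n) , (i<m , below) , inj₂ (update-≡ tgt x i , refl) ,
        inj₂ free-x , inj₂ (proj₁ (proj₂ (proj₂ (freed z z<n fz))) , D-z))
      ... | no u≢z = inj₂ (w , e , bounds , ok , src′ src , who′ who , at)
        where
        w≢z : w ≡ u ⊎ free w ≡ 0 → w ≢ z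
        w≢z (inj₁ w≡u) w≡z = u≢z (trans (sym w≡u) w≡z)
        w≢z (inj₂ f)   w≡z = fz (trans (cong free (sym w≡z)) f)
        -- An ear arc starting at `u` cannot witness `u` itself, since its tail would have to close
        -- after `u`; any other owner is not free, whereas `x` is.
        w≢x : w ≡ u ⊎ free w ≡ 0 → tl e ≡ w → w ≢ x
        w≢x (inj₁ w≡u) t _   = <-irrefl (cong post (sym (trans t w≡u))) (proj₂ ok)
        w≢x (inj₂ f)   _ w≡x = fx (trans (cong free (sym w≡x)) f)
        src′ : entry w ≡ suc e ⊎ (tgt w ≡ e × tl e ≡ w) → entry′ w ≡ suc e ⊎ (tgt′ w ≡ e × tl e ≡ w)
        src′ (inj₁ eq)       = inj₁ (trans (update-≢ entry 0 (w≢z who)) eq)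
        src′ (inj₂ (eq , t)) = inj₂ (trans (tgt′-≢ (w≢x who t)) eq , t)
        who′ : w ≡ u ⊎ free w ≡ 0 → w ≡ u ⊎ free′ w ≡ 0
        who′ (inj₁ eq) = inj₁ eq
        who′ (inj₂ f)  = inj₂ (free-0 w f)
      ears′ : Ears (suc count) 0 0 mark tgt′ entry′ free′ top
      ears′ = record
        { mark-root = mark-root ; marked = marked
        ; pending = λ v v<n le → contradiction le (<⇒≱ (all v<n))
        ; tgt-ok = λ v v<n v≢0 lt → update-elim (λ y → y < m × pre (hd y) < pre v) tgt x i v
            (λ v≡x → i<m , subst (λ y → pre (hd i) < pre y) (sym v≡x) back) (λ _ → tgt-ok v v<n v≢0 lt)
        ; tgt-child = child
        ; entries = λ v v<n v≢0 lt → old-entry v v<n v≢0 (entries v v<n v≢0 lt)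
        ; top-root = top-root ; top-D = top-D ; top-none = top-none ; top-cases = top-cases
        ; freed = λ v v<n f → let (v≢x , v≢z , f′) = free⁻ f ; (a , b , c , d , e) = freed v v<n f′ in
            a , b , c , trans (cong tl (tgt′-≢ v≢x)) d , subst (_≢ 0) (sym (update-≢ entry 0 v≢z)) e
        ; entry-0 = λ v v<n le → contradiction le (<⇒≱ (all v<n))
        ; unpaired = λ v v<n v≢0 lt t f → unpaired v v<n v≢0 lt t (proj₂ (proj₂ (free⁻ f)))
        ; balance = s≤s⁻¹ (s≤s⁻¹ bal)
        }
        where
        bal : 2 + 2 * ∑ n ([_≢0] ∘ entry′) ≤ 2 + (∑ n ([_≢0] ∘ mark) + ∑ n ([_≢0] ∘ free′))
        bal = begin
          2 + 2 * ∑ n ([_≢0] ∘ entry′)    ≡⟨ sym (*-suc 2 _) ⟩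
          2 * suc (∑ n ([_≢0] ∘ entry′))  ≡⟨ cong (2 *_) (∑-clear n entry z<n (proj₂ (proj₂ (proj₂ (proj₂ (freed z z<n fz)))))) ⟩
          2 * ∑ n ([_≢0] ∘ entry)         ≤⟨ balance ⟩
          M + ∑ n ([_≢0] ∘ free)          ≡⟨ cong (M +_) (sym (∑-clear n free x<n fx)) ⟩
          M + suc (∑ n ([_≢0] ∘ freeₓ))   ≡⟨ cong (λ a → M + suc a) (sym (∑-clear n freeₓ z<n (subst (_≢ 0) (sym (update-≢ free 0 (≢-sym x≢z))) fz))) ⟩
          M + (2 + ∑ n ([_≢0] ∘ free′))   ≡⟨ +-assoc M 2 _ ⟨
          M + 2 + ∑ n ([_≢0] ∘ free′)     ≡⟨ cong (_+ ∑ n ([_≢0] ∘ free′)) (+-comm M 2) ⟩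
          2 + (M + ∑ n ([_≢0] ∘ free′))   ∎
          where open ≤-Reasoning ; M = ∑ n ([_≢0] ∘ mark)

-- The solution and its size

-- Each vertex other than the root contributes one ear arc and at most one entry. Counting starts at
-- `i = 1`, and the `suc` in `out-size` stands for the root, which contributes nothing. Coinciding
-- arcs only help the bound.
record Output (m i : ℕ) (tl par bc tgt entry out : ℕ → ℕ) : Set where
  field
    out-tgt   : ∀ u → u ≢ 0 → u < i → tl (tgt u) ≡ u → out (tgt u) ≢ 0
    out-child : ∀ u → u ≢ 0 → u < i → tl (tgt u) ≢ u → out (par (bc u)) ≢ 0
    out-entry : ∀ u e → u ≢ 0 → u < i → entry u ≡ suc e → out e ≢ 0
    out-size  : suc (∑ m ([_≢0] ∘ out)) ≤ i + ∑ i ([_≢0] ∘ entry)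

output-start : ∀ {m tl par bc tgt entry out} → (∀ e → out e ≡ 0) → Output m 1 tl par bc tgt entry out
output-start {m} z = record
  { out-tgt = λ u u≢0 lt → contradiction (n≤0⇒n≡0 (s≤s⁻¹ lt)) u≢0
  ; out-child = λ u u≢0 lt → contradiction (n≤0⇒n≡0 (s≤s⁻¹ lt)) u≢0
  ; out-entry = λ u e u≢0 lt → contradiction (n≤0⇒n≡0 (s≤s⁻¹ lt)) u≢0
  ; out-size = s≤s (≤-trans (≤-reflexive (trans (∑-cong m λ j _ → cong [_≢0] (z j)) (∑-0 m))) z≤n)
  }

module _ {m i tl par bc tgt entry out} (O : Output m i tl par bc tgt entry out) where
  open Output O

  private
    extend : ∀ {out′} → (∀ e → out e ≢ 0 → out′ e ≢ 0) →
      (tl (tgt i) ≡ i → out′ (tgt i) ≢ 0) → (tl (tgt i) ≢ i → out′ (par (bc i)) ≢ 0) →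
      (∀ e → entry i ≡ suc e → out′ e ≢ 0) →
      suc (∑ m ([_≢0] ∘ out′)) ≤ suc i + ∑ (suc i) ([_≢0] ∘ entry) →
      Output m (suc i) tl par bc tgt entry out′
    extend {out′} mono at-tgt at-child at-entry size = record
      { out-tgt = λ u u≢0 lt → split (λ u → tl (tgt u) ≡ u → out′ (tgt u) ≢ 0) at-tgt
          (λ lt′ t → mono _ (out-tgt u u≢0 lt′ t)) lt
      ; out-child = λ u u≢0 lt → split (λ u → tl (tgt u) ≢ u → out′ (par (bc u)) ≢ 0) at-child
          (λ lt′ t → mono _ (out-child u u≢0 lt′ t)) lt
      ; out-entry = λ u e u≢0 lt → split (λ u → entry u ≡ suc e → out′ e ≢ 0) (at-entry e)
          (λ lt′ t → mono _ (out-entry u e u≢0 lt′ t)) lt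
      ; out-size = size
      }
      where
      split : ∀ (P : ℕ → Set) → P i → ∀ {u} → (u < i → P u) → u < suc i → P u
      split P Pi {u} h lt with u ≟ i
      ... | yes refl = Pi
      ... | no ne    = h (≤∧≢⇒< (s≤s⁻¹ lt) ne)

    mono : ∀ (out : ℕ → ℕ) x e → out e ≢ 0 → update out x 1 e ≢ 0
    mono out x e o = update-elim (_≢ 0) out x 1 e (λ _ ()) (λ _ → o)

    hit : ∀ (out : ℕ → ℕ) x → update out x 1 x ≢ 0
    hit out x eq = contradiction (trans (sym (update-≡ out x 1)) eq) λ ()

    ≤-tail : suc i + ∑ i ([_≢0] ∘ entry) ≤ suc i + ∑ (suc i) ([_≢0] ∘ entry)
    ≤-tail = +-monoʳ-≤ (suc i) (m≤m+n _ _)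

  module _ {x} (x-tgt : tl (tgt i) ≡ i → x ≡ tgt i) (x-child : tl (tgt i) ≢ i → x ≡ par (bc i)) where

    output-step : entry i ≡ 0 → Output m (suc i) tl par bc tgt entry (update out x 1)
    output-step e0 = extend (mono out x)
      (λ t → subst (λ y → update out x 1 y ≢ 0) (x-tgt t) (hit out x))
      (λ t → subst (λ y → update out x 1 y ≢ 0) (x-child t) (hit out x))
      (λ e eq → contradiction (trans (sym e0) eq) λ ())
      (≤-trans (s≤s (≤-trans (∑-update-≤ m out x 1) out-size)) ≤-tail)

    output-step-entry : entry i ≢ 0 →
      Output m (suc i) tl par bc tgt entry (update (update out x 1) (pred (entry i)) 1)
    output-step-entry e≢0 = extend (λ e → mono out₁ y e ∘ mono out x e)
      (λ t → mono out₁ y (tgt i) (subst (λ y → out₁ y ≢ 0) (x-tgt t) (hit out x)))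
      (λ t → mono out₁ y (par (bc i)) (subst (λ y → out₁ y ≢ 0) (x-child t) (hit out x)))
      (λ e eq → subst (λ z → update out₁ y 1 z ≢ 0) (cong pred eq) (hit out₁ y))
      (begin
        suc (∑ m (w ∘ update out₁ y 1))       ≤⟨ s≤s (∑-update-≤ m out₁ y 1) ⟩
        2 + ∑ m (w ∘ out₁)                    ≤⟨ s≤s (s≤s (∑-update-≤ m out x 1)) ⟩
        2 + suc (∑ m (w ∘ out))               ≤⟨ s≤s (s≤s out-size) ⟩
        2 + (i + ∑ i (w ∘ entry))             ≡⟨ cong suc (sym (+-suc i _)) ⟩
        suc i + suc (∑ i (w ∘ entry))         ≡⟨ cong (suc i +_) (+-comm 1 _) ⟩
        suc i + (∑ i (w ∘ entry) + 1)         ≡⟨ cong (λ a → suc i + (∑ i (w ∘ entry) + a)) (sym ([≢0]≡1 e≢0)) ⟩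
        suc i + ∑ (suc i) (w ∘ entry)         ∎)
      where
      open ≤-Reasoning
      w = [_≢0]
      y = pred (entry i)
      out₁ = update out x 1

-- Strong connectivity and the performance guarantee

module Quality {n m tl hd pre ord par post count lo hi ch bc}
  (G : Graph n m tl hd) (T : Tree n m tl hd pre ord par post count)
  (L : Extremes.Low G T m lo) (H : Extremes.High G T m 1 hi) (C : Extremes.Child G T lo 1 ch bc)
  {mark tgt entry free top out : ℕ → ℕ}
  (P : Result.Pairs G T L H C m mark tgt entry free top)
  (O : Output m n tl par bc tgt entry out) where
  open Subtrees G T
  open Extremes G T
  open Cover G T L H C
  open Result G T L H C
  open Pairs P
  open Ears ears
  open Output O

  private
    all : ∀ {v} → v < n → pre v < suc count
    all {v} v<n = s≤s (pre≤count v v<n)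

  Walk : ℕ → ℕ → Set
  Walk = Star (Arc m tl hd λ e → out e ≢ 0)

  -- Preorder numbers grow along an ear, so `k` bounds the rest of it.
  climb : ∀ k v → v < n → v ≢ 0 → count ≤ k + pre v → Walk v (hd (tgt v))
  climb k v v<n v≢0 le with tl (tgt v) ≟ v
  ... | yes t = (tgt v , proj₁ (tgt-ok v v<n v≢0 (all v<n)) , out-tgt v v≢0 v<n t , t , refl) ◅ ε
  ... | no t with tgt-child v v<n v≢0 (all v<n) v≢0 t
  ...   | b<n , b≢0 , pb , tb , _ with k
  ...     | zero   = contradiction (subst (λ x → pre x < pre (bc v)) pb (par-< (bc v) b<n b≢0))
    (≤⇒≯ (≤-trans (pre≤count (bc v) b<n) le))
  ...     | suc k′ = (par (bc v) , par<m (bc v) b<n b≢0 , out-child v v≢0 v<n t , pb , hd-par (bc v) b<n b≢0) ◅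
    subst (λ x → Walk (bc v) (hd x)) tb (climb k′ (bc v) b<n b≢0 (≤-trans le (≤-trans
      (≤-reflexive (sym (+-suc k′ (pre v))))
      (+-monoʳ-≤ k′ (subst (λ x → pre x < pre (bc v)) pb (par-< (bc v) b<n b≢0))))))

  to-root : ∀ k v → v < n → pre v ≤ k → Walk v 0
  to-root zero    v v<n le = contradiction (pre>0 v v<n) (≤⇒≯ le)
  to-root (suc k) v v<n le with v ≟ 0
  ... | yes refl = ε
  ... | no v≢0 = let (t<m , lt) = tgt-ok v v<n v≢0 (all v<n) in
    climb count v v<n v≢0 (m≤m+n count _) ◅◅ to-root k (hd (tgt v)) (hd<n _ t<m) (s≤s⁻¹ (≤-trans lt le))

  post-root : ∀ k v → v < n → pre v ≤ k → post v ≤ post 0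
  post-root zero    v v<n le = contradiction (pre>0 v v<n) (≤⇒≯ le)
  post-root (suc k) v v<n le with v ≟ 0
  ... | yes refl = ≤-refl
  ... | no v≢0 = ≤-trans (<⇒≤ (post-parent v<n v≢0))
    (post-root k (parent v) (parent<n v<n v≢0) (s≤s⁻¹ (≤-trans (par-< v v<n v≢0) le)))

  entered : ∀ v → v < n → v ≢ 0 → ∃ λ u → u < n × post v < post u × Walk u v
  entered v v<n v≢0 with entries v v<n v≢0 (all v<n)
  ... | inj₁ (p≢0 , mid , bp) = parent v , parent<n v<n v≢0 , post-parent v<n v≢0 ,
    (par v , par<m v v<n v≢0 , subst (λ x → out (par x) ≢ 0) bp (out-child (parent v) p≢0 (parent<n v<n v≢0) mid) ,
      refl , hd-par v v<n v≢0) ◅ ε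
  ... | inj₂ (u , e , (u<n , u≢0 , _) , (e<m , lt) , src , _ , at) =
    tl e , tl<n e e<m , lt , (e , e<m , chosen src , refl , refl) ◅ reach at
    where
    chosen : entry u ≡ suc e ⊎ (tgt u ≡ e × tl e ≡ u) → out e ≢ 0
    chosen (inj₁ eq)         = out-entry u e u≢0 u<n eq
    chosen (inj₂ (refl , t)) = out-tgt u u≢0 u<n t
    reach : hd e ≡ v ⊎ (top v ≡ v × D v (hd e)) → Walk (hd e) v
    reach (inj₁ refl)    = ε
    -- The walk to the root from `to-root` has to leave the subtree of the singleton `v`, and passes
    -- through `v` in doing so.
    reach (inj₂ (t , d)) = exit-root
      (λ e′ → leaving-root L C v<n v≢0 (top-none v v<n v≢0 (all v<n) t))
      (to-root _ (hd e) (hd<n e e<m) ≤-refl) d (¬D-root v<n v≢0)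

  -- Going backwards from `v`, `entered` leads to ever larger postorder numbers, and the largest is
  -- that of the root.
  from-root : ∀ k v → v < n → post 0 ≤ k + post v → Walk 0 v
  from-root k v v<n le with v ≟ 0
  ... | yes refl = ε
  ... | no v≢0 with entered v v<n v≢0
  ...   | u , u<n , lt , w with k
  ...     | zero   = contradiction (<-≤-trans lt (post-root _ u u<n ≤-refl)) (≤⇒≯ le)
  ...     | suc k′ = from-root k′ u u<n (≤-trans le
    (≤-trans (≤-reflexive (sym (+-suc k′ (post v)))) (+-monoʳ-≤ k′ lt))) ◅◅ w

  strongly-connected : ∀ u v → u < n → v < n → Walk u v
  strongly-connected u v u<n v<n = to-root _ u u<n ≤-refl ◅◅ from-root (post 0) v v<n (m≤m+n _ _)

  -- On the path from `z` down to `x`, `top` stays `z` until the first singleton strictly below `z`;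
  -- that one is `y`.
  top-or-below : ∀ {z} → z < n → z ≢ 0 → top z ≡ z → ∀ k x → pre x ≤ k → x < n → D z x →
    top x ≡ z ⊎ ∃ λ y → y < n × y ≢ 0 × top y ≡ y × top (parent y) ≡ z × D y x
  top-or-below z<n z≢0 tz zero    x le x<n d = contradiction (pre>0 x x<n) (≤⇒≯ le)
  top-or-below {z} z<n z≢0 tz (suc k) x le x<n d with x ≟ z
  ... | yes refl = inj₁ tz
  ... | no x≢z with D-up z<n x<n d x≢z
  ...   | x≢0 , d′ with top-or-below z<n z≢0 tz k (parent x) (s≤s⁻¹ (≤-trans (par-< x x<n x≢0) le))
                          (parent<n x<n x≢0) d′
  ...     | inj₂ (y , y<n , y≢0 , ty , tp , dy) =
    inj₂ (y , y<n , y≢0 , ty , tp , D-trans dy (D-child x<n x≢0))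
  ...     | inj₁ tp with top-cases x x<n x≢0 (all x<n)
  ...       | inj₁ tx = inj₂ (x , x<n , x≢0 , tx , tp , D-refl)
  ...       | inj₂ eq = inj₁ (trans eq tp)

  -- Otherwise the arc would also enter the subtree of a singleton `y` next below `z`. Then the tail
  -- of `hi y` closes after `z`, against `unpaired`: `y` and `z` could have shared an entry.
  entering-top : ∀ {z e} → z < n → free z ≢ 0 → e < m → D z (hd e) → ¬ D z (tl e) → top (hd e) ≡ z
  entering-top {z} {e} z<n fz e<m d ¬d with freed z z<n fz
  ... | z≢0 , _ , tz , _ with top-or-below z<n z≢0 tz _ (hd e) ≤-refl (hd<n e e<m) d
  ...   | inj₁ eq = eq
  ...   | inj₂ (y , y<n , y≢0 , ty , tp , dy) = contradiction (entering z<n e<m d ¬d) (≤⇒≯ (≤-trans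
    (hi-bound H y<n e<m dy)
    (subst (λ x → post (tl (hi y)) ≤ post x) tp
      (unpaired y y<n y≢0 (all y<n) ty (subst (λ x → free x ≢ 0) (sym tp) fz)))))

  module _ (X : ℕ → ℕ) (X-connected : ∀ u v → u < n → v < n → Star (Arc m tl hd λ e → X e ≢ 0) u v) where

    -- Leaving arcs are told apart by their tails, entering arcs by `top` of their heads. The second
    -- `pigeonhole` works on what the first leaves over, and by `separated` no entering arc has been
    -- used up.
    free-bound : 2 * ∑ n ([_≢0] ∘ free) ≤ ∑ m ([_≢0] ∘ X)
    free-bound with pigeonhole n free X m (λ z e → tl e ≡ z × ¬ D z (hd e)) out-arc
                      (λ i j e (a , _) (b , _) → trans (sym a) b)
      where
      out-arc : ∀ z → z < n → free z ≢ 0 → ∃ λ e → e < m × X e ≢ 0 × tl e ≡ z × ¬ D z (hd e)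
      out-arc z z<n fz with freed z z<n fz
      ... | z≢0 , _ , tz , _ with crossing (D? z) (X-connected z 0 z<n n>0) D-refl (¬D-root z<n z≢0)
      ...   | e , e<m , Xe , d , ¬d = e , e<m , Xe ,
        leaving-root L C z<n z≢0 (top-none z z<n z≢0 (all z<n) tz) e<m d ¬d , ¬d
    ... | X′ , eq , keep with pigeonhole n free X′ m (λ z e → top (hd e) ≡ z) in-arc
                                (λ i j e a b → trans (sym a) b)
      where
      in-arc : ∀ z → z < n → free z ≢ 0 → ∃ λ e → e < m × X′ e ≢ 0 × top (hd e) ≡ z
      in-arc z z<n fz with freed z z<n fz
      ... | z≢0 , _ with crossing (λ x → ¬? (D? z x)) (X-connected 0 z n>0 z<n) (¬D-root z<n z≢0) (λ ¬d → ¬d D-refl)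
      ...   | e , e<m , Xe , ¬d , ¬¬d = e , e<m , keep e Xe unshared , t
        where
        d = decidable-stable (D? z (hd e)) ¬¬d
        t = entering-top z<n fz e<m d ¬d
        unshared : ∀ i → i < n → free i ≢ 0 → ¬ (tl e ≡ i × ¬ D i (hd e))
        unshared i i<n fi (refl , ¬di) = <⇒≱ (entering z<n e<m d ¬d)
          (subst (λ x → post (tl e) ≤ post x) t (separated e e<m e<m fi (subst (λ x → free x ≢ 0) (sym t) fz)
            (leaving i<n e<m D-refl ¬di)))
    ... | X″ , eq′ , _ = begin
      2 * F              ≡⟨ cong (F +_) (+-identityʳ F) ⟩
      F + F              ≤⟨ +-monoʳ-≤ F (m≤m+n F _) ⟩
      F + (F + ∑ m ([_≢0] ∘ X″)) ≡⟨ cong (F +_) eq′ ⟩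
      F + ∑ m ([_≢0] ∘ X′)  ≡⟨ eq ⟩
      ∑ m ([_≢0] ∘ X)       ∎
      where
      open ≤-Reasoning
      F = ∑ n ([_≢0] ∘ free)

    mark-bound : ∑ n ([_≢0] ∘ mark) < n
    mark-bound = subst (suc (∑ n ([_≢0] ∘ mark)) ≤_) (∑-1 n)
      (∑-mono-< n n>0 (λ j _ → [≢0]≤1 (mark j)) (subst (λ x → [ x ≢0] < 1) (sym mark-root) ≤-refl))

    -- The size bound times four reads 6 (n - 1) + 2 F. Adding 6 removes the subtraction: 4 goes
    -- into `out-size`, 2 into `mark-bound`, and 6 comes back from `vertices≤arcs`.
    approximation : 4 * ∑ m ([_≢0] ∘ out) ≤ 7 * ∑ m ([_≢0] ∘ X)
    approximation = +-cancelˡ-≤ 6 _ _ (begin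
      6 + 4 * Os                    ≡⟨ solve 1 (λ o → con 6 :+ con 4 :* o := con 2 :+ con 4 :* (con 1 :+ o)) refl Os ⟩
      2 + 4 * suc Os                ≤⟨ +-monoʳ-≤ 2 (*-monoʳ-≤ 4 out-size) ⟩
      2 + 4 * (n + E)               ≡⟨ solve 2 (λ n e → con 2 :+ con 4 :* (n :+ e) := con 4 :* n :+ con 2 :+ con 2 :* (con 2 :* e)) refl n E ⟩
      4 * n + 2 + 2 * (2 * E)       ≤⟨ +-monoʳ-≤ (4 * n + 2) (*-monoʳ-≤ 2 balance) ⟩
      4 * n + 2 + 2 * (M + F)       ≡⟨ solve 3 (λ n m f → con 4 :* n :+ con 2 :+ con 2 :* (m :+ f) := con 4 :* n :+ con 2 :* (con 1 :+ m) :+ con 2 :* f) refl n M F ⟩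
      4 * n + 2 * suc M + 2 * F     ≤⟨ +-mono-≤ (+-monoʳ-≤ (4 * n) (*-monoʳ-≤ 2 mark-bound)) free-bound ⟩
      4 * n + 2 * n + Xs            ≡⟨ cong (_+ Xs) (sym (*-distribʳ-+ n 4 2)) ⟩
      6 * n + Xs                    ≤⟨ +-monoˡ-≤ Xs (*-monoʳ-≤ 6 (vertices≤arcs G X X-connected)) ⟩
      6 * suc Xs + Xs               ≡⟨ solve 1 (λ x → con 6 :* (con 1 :+ x) :+ x := con 6 :+ con 7 :* x) refl Xs ⟩
      6 + 7 * Xs                    ∎)
      where
      open ≤-Reasoning
      open +-*-Solver
      Os = ∑ m ([_≢0] ∘ out)
      E = ∑ n ([_≢0] ∘ entry)
      M = ∑ n ([_≢0] ∘ mark)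
      F = ∑ n ([_≢0] ∘ free)
      Xs = ∑ m ([_≢0] ∘ X)

-- The program

nᵣ mᵣ iᵣ cᵣ countᵣ finᵣ eᵣ vᵣ : ℕ
nᵣ = 0
mᵣ = 1
iᵣ = 2
cᵣ = 3
countᵣ = 4
finᵣ = 5
eᵣ = 6
vᵣ = 7

-- firstₐ, nextₐ: linked lists of the arcs with a given tail; arc e is stored as
--   e + 1, and 0 ends a list.  The search uses firstₐ as its scanning pointers.
-- preₐ, postₐ: the preorder and postorder numbers, starting at 1.
-- ordₐ: the vertex with a given preorder number.
-- parₐ: the tree arc into a vertex.
-- loₐ: the arc from v whose head has the least preorder number.
-- hiₐ: the arc into the subtree of v whose tail has the largest postorder number.
-- chₐ, bcₐ: the arc from a proper descendant of v whose head has the least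
--   preorder number, and the child of v above its tail.
-- markₐ: whether a vertex is on an ear.
-- tgtₐ: the last arc of the ear of v.
-- entryₐ: e + 1 if arc e is the entry of the ear starting at v, 0 if it has none.
-- freeₐ: whether v is a free singleton.
-- topₐ: the closest singleton on the tree path from v to the root, or 0.
tlₐ hdₐ outₐ firstₐ nextₐ preₐ ordₐ parₐ postₐ loₐ hiₐ chₐ bcₐ markₐ tgtₐ entryₐ freeₐ topₐ : ℕ
tlₐ = 0
hdₐ = 1
outₐ = 2
firstₐ = 3
nextₐ = 4
preₐ = 5
ordₐ = 6
parₐ = 7
postₐ = 8
loₐ = 9
hiₐ = 10
chₐ = 11
bcₐ = 12
markₐ = 13
tgtₐ = 14
entryₐ = 15
freeₐ = 16
topₐ = 17

vertex : Exp
vertex = ordₐ [ reg iᵣ ]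

parentOf : Exp → Exp
parentOf e = tlₐ [ parₐ [ e ] ]

listsBody searchBody startBody arcsBody treeBody takeFree classifyStep extendStep earsBody pairsBody outputBody : Program

listsBody =
  (nextₐ [ reg iᵣ ]≔ (firstₐ [ tlₐ [ reg iᵣ ] ])) ⨾
  (firstₐ [ tlₐ [ reg iᵣ ] ]≔ inc (reg iᵣ)) ⨾
  (iᵣ ≔ inc (reg iᵣ))

searchBody =
  IF (firstₐ [ reg cᵣ ]) == lit 0
  THEN (
    (finᵣ ≔ inc (reg finᵣ)) ⨾
    (postₐ [ reg cᵣ ]≔ reg finᵣ) ⨾
    -- Tree arcs serve as the stack. For the root the value read is arbitrary, but then the loop
    -- ends.
    (cᵣ ≔ (tlₐ [ parₐ [ reg cᵣ ] ])))
  ELSE (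
    (eᵣ ≔ dec (firstₐ [ reg cᵣ ])) ⨾
    (vᵣ ≔ (hdₐ [ reg eᵣ ])) ⨾
    (firstₐ [ reg cᵣ ]≔ (nextₐ [ reg eᵣ ])) ⨾
    (IF (preₐ [ reg vᵣ ]) == lit 0
     THEN (
       (countᵣ ≔ inc (reg countᵣ)) ⨾
       (preₐ [ reg vᵣ ]≔ reg countᵣ) ⨾
       (ordₐ [ reg countᵣ ]≔ reg vᵣ) ⨾
       (parₐ [ reg vᵣ ]≔ reg eᵣ) ⨾
       (cᵣ ≔ reg vᵣ))
     ELSE skip))

startBody =
  (loₐ [ reg iᵣ ]≔ (parₐ [ reg iᵣ ])) ⨾
  (hiₐ [ reg iᵣ ]≔ (parₐ [ reg iᵣ ])) ⨾
  (chₐ [ reg iᵣ ]≔ (parₐ [ reg iᵣ ])) ⨾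
  (iᵣ ≔ inc (reg iᵣ))

arcsBody =
  (IF (preₐ [ hdₐ [ reg iᵣ ] ]) << (preₐ [ hdₐ [ loₐ [ tlₐ [ reg iᵣ ] ] ] ])
   THEN (loₐ [ tlₐ [ reg iᵣ ] ]≔ reg iᵣ) ELSE skip) ⨾
  (IF (postₐ [ tlₐ [ hiₐ [ hdₐ [ reg iᵣ ] ] ] ]) << (postₐ [ tlₐ [ reg iᵣ ] ])
   THEN (hiₐ [ hdₐ [ reg iᵣ ] ]≔ reg iᵣ) ELSE skip) ⨾
  (iᵣ ≔ inc (reg iᵣ))

treeBody =
  (IF (preₐ [ hdₐ [ loₐ [ vertex ] ] ]) << (preₐ [ hdₐ [ chₐ [ parentOf vertex ] ] ])
   THEN ((chₐ [ parentOf vertex ]≔ (loₐ [ vertex ])) ⨾ (bcₐ [ parentOf vertex ]≔ vertex)) ELSE skip) ⨾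
  (IF (preₐ [ hdₐ [ chₐ [ vertex ] ] ]) << (preₐ [ hdₐ [ chₐ [ parentOf vertex ] ] ])
   THEN ((chₐ [ parentOf vertex ]≔ (chₐ [ vertex ])) ⨾ (bcₐ [ parentOf vertex ]≔ vertex)) ELSE skip) ⨾
  (IF (postₐ [ tlₐ [ hiₐ [ parentOf vertex ] ] ]) << (postₐ [ tlₐ [ hiₐ [ vertex ] ] ])
   THEN (hiₐ [ parentOf vertex ]≔ (hiₐ [ vertex ])) ELSE skip) ⨾
  (iᵣ ≔ dec (reg iᵣ))

takeFree = (entryₐ [ vertex ]≔ inc (parₐ [ vertex ])) ⨾ (freeₐ [ vertex ]≔ lit 1)

classifyStep =
  IF (markₐ [ vertex ]) == lit 0
  THEN (
    (markₐ [ vertex ]≔ lit 1) ⨾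
    (IF (preₐ [ hdₐ [ chₐ [ vertex ] ] ]) << (preₐ [ vertex ])
     THEN (
       (tgtₐ [ vertex ]≔ (chₐ [ vertex ])) ⨾
       (entryₐ [ vertex ]≔ inc (parₐ [ vertex ])) ⨾
       (topₐ [ vertex ]≔ (topₐ [ parentOf vertex ])))
     ELSE (
       (tgtₐ [ vertex ]≔ (loₐ [ vertex ])) ⨾
       (IF (freeₐ [ topₐ [ parentOf vertex ] ]) == lit 0
        THEN takeFree
        ELSE
          (IF (postₐ [ topₐ [ parentOf vertex ] ]) << (postₐ [ tlₐ [ hiₐ [ vertex ] ] ])
           THEN (
             (entryₐ [ topₐ [ parentOf vertex ] ]≔ inc (hiₐ [ vertex ])) ⨾
             (freeₐ [ topₐ [ parentOf vertex ] ]≔ lit 0))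
           ELSE takeFree)) ⨾
       (topₐ [ vertex ]≔ vertex))))
  ELSE (topₐ [ vertex ]≔ (topₐ [ parentOf vertex ]))

extendStep =
  (IF (tlₐ [ tgtₐ [ vertex ] ]) == vertex
   THEN skip
   ELSE (
     (markₐ [ bcₐ [ vertex ] ]≔ lit 1) ⨾
     (tgtₐ [ bcₐ [ vertex ] ]≔ (tgtₐ [ vertex ])))) ⨾
  (iᵣ ≔ inc (reg iᵣ))

earsBody = classifyStep ⨾ extendStep

pairsBody =
  (IF (freeₐ [ tlₐ [ reg iᵣ ] ]) == lit 0 THEN skip ELSE
    (IF (freeₐ [ topₐ [ hdₐ [ reg iᵣ ] ] ]) == lit 0 THEN skip ELSE
      (IF (preₐ [ hdₐ [ reg iᵣ ] ]) << (preₐ [ tlₐ [ reg iᵣ ] ])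
       THEN
         (IF (postₐ [ topₐ [ hdₐ [ reg iᵣ ] ] ]) << (postₐ [ tlₐ [ reg iᵣ ] ])
          THEN (
            (freeₐ [ tlₐ [ reg iᵣ ] ]≔ lit 0) ⨾
            (freeₐ [ topₐ [ hdₐ [ reg iᵣ ] ] ]≔ lit 0) ⨾
            (entryₐ [ topₐ [ hdₐ [ reg iᵣ ] ] ]≔ lit 0) ⨾
            (tgtₐ [ tlₐ [ reg iᵣ ] ]≔ reg iᵣ))
          ELSE skip)
       ELSE skip))) ⨾
  (iᵣ ≔ inc (reg iᵣ))

outputBody =
  (IF (tlₐ [ tgtₐ [ reg iᵣ ] ]) == reg iᵣ
   THEN (outₐ [ tgtₐ [ reg iᵣ ] ]≔ lit 1)
   ELSE (outₐ [ parₐ [ bcₐ [ reg iᵣ ] ] ]≔ lit 1)) ⨾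
  (IF (entryₐ [ reg iᵣ ]) == lit 0
   THEN skip
   ELSE (outₐ [ dec (entryₐ [ reg iᵣ ]) ]≔ lit 1)) ⨾
  (iᵣ ≔ inc (reg iᵣ))

listsLoop searchInit searchLoop startLoop arcsLoop treeLoop earsLoop pairsLoop outputLoop sparsify : Program
listsLoop  = WHILE reg iᵣ << reg mᵣ DO listsBody
searchInit =
  (preₐ [ lit 0 ]≔ lit 1) ⨾ (ordₐ [ lit 1 ]≔ lit 0) ⨾ (countᵣ ≔ lit 1) ⨾ (finᵣ ≔ lit 0) ⨾ (cᵣ ≔ lit 0)
searchLoop = WHILE (postₐ [ lit 0 ]) == lit 0 DO searchBody
startLoop  = WHILE reg iᵣ << reg nᵣ DO startBody
arcsLoop   = WHILE reg iᵣ << reg mᵣ DO arcsBody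
-- The loop stops before the root, numbered 1, which has no parent.
treeLoop   = WHILE lit 1 << reg iᵣ DO treeBody
earsLoop   = WHILE reg iᵣ << inc (reg countᵣ) DO earsBody
pairsLoop  = WHILE reg iᵣ << reg mᵣ DO pairsBody
outputLoop = WHILE reg iᵣ << reg nᵣ DO outputBody

sparsify =
  listsLoop ⨾ searchInit ⨾ searchLoop ⨾
  (iᵣ ≔ lit 0) ⨾ startLoop ⨾
  (iᵣ ≔ lit 0) ⨾ arcsLoop ⨾
  (iᵣ ≔ reg countᵣ) ⨾ treeLoop ⨾
  (iᵣ ≔ lit 2) ⨾ earsLoop ⨾
  (iᵣ ≔ lit 0) ⨾ pairsLoop ⨾
  (iᵣ ≔ lit 1) ⨾ outputLoop

-- Start and termination of the search

search-start : ∀ {n m tl hd first next pre ord par post} → 0 < n → Lists tl m first next →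
  (∀ v → pre v ≡ 0) → (∀ v → post v ≡ 0) →
  Search n m tl hd first (update pre 0 1) (update ord 1 0) par post 1 0 0
search-start {n} {m} {tl} {first = first} {pre = pre} {ord} {post = post} n>0 L pre0 post0 = record
  { pre≤count = λ v _ → update-elim (_≤ 1) pre 0 1 v (λ _ → ≤-refl) (λ _ → subst (_≤ 1) (sym (pre0 v)) z≤n)
  ; count+ = begin
      1 + ∑ n (w ∘ update pre 0 1)            ≡⟨ +-comm 1 _ ⟩
      ∑ n (w ∘ update pre 0 1) + 1            ≡⟨ cong (λ a → ∑ n (w ∘ update pre 0 1) + w a) (sym (pre0 0)) ⟩
      ∑ n (w ∘ update pre 0 1) + w (pre 0)    ≡⟨ ∑-update w n pre 1 n>0 ⟩
      ∑ n (w ∘ pre) + 0                       ≡⟨ +-identityʳ _ ⟩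
      ∑ n (w ∘ pre)                           ≡⟨ ∑-cong n (λ j _ → cong w (pre0 j)) ⟩
      ∑ n (λ _ → 1)                           ≡⟨ ∑-1 n ⟩
      n                                       ∎
  ; ord-pre = λ v _ pv → subst (λ u → update ord 1 0 (update pre 0 1 u) ≡ u) (sym (root v pv)) refl
  ; ord<n = λ k k>0 k≤1 → subst (λ k → update ord 1 0 k < n) (≤-antisym k>0 k≤1) n>0
  ; pre-ord = λ k k>0 k≤1 → subst (λ k → update pre 0 1 (update ord 1 0 k) ≡ k) (≤-antisym k>0 k≤1) refl
  ; pre-root = refl
  ; post≤fin = λ v _ → ≤-reflexive (post0 v)
  ; post⇒pre = λ v _ fv → contradiction (post0 v) fv
  ; par-arc = λ v _ pv v≢0 → contradiction (root v pv) v≢0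
  ; par-pre = λ v _ pv v≢0 → contradiction (root v pv) v≢0
  ; par-< = λ v _ pv v≢0 → contradiction (root v pv) v≢0
  ; par-open = λ v _ pv v≢0 → contradiction (root v pv) v≢0
  ; gap = λ v _ _ pv v≢0 → contradiction (root v pv) v≢0
  ; contiguous = λ v _ _ _ _ _ fv → contradiction (post0 v) fv
  ; closed = λ e _ fe → contradiction (post0 (tl e)) fe
  ; first-arc = Lists.first-arc L
  ; scanned = λ e e<m le → contradiction (Lists.first-above L e e<m) (≤⇒≯ le)
  ; current = λ _ → n>0 , (λ ()) , post0 0 , λ x _ lt → contradiction
      (update-elim (_≤ 1) pre 0 1 x (λ _ → ≤-refl) (λ _ → subst (_≤ 1) (sym (pre0 x)) z≤n)) (<⇒≱ lt)
  }
  where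
  open ≡-Reasoning
  w = [_≡0]
  root : ∀ v → update pre 0 1 v ≢ 0 → v ≡ 0
  root v = update-elim (λ x → x ≢ 0 → v ≡ 0) pre 0 1 v (λ v≡0 _ → v≡0) (λ _ pv → contradiction (pre0 v) pv)

[≢0]-mono : ∀ {a b} → a ≤ b → [ a ≢0] ≤ [ b ≢0]
[≢0]-mono {zero}          _       = z≤n
[≢0]-mono {suc _} {suc _} _       = ≤-refl

-- Lists are scanned in decreasing order: arc e is unscanned while e < first (tl e).
unscanned : (m : ℕ) (tl first : ℕ → ℕ) → ℕ
unscanned m tl first = ∑ m (λ e → [ first (tl e) ∸ e ≢0])

∑-≤ : ∀ k {f} → (∀ j → f j ≤ 1) → ∑ k f ≤ k
∑-≤ k h = ≤-trans (∑-mono k λ j _ → h j) (≤-reflexive (∑-1 k))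

unscanned-< : ∀ {m tl first next₀ next c} → Lists tl m next₀ next →
  (∀ v p → first v ≡ suc p → p < m × tl p ≡ v) → first c ≢ 0 →
  unscanned m tl (update first c (next (pred (first c)))) < unscanned m tl first
unscanned-< {m} {tl} {first} {next = next} {c} L arc fc = ∑-mono-< m p<m
  (λ e _ → [≢0]-mono (∸-monoˡ-≤ e (shrink (tl e))))
  (subst₂ _<_ (cong [_≢0] (sym (m≤n⇒m∸n≡0 le))) (cong [_≢0] (sym here-1)) ≤-refl)
  where
  p = pred (first c)
  first-c : first c ≡ suc p
  first-c = sym (suc-pred (first c) {{≢-nonZero fc}})
  p<m = proj₁ (arc c p first-c)
  tl-p = proj₂ (arc c p first-c)
  next≤ : next p ≤ p
  next≤ with next p in eq
  ... | zero  = z≤n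
  ... | suc q = proj₁ (Lists.next-arc L p q p<m eq)
  shrink : ∀ v → update first c (next p) v ≤ first v
  shrink v = update-elim (_≤ first v) first c (next p) v
    (λ v≡c → subst (λ u → next p ≤ first u) (sym v≡c) (subst (next p ≤_) (sym first-c) (m≤n⇒m≤1+n next≤)))
    (λ _ → ≤-refl)
  le : update first c (next p) (tl p) ≤ p
  le = subst (_≤ p) (sym (trans (cong (update first c (next p)) tl-p) (update-≡ first c (next p)))) next≤
  here-1 : first (tl p) ∸ p ≡ 1
  here-1 = trans (cong (_∸ p) (trans (cong first tl-p) first-c)) (m+n∸n≡m 1 p)

unfinished-< : ∀ {n post c} x → c < n → post c ≡ 0 →
  ∑ n ([_≡0] ∘ update post c (suc x)) < ∑ n ([_≡0] ∘ post)
unfinished-< {n} {post} {c} x c<n open-c = ≤-reflexive (begin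
  suc (∑ n (w ∘ post′))       ≡⟨ +-comm 1 _ ⟩
  ∑ n (w ∘ post′) + 1         ≡⟨ cong (λ a → ∑ n (w ∘ post′) + w a) (sym open-c) ⟩
  ∑ n (w ∘ post′) + w (post c) ≡⟨ ∑-update w n post (suc x) c<n ⟩
  ∑ n (w ∘ post) + 0          ≡⟨ +-identityʳ _ ⟩
  ∑ n (w ∘ post)              ∎)
  where
  open ≡-Reasoning
  w = [_≡0]
  post′ = update post c (suc x)

-- Every step of the search scans an arc or finishes a vertex.
workload : (n m : ℕ) (tl first post : ℕ → ℕ) → ℕ
workload n m tl first post = ∑ n ([_≡0] ∘ post) + unscanned m tl first

workload-finish : ∀ {n m tl first post c} x → c < n → post c ≡ 0 →
  workload n m tl first (update post c (suc x)) < workload n m tl first post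
workload-finish {m = m} {tl} {first} x c<n open-c = +-monoˡ-< (unscanned m tl first) (unfinished-< x c<n open-c)

workload-scan : ∀ {n m tl first next₀ next post c} → Lists tl m next₀ next →
  (∀ v p → first v ≡ suc p → p < m × tl p ≡ v) → first c ≢ 0 →
  workload n m tl (update first c (next (pred (first c)))) post < workload n m tl first post
workload-scan {n} {next = next} {post = post} L arc fc = +-monoʳ-< (∑ n ([_≡0] ∘ post)) (unscanned-< L arc fc)

workload-≤ : ∀ n m {tl first post} → workload n m tl first post ≤ n + m
workload-≤ n m {tl} {first} {post} =
  +-mono-≤ (∑-≤ n λ j → [≡0]≤1 (post j)) (∑-≤ m λ e → [≢0]≤1 (first (tl e) ∸ e))
  where
  [≡0]≤1 : ∀ a → [ a ≡0] ≤ 1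
  [≡0]≤1 zero    = ≤-refl
  [≡0]≤1 (suc _) = z≤n

-- Loop invariants

Zeros : List ℕ → State → Set
Zeros []       s = ⊤
Zeros (a ∷ as) s = (∀ i → arrs s a i ≡ 0) × Zeros as s

-- The invariants speak of the graph in the current state; these equations identify it with the
-- input where a time bound or the result is concerned.
record Same {n₀ m₀ : ℕ} {tl₀ hd₀ : ℕ → ℕ} (n m : ℕ) (tl hd : ℕ → ℕ) : Set where
  constructor same
  field
    same-n  : n ≡ n₀
    same-m  : m ≡ m₀
    same-tl : tl ≡ tl₀
    same-hd : hd ≡ hd₀

module TreeStep {n m tl hd pre ord par post count lo}
  (G : Graph n m tl hd) (T : Tree n m tl hd pre ord par post count) (L : Extremes.Low G T m lo)
  {i v : ℕ} (v<n : v < n) (v≢0 : v ≢ 0) (pv : pre v ≡ i) where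
  open Subtrees G T
  open Extremes G T

  -- The situation between two tests of an iteration: `lo v` has been offered to the parent, `ch v`
  -- has not.
  Offered : (ch bc : ℕ → ℕ) → Set
  Offered ch bc = Child lo i ch bc × pre (hd (ch (parent v))) ≤ pre (hd (lo v))

  private
    suc-pred-i : suc (pred i) ≡ i
    suc-pred-i = suc-pred i {{>-nonZero (subst (0 <_) pv (pre>0 v v<n))}}
    pv′ : pre v ≡ suc (pred i)
    pv′ = trans pv (sym suc-pred-i)
    v≢p : v ≢ parent v
    v≢p eq = <-irrefl (cong pre (sym eq)) (par-< v v<n v≢0)
    child⁺ : ∀ {ch bc} → Child lo i ch bc → Child lo (suc (pred i)) ch bc
    child⁺ = subst (λ i → Child lo i _ _) (sym suc-pred-i)
    child⁻ : ∀ {ch bc} → Child lo (suc (pred i)) ch bc → Child lo i ch bc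
    child⁻ = subst (λ i → Child lo i _ _) suc-pred-i
    high⁺ : ∀ {hi} → High m i hi → High m (suc (pred i)) hi
    high⁺ = subst (λ i → High m i _) (sym suc-pred-i)

  offer-lo : ∀ {ch bc} → Child lo i ch bc → pre (hd (lo v)) < pre (hd (ch (parent v))) →
    Offered (update ch (parent v) (lo v)) (update bc (parent v) v)
  offer-lo {ch} C lt = child⁻ (child-offer-lo v<n v≢0 pv′ (child⁺ C) L lt) ,
    ≤-reflexive (cong (pre ∘ hd) (update-≡ ch (parent v) (lo v)))

  keep-lo : ∀ {ch bc} → Child lo i ch bc → pre (hd (ch (parent v))) ≤ pre (hd (lo v)) → Offered ch bc
  keep-lo C le = C , le

  offer-ch : ∀ {ch bc} → Offered ch bc → pre (hd (ch v)) < pre (hd (ch (parent v))) →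
    Child lo (pred i) (update ch (parent v) (ch v)) (update bc (parent v) v)
  offer-ch {ch = ch} (C , le) lt = child-next v<n v≢0 pv′ (child-offer-ch v<n v≢0 pv′ (child⁺ C) lt)
    (≤-trans (≤-reflexive ch′-p) (≤-trans (<⇒≤ lt) le))
    (≤-reflexive (trans ch′-p (cong (pre ∘ hd) (sym (update-≢ ch (ch v) v≢p)))))
    where
    ch′-p : pre (hd (update ch (parent v) (ch v) (parent v))) ≡ pre (hd (ch v))
    ch′-p = cong (pre ∘ hd) (update-≡ ch (parent v) (ch v))

  keep-ch : ∀ {ch bc} → Offered ch bc → pre (hd (ch (parent v))) ≤ pre (hd (ch v)) → Child lo (pred i) ch bc
  keep-ch (C , le) le′ = child-next v<n v≢0 pv′ (child⁺ C) le le′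

  raise-hi : ∀ {hi} → High m i hi → post (tl (hi (parent v))) < post (tl (hi v)) →
    High m (pred i) (update hi (parent v) (hi v))
  raise-hi H lt = high-up-set v<n v≢0 pv′ (high⁺ H) lt

  keep-hi : ∀ {hi} → High m i hi → post (tl (hi v)) ≤ post (tl (hi (parent v))) → High m (pred i) hi
  keep-hi H le = high-up-keep v<n pv′ (high⁺ H) le

module Execution (n₀ m₀ : ℕ) (tl₀ hd₀ : ℕ → ℕ) where

  GraphIn : State → Set
  GraphIn s = Graph (regs s nᵣ) (regs s mᵣ) (arrs s tlₐ) (arrs s hdₐ)

  Ctx : State → Set
  Ctx s = GraphIn s × Same {n₀} {m₀} {tl₀} {hd₀} (regs s nᵣ) (regs s mᵣ) (arrs s tlₐ) (arrs s hdₐ)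

  bound : ℕ
  bound = n₀ + m₀

  n≤bound : ∀ {s} → Ctx s → regs s nᵣ ≤ bound
  n≤bound (_ , same refl refl refl refl) = m≤m+n _ _

  m≤bound : ∀ {s} → Ctx s → regs s mᵣ ≤ bound
  m≤bound (_ , same refl refl refl refl) = m≤n+m _ n₀

  ListsAt : State → Set
  ListsAt s = Ctx s × Lists (arrs s tlₐ) (regs s iᵣ) (arrs s firstₐ) (arrs s nextₐ) × regs s iᵣ ≤ regs s mᵣ ×
    Zeros (preₐ ∷ postₐ ∷ outₐ ∷ markₐ ∷ entryₐ ∷ freeₐ ∷ topₐ ∷ []) s

  lists-run : ∀ {s} → ListsAt s →
    Run listsLoop s (loopCost (reg iᵣ << reg mᵣ) listsBody * suc bound) λ s′ → ListsAt s′ × regs s′ iᵣ ≡ regs s′ mᵣ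
  lists-run {s} I = run-map (λ (I , ge) → I , ≤-antisym (proj₁ (proj₂ (proj₂ I))) ge)
    (while-sound (reg iᵣ << reg mᵣ) listsBody ListsAt (λ s → regs s mᵣ ∸ regs s iᵣ)
      -- Registers and arrays are named by literals, so the goal reduces to the invariant with the
      -- written ones updated, and conditions on the others carry over unchanged.
      (λ (ctx , L , _ , Z) lt → (ctx , lists-step L , lt , Z) , ∸-monoʳ-< ≤-refl lt)
      bound I (≤-trans (m∸n≤m _ (regs s iᵣ)) (m≤bound {s} (proj₁ I))))

  SearchAt : State → Set
  SearchAt s = Ctx s × (∃ λ first → Lists (arrs s tlₐ) (regs s mᵣ) first (arrs s nextₐ)) ×
    Search (regs s nᵣ) (regs s mᵣ) (arrs s tlₐ) (arrs s hdₐ) (arrs s firstₐ) (arrs s preₐ) (arrs s ordₐ)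
      (arrs s parₐ) (arrs s postₐ) (regs s countᵣ) (regs s finᵣ) (regs s cᵣ) ×
    Zeros (outₐ ∷ markₐ ∷ entryₐ ∷ freeₐ ∷ topₐ ∷ []) s

  to-search : ∀ {s} → ListsAt s × regs s iᵣ ≡ regs s mᵣ → wp searchInit SearchAt s
  to-search {s} ((ctx@(G , _) , L , _ , (pre0 , post0 , Z)) , i≡m) =
    ctx , (_ , L′) , search-start (Graph.n>0 G) L′ pre0 post0 , Z
    where
    L′ : Lists (arrs s tlₐ) (regs s mᵣ) (arrs s firstₐ) (arrs s nextₐ)
    L′ = subst (λ i → Lists (arrs s tlₐ) i (arrs s firstₐ) (arrs s nextₐ)) i≡m L

  work : State → ℕ
  work s = workload (regs s nᵣ) (regs s mᵣ) (arrs s tlₐ) (arrs s firstₐ) (arrs s postₐ)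

  search-body : ∀ {s} → SearchAt s → arrs s postₐ 0 ≡ 0 → wp searchBody (λ s′ → SearchAt s′ × work s′ < work s) s
  search-body {s} (ctx@(G , _) , (f₀ , L) , S , Z) open₀ =
    (λ eq → (ctx , (f₀ , L) , search-finish G S open₀ eq , Z) , finish) ,
    (λ ne →
      (λ new → (ctx , (f₀ , L) , search-discover G L S open₀ ne new , Z) , scan ne) ,
      (λ old → (ctx , (f₀ , L) , search-skip G L S open₀ ne old , Z) , scan ne))
    where
    c<n = proj₁ (Search.current S open₀)
    open-c = proj₁ (proj₂ (proj₂ (Search.current S open₀)))
    scan : arrs s firstₐ (regs s cᵣ) ≢ 0 → workload (regs s nᵣ) (regs s mᵣ) (arrs s tlₐ)
      (update (arrs s firstₐ) (regs s cᵣ) (arrs s nextₐ (pred (arrs s firstₐ (regs s cᵣ))))) (arrs s postₐ) < work s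
    scan = workload-scan {regs s nᵣ} {regs s mᵣ} {arrs s tlₐ} {arrs s firstₐ} {f₀} {arrs s nextₐ}
      {arrs s postₐ} {regs s cᵣ} L (Search.first-arc S)
    finish : workload (regs s nᵣ) (regs s mᵣ) (arrs s tlₐ) (arrs s firstₐ)
      (update (arrs s postₐ) (regs s cᵣ) (suc (regs s finᵣ))) < work s
    finish = workload-finish {regs s nᵣ} {regs s mᵣ} {arrs s tlₐ} {arrs s firstₐ} {arrs s postₐ} {regs s cᵣ}
      (regs s finᵣ) c<n open-c

  TreeAt : State → Set
  TreeAt s = Tree (regs s nᵣ) (regs s mᵣ) (arrs s tlₐ) (arrs s hdₐ) (arrs s preₐ) (arrs s ordₐ)
    (arrs s parₐ) (arrs s postₐ) (regs s countᵣ)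

  search-run : ∀ {s} → SearchAt s → Run searchLoop s (loopCost ((postₐ [ lit 0 ]) == lit 0) searchBody * suc bound)
    λ s′ → Ctx s′ × TreeAt s′ × Zeros (outₐ ∷ markₐ ∷ entryₐ ∷ freeₐ ∷ topₐ ∷ []) s′
  search-run {s} I@((_ , same refl refl refl refl) , _) =
    run-map (λ ((ctx@(G , _) , _ , S , Z) , closed) → ctx , search-tree G S closed , Z)
      (while-sound ((postₐ [ lit 0 ]) == lit 0) searchBody SearchAt work (λ {s} → search-body {s}) bound I
        (workload-≤ n₀ m₀ {arrs s tlₐ} {arrs s firstₐ} {arrs s postₐ}))

  StartAt : State → Set
  StartAt s = Ctx s × TreeAt s × regs s iᵣ ≤ regs s nᵣ ×
    (∀ v → v < regs s iᵣ → arrs s loₐ v ≡ arrs s parₐ v) ×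
    (∀ v → v < regs s iᵣ → arrs s hiₐ v ≡ arrs s parₐ v) ×
    (∀ v → v < regs s iᵣ → arrs s chₐ v ≡ arrs s parₐ v) ×
    Zeros (outₐ ∷ markₐ ∷ entryₐ ∷ freeₐ ∷ topₐ ∷ []) s

  start-run : ∀ {s} → StartAt s →
    Run startLoop s (loopCost (reg iᵣ << reg nᵣ) startBody * suc bound) λ s′ → StartAt s′ × regs s′ iᵣ ≡ regs s′ nᵣ
  start-run {s} I = run-map (λ (I , ge) → I , ≤-antisym (proj₁ (proj₂ (proj₂ I))) ge)
    (while-sound (reg iᵣ << reg nᵣ) startBody StartAt (λ s → regs s nᵣ ∸ regs s iᵣ)
      (λ (ctx , T , _ , lo≡ , hi≡ , ch≡ , Z) lt →
        (ctx , T , lt , copy lo≡ , copy hi≡ , copy ch≡ , Z) , ∸-monoʳ-< ≤-refl lt)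
      bound I (≤-trans (m∸n≤m _ (regs s iᵣ)) (n≤bound {s} (proj₁ I))))
    where
    copy : ∀ {f g : ℕ → ℕ} {i} → (∀ v → v < i → f v ≡ g v) → ∀ v → v < suc i → update f i (g i) v ≡ g v
    copy {f} {g} {i} h v lt = update-elim (_≡ g v) f i (g i) v (λ v≡i → cong g (sym v≡i))
      (λ v≢i → h v (≤∧≢⇒< (s≤s⁻¹ lt) v≢i))

  ArcsAt : State → Set
  ArcsAt s = Σ (Ctx s) λ ctx → Σ (TreeAt s) λ T →
    Extremes.Low (proj₁ ctx) T (regs s iᵣ) (arrs s loₐ) ×
    Extremes.High (proj₁ ctx) T (regs s iᵣ) (regs s countᵣ) (arrs s hiₐ) ×
    regs s iᵣ ≤ regs s mᵣ ×
    (∀ v → v < regs s nᵣ → arrs s chₐ v ≡ arrs s parₐ v) ×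
    Zeros (outₐ ∷ markₐ ∷ entryₐ ∷ freeₐ ∷ topₐ ∷ []) s

  arcs-body : ∀ {s} → ArcsAt s → regs s iᵣ < regs s mᵣ →
    wp arcsBody (λ s′ → ArcsAt s′ × regs s′ mᵣ ∸ regs s′ iᵣ < regs s mᵣ ∸ regs s iᵣ) s
  arcs-body (ctx@(G , _) , T , L , H , _ , ch≡ , Z) lt =
    (λ a → (λ b → (ctx , T , low-set lt L a , high-set lt H b , lt , ch≡ , Z) , down) ,
           (λ b → (ctx , T , low-set lt L a , high-keep H b , lt , ch≡ , Z) , down)) ,
    (λ a → (λ b → (ctx , T , low-keep L a , high-set lt H b , lt , ch≡ , Z) , down) ,
           (λ b → (ctx , T , low-keep L a , high-keep H b , lt , ch≡ , Z) , down))
    where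
    open Extremes G T
    down = ∸-monoʳ-< ≤-refl lt

  arcs-run : ∀ {s} → ArcsAt s →
    Run arcsLoop s (loopCost (reg iᵣ << reg mᵣ) arcsBody * suc bound) λ s′ → ArcsAt s′ × regs s′ iᵣ ≡ regs s′ mᵣ
  arcs-run {s} I = run-map (λ (I@(_ , _ , _ , _ , le , _) , ge) → I , ≤-antisym le ge)
    (while-sound (reg iᵣ << reg mᵣ) arcsBody ArcsAt (λ s → regs s mᵣ ∸ regs s iᵣ) (λ {s} → arcs-body {s})
      bound I (≤-trans (m∸n≤m _ (regs s iᵣ)) (m≤bound {s} (proj₁ I))))

  UpAt : State → Set
  UpAt s = Σ (Ctx s) λ ctx → Σ (TreeAt s) λ T →
    Extremes.Low (proj₁ ctx) T (regs s mᵣ) (arrs s loₐ) ×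
    Extremes.High (proj₁ ctx) T (regs s mᵣ) (regs s iᵣ) (arrs s hiₐ) ×
    Extremes.Child (proj₁ ctx) T (arrs s loₐ) (regs s iᵣ) (arrs s chₐ) (arrs s bcₐ) ×
    (0 < regs s iᵣ × regs s iᵣ ≤ regs s countᵣ) ×
    Zeros (outₐ ∷ markₐ ∷ entryₐ ∷ freeₐ ∷ topₐ ∷ []) s

  tree-body : ∀ {s} → UpAt s → 1 < regs s iᵣ →
    wp treeBody (λ s′ → UpAt s′ × regs s′ iᵣ < regs s iᵣ) s
  tree-body {s} (ctx@(G , _) , T , L , H , C , (i>0 , i≤) , Z) lt =
    (λ a → let O = offer-lo C a in
      (λ b → let C′ = offer-ch O b in
        (λ h → (ctx , T , L , raise-hi H h , C′ , range , Z) , down) ,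
        (λ h → (ctx , T , L , keep-hi H h , C′ , range , Z) , down)) ,
      (λ b → let C′ = keep-ch O b in
        (λ h → (ctx , T , L , raise-hi H h , C′ , range , Z) , down) ,
        (λ h → (ctx , T , L , keep-hi H h , C′ , range , Z) , down))) ,
    (λ a → let O = keep-lo C a in
      (λ b → let C′ = offer-ch O b in
        (λ h → (ctx , T , L , raise-hi H h , C′ , range , Z) , down) ,
        (λ h → (ctx , T , L , keep-hi H h , C′ , range , Z) , down)) ,
      (λ b → let C′ = keep-ch O b in
        (λ h → (ctx , T , L , raise-hi H h , C′ , range , Z) , down) ,
        (λ h → (ctx , T , L , keep-hi H h , C′ , range , Z) , down)))
    where
    i = regs s iᵣ
    v = arrs s ordₐ i
    pre-v = Tree.pre-ord T i i>0 i≤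
    open TreeStep G T L {i} {v} (Tree.ord<n T i i>0 i≤)
      (Subtrees.pre>1⇒≢0 G T (subst (1 <_) (sym pre-v) lt)) pre-v
    range : 0 < pred i × pred i ≤ regs s countᵣ
    range = pred-mono-≤ lt , ≤-trans pred[n]≤n i≤
    down : pred i < i
    down = pred[n]<n {{>-nonZero i>0}}
      where
      pred[n]<n : ∀ {k} {{_ : NonZero k}} → pred k < k
      pred[n]<n {suc k} = ≤-refl

  tree-run : ∀ {s} → UpAt s →
    Run treeLoop s (loopCost (lit 1 << reg iᵣ) treeBody * suc bound) λ s′ → UpAt s′ × regs s′ iᵣ ≡ 1
  tree-run {s} I@(ctx , T , _ , _ , _ , (_ , i≤) , _) =
    run-map (λ (I@(_ , _ , _ , _ , _ , (i>0 , _) , _) , le) → I , ≤-antisym le i>0)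
      (while-sound (lit 1 << reg iᵣ) treeBody UpAt (λ s → regs s iᵣ) (λ {s} → tree-body {s})
        bound I (≤-trans i≤ (≤-trans (Tree.count≤n T) (n≤bound {s} ctx))))

  Prepared : (s : State) → Ctx s → TreeAt s → Set
  Prepared s (G , _) T = 
    Σ (Extremes.Low G T (regs s mᵣ) (arrs s loₐ)) λ L →
    Σ (Extremes.High G T (regs s mᵣ) 1 (arrs s hiₐ)) λ H →
    Extremes.Child G T (arrs s loₐ) 1 (arrs s chₐ) (arrs s bcₐ)

  EarsAt : State → Set
  EarsAt s = Σ (Ctx s) λ ctx → Σ (TreeAt s) λ T → Σ (Prepared s ctx T) λ (L , H , C) →
    Cover.Ears (proj₁ ctx) T L H C (regs s iᵣ) 0 0 (arrs s markₐ) (arrs s tgtₐ) (arrs s entryₐ) (arrs s freeₐ) (arrs s topₐ) ×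
    (2 ≤ regs s iᵣ × regs s iᵣ ≤ suc (regs s countᵣ)) ×
    Zeros (outₐ ∷ []) s

  -- `μ` remembers the measure at the start of the iteration, against which the end of the iteration
  -- is compared. Cutting the body here keeps the branches of its two halves from multiplying.
  ClassifiedAt : ℕ → State → Set
  ClassifiedAt μ s = Σ (Ctx s) λ ctx → Σ (TreeAt s) λ T → Σ (Prepared s ctx T) λ (L , H , C) →
    Cover.Classified (proj₁ ctx) T L H C (regs s iᵣ) (arrs s ordₐ (regs s iᵣ))
      (arrs s markₐ) (arrs s tgtₐ) (arrs s entryₐ) (arrs s freeₐ) (arrs s topₐ) ×
    (2 ≤ regs s iᵣ × regs s iᵣ < suc (regs s countᵣ)) ×
    suc (regs s countᵣ) ∸ regs s iᵣ ≡ μ ×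
    Zeros (outₐ ∷ []) s

  room : State → ℕ
  room s = suc (regs s countᵣ) ∸ regs s iᵣ

  classify-step : ∀ {s} → EarsAt s → regs s iᵣ < suc (regs s countᵣ) → wp classifyStep (ClassifiedAt (room s)) s
  classify-step {s} (ctx@(G , _) , T , (L , H , C) , E , (i≥2 , _) , Z) lt =
    (λ unmarked →
      (λ a → ctx , T , (L , H , C) , classify-head E v<n v≢0 pre-v unmarked a , (i≥2 , lt) , refl , Z) ,
      (λ a →
        (λ none → ctx , T , (L , H , C) ,
          classify-free E v<n v≢0 pre-v unmarked a (λ f → contradiction none f) , (i≥2 , lt) , refl , Z) ,
        (λ some →
          (λ b → ctx , T , (L , H , C) ,
            classify-pair E v<n v≢0 pre-v unmarked a some b , (i≥2 , lt) , refl , Z) ,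
          (λ b → ctx , T , (L , H , C) ,
            classify-free E v<n v≢0 pre-v unmarked a (λ _ → b) , (i≥2 , lt) , refl , Z)))) ,
    (λ marked → ctx , T , (L , H , C) , classify-inner E v<n v≢0 pre-v marked , (i≥2 , lt) , refl , Z)
    where
    open Cover G T L H C
    i = regs s iᵣ
    i>0 : 0 < i
    i>0 = ≤-trans (s≤s z≤n) i≥2
    v<n = Tree.ord<n T i i>0 (s≤s⁻¹ lt)
    pre-v = Tree.pre-ord T i i>0 (s≤s⁻¹ lt)
    v≢0 = Subtrees.pre>1⇒≢0 G T (subst (1 <_) (sym pre-v) i≥2)

  extend-step : ∀ {μ s} → ClassifiedAt μ s → wp extendStep (λ s′ → EarsAt s′ × room s′ < μ) s
  extend-step {s = s} (ctx@(G , _) , T , (L , H , C) , Cl , (i≥2 , lt) , refl , Z) =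
    (λ end → (ctx , T , (L , H , C) , ear-ends Cl end , (m≤n⇒m≤1+n i≥2 , lt) , Z) , ∸-monoʳ-< ≤-refl lt) ,
    (λ mid → (ctx , T , (L , H , C) , ear-continues Cl mid , (m≤n⇒m≤1+n i≥2 , lt) , Z) , ∸-monoʳ-< ≤-refl lt)
    where open Cover G T L H C

  ears-run : ∀ {s} → EarsAt s →
    Run earsLoop s (loopCost (reg iᵣ << inc (reg countᵣ)) earsBody * suc bound) λ s′ → EarsAt s′ × regs s′ iᵣ ≡ suc (regs s′ countᵣ)
  ears-run {s} I@(ctx , T , _ , _ , (i≥2 , _) , _) =
    run-map (λ (I@(_ , _ , _ , _ , (_ , le) , _) , ge) → I , ≤-antisym le ge)
      (while-sound (reg iᵣ << inc (reg countᵣ)) earsBody EarsAt room (λ {s} I lt → wp-mono classifyStep {s = s}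
          (λ {s′} → extend-step {room s} {s′}) (classify-step {s} I lt))
        bound I (room≤ (regs s iᵣ) i≥2))
    where
    room≤ : ∀ i → 2 ≤ i → suc (regs s countᵣ) ∸ i ≤ bound
    room≤ (suc i) _ = ≤-trans (m∸n≤m (regs s countᵣ) i) (≤-trans (Tree.count≤n T) (n≤bound {s} ctx))

  PairsAt : State → Set
  PairsAt s = Σ (Ctx s) λ ctx → Σ (TreeAt s) λ T → Σ (Prepared s ctx T) λ (L , H , C) →
    Result.Pairs (proj₁ ctx) T L H C (regs s iᵣ) (arrs s markₐ) (arrs s tgtₐ) (arrs s entryₐ) (arrs s freeₐ) (arrs s topₐ) ×
    regs s iᵣ ≤ regs s mᵣ × Zeros (outₐ ∷ []) s

  pairs-body : ∀ {s} → PairsAt s → regs s iᵣ < regs s mᵣ →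
    wp pairsBody (λ s′ → PairsAt s′ × regs s′ mᵣ ∸ regs s′ iᵣ < regs s mᵣ ∸ regs s iᵣ) s
  pairs-body {s} (ctx@(G , _) , T , (L , H , C) , P , _ , Z) lt =
    (λ a → skipped (λ fx → contradiction a fx)) ,
    (λ fx → (λ a → skipped (λ _ fz → contradiction a fz)) ,
      (λ fz →
        (λ a → (λ b → (ctx , T , (L , H , C) , pairs-join P lt fx fz a b , lt , Z) , ∸-monoʳ-< ≤-refl lt) ,
               (λ b → skipped λ _ _ _ → b)) ,
        (λ a → skipped λ _ _ a′ → contradiction a′ (≤⇒≯ a))))
    where
    open Result G T L H C
    skipped : (arrs s freeₐ (arrs s tlₐ (regs s iᵣ)) ≢ 0 → arrs s freeₐ (arrs s topₐ (arrs s hdₐ (regs s iᵣ))) ≢ 0 →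
      arrs s preₐ (arrs s hdₐ (regs s iᵣ)) < arrs s preₐ (arrs s tlₐ (regs s iᵣ)) →
      arrs s postₐ (arrs s tlₐ (regs s iᵣ)) ≤ arrs s postₐ (arrs s topₐ (arrs s hdₐ (regs s iᵣ)))) →
      wp (iᵣ ≔ inc (reg iᵣ)) (λ s′ → PairsAt s′ × regs s′ mᵣ ∸ regs s′ iᵣ < regs s mᵣ ∸ regs s iᵣ) s
    skipped h = (ctx , T , (L , H , C) , pairs-skip P h , lt , Z) , ∸-monoʳ-< ≤-refl lt

  pairs-run : ∀ {s} → PairsAt s →
    Run pairsLoop s (loopCost (reg iᵣ << reg mᵣ) pairsBody * suc bound) λ s′ → PairsAt s′ × regs s′ iᵣ ≡ regs s′ mᵣ
  pairs-run {s} I = run-map (λ (I@(_ , _ , _ , _ , le , _) , ge) → I , ≤-antisym le ge)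
    (while-sound (reg iᵣ << reg mᵣ) pairsBody PairsAt (λ s → regs s mᵣ ∸ regs s iᵣ) (λ {s} → pairs-body {s})
      bound I (≤-trans (m∸n≤m _ (regs s iᵣ)) (m≤bound {s} (proj₁ I))))

  OutputAt : State → Set
  OutputAt s = Σ (Ctx s) λ ctx → Σ (TreeAt s) λ T → Σ (Prepared s ctx T) λ (L , H , C) →
    Result.Pairs (proj₁ ctx) T L H C (regs s mᵣ) (arrs s markₐ) (arrs s tgtₐ) (arrs s entryₐ) (arrs s freeₐ) (arrs s topₐ) ×
    Output (regs s mᵣ) (regs s iᵣ) (arrs s tlₐ) (arrs s parₐ) (arrs s bcₐ) (arrs s tgtₐ) (arrs s entryₐ) (arrs s outₐ) ×
    regs s iᵣ ≤ regs s nᵣ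

  output-body : ∀ {s} → OutputAt s → regs s iᵣ < regs s nᵣ →
    wp outputBody (λ s′ → OutputAt s′ × regs s′ nᵣ ∸ regs s′ iᵣ < regs s nᵣ ∸ regs s iᵣ) s
  output-body {s} (ctx , T , LHC , P , O , _) lt =
    (λ end →
      (λ e0 → (ctx , T , LHC , P , output-step O (λ _ → refl) (λ mid → contradiction end mid) e0 , lt) , down) ,
      (λ e≢0 → (ctx , T , LHC , P , output-step-entry O (λ _ → refl) (λ mid → contradiction end mid) e≢0 , lt) , down)) ,
    (λ mid →
      (λ e0 → (ctx , T , LHC , P , output-step O (λ end → contradiction end mid) (λ _ → refl) e0 , lt) , down) ,
      (λ e≢0 → (ctx , T , LHC , P , output-step-entry O (λ end → contradiction end mid) (λ _ → refl) e≢0 , lt) , down))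
    where
    down = ∸-monoʳ-< ≤-refl lt

  output-run : ∀ {s} → OutputAt s →
    Run outputLoop s (loopCost (reg iᵣ << reg nᵣ) outputBody * suc bound) λ s′ → OutputAt s′ × regs s′ iᵣ ≡ regs s′ nᵣ
  output-run {s} I = run-map (λ (I@(_ , _ , _ , _ , _ , le) , ge) → I , ≤-antisym le ge)
    (while-sound (reg iᵣ << reg nᵣ) outputBody OutputAt (λ s → regs s nᵣ ∸ regs s iᵣ) (λ {s} → output-body {s})
      bound I (≤-trans (m∸n≤m _ (regs s iᵣ)) (n≤bound {s} (proj₁ I))))

-- Composition of the phases and the total cost

cost₁₄ cost₁₃ cost₁₂ cost₁₁ cost₁₀ cost₉ cost₈ cost₇ cost₆ cost₅ cost₄ cost₃ cost₂ cost₁ totalCost : ℕ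
cost₁₄ = loopCost (reg iᵣ << reg nᵣ) outputBody
cost₁₃ = maxTime (iᵣ ≔ lit 1) + cost₁₄
cost₁₂ = loopCost (reg iᵣ << reg mᵣ) pairsBody + cost₁₃
cost₁₁ = maxTime (iᵣ ≔ lit 0) + cost₁₂
cost₁₀ = loopCost (reg iᵣ << inc (reg countᵣ)) earsBody + cost₁₁
cost₉ = maxTime (iᵣ ≔ lit 2) + cost₁₀
cost₈ = loopCost (lit 1 << reg iᵣ) treeBody + cost₉
cost₇ = maxTime (iᵣ ≔ reg countᵣ) + cost₈
cost₆ = loopCost (reg iᵣ << reg mᵣ) arcsBody + cost₇
cost₅ = maxTime (iᵣ ≔ lit 0) + cost₆
cost₄ = loopCost (reg iᵣ << reg nᵣ) startBody + cost₅
cost₃ = maxTime (iᵣ ≔ lit 0) + cost₄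
cost₂ = loopCost ((postₐ [ lit 0 ]) == lit 0) searchBody + cost₃
cost₁ = maxTime searchInit + cost₂
totalCost = loopCost (reg iᵣ << reg mᵣ) listsBody + cost₁

module Phases (n₀ m₀ : ℕ) (tl₀ hd₀ : ℕ → ℕ) where
  open Execution n₀ m₀ tl₀ hd₀

  to-start : ∀ {s} → Ctx s × TreeAt s × Zeros (outₐ ∷ markₐ ∷ entryₐ ∷ freeₐ ∷ topₐ ∷ []) s →
    wp (iᵣ ≔ lit 0) StartAt s
  to-start (ctx , T , Z) = ctx , T , z≤n , (λ _ ()) , (λ _ ()) , (λ _ ()) , Z

  to-arcs : ∀ {s} → StartAt s × regs s iᵣ ≡ regs s nᵣ → wp (iᵣ ≔ lit 0) ArcsAt s
  to-arcs {s} ((ctx@(G , _) , T , _ , lo≡ , hi≡ , ch≡ , Z) , i≡n) =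
    ctx , T , low-start (below lo≡) , high-start (below hi≡) , z≤n , below ch≡ , Z
    where
    open Extremes G T
    below : ∀ {P : ℕ → Set} → (∀ v → v < regs s iᵣ → P v) → ∀ v → v < regs s nᵣ → P v
    below h v lt = h v (subst (v <_) (sym i≡n) lt)

  to-tree : ∀ {s} → ArcsAt s × regs s iᵣ ≡ regs s mᵣ → wp (iᵣ ≔ reg countᵣ) UpAt s
  to-tree {s} ((ctx@(G , _) , T , L , H , _ , ch≡ , Z) , i≡m) =
    ctx , T , subst (λ k → Low k (arrs s loₐ)) i≡m L , subst (λ k → High k (regs s countᵣ) (arrs s hiₐ)) i≡m H ,
    child-start ch≡ ,
    (subst (_≤ regs s countᵣ) (Tree.pre-root T) (Tree.pre≤count T 0 (Graph.n>0 G)) , ≤-refl) , Z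
    where open Extremes G T

  to-ears : ∀ {s} → UpAt s × regs s iᵣ ≡ 1 → wp (iᵣ ≔ lit 2) EarsAt s
  to-ears {s} ((ctx@(G , _) , T , L , H , C , (i>0 , i≤) , (out0 , mark0 , entry0 , free0 , top0 , _)) , i≡1) =
    ctx , T , (L , H′ , C′) ,
    Cover.ears-start G T L H′ C′ mark0 entry0 free0 top0 , (≤-refl , s≤s (≤-trans i>0 i≤)) , (out0 , tt)
    where
    open Extremes G T
    H′ = subst (λ k → High (regs s mᵣ) k (arrs s hiₐ)) i≡1 H
    C′ = subst (λ k → Child (arrs s loₐ) k (arrs s chₐ) (arrs s bcₐ)) i≡1 C

  to-pairs : ∀ {s} → EarsAt s × regs s iᵣ ≡ suc (regs s countᵣ) → wp (iᵣ ≔ lit 0) PairsAt s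
  to-pairs {s} ((ctx@(G , _) , T , (L , H , C) , E , _ , Z) , i≡) =
    ctx , T , (L , H , C) , Result.pairs-start G T L H C
      (subst (λ k → Cover.Ears G T L H C k 0 0 (arrs s markₐ) (arrs s tgtₐ) (arrs s entryₐ) (arrs s freeₐ) (arrs s topₐ)) i≡ E) ,
    z≤n , Z

  to-output : ∀ {s} → PairsAt s × regs s iᵣ ≡ regs s mᵣ → wp (iᵣ ≔ lit 1) OutputAt s
  to-output {s} ((ctx@(G , _) , T , (L , H , C) , P , _ , (out0 , _)) , i≡m) =
    ctx , T , (L , H , C) ,
    subst (λ k → Result.Pairs G T L H C k (arrs s markₐ) (arrs s tgtₐ) (arrs s entryₐ) (arrs s freeₐ) (arrs s topₐ)) i≡m P ,
    output-start out0 , Graph.n>0 G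

  sparsify-run : ∀ {s} → ListsAt s → Run sparsify s (totalCost * suc bound) λ s′ → OutputAt s′ × regs s′ iᵣ ≡ regs s′ nᵣ
  sparsify-run {s} I =
    run-then (loopCost (reg iᵣ << reg mᵣ) listsBody) cost₁ (lists-run {s} I) λ {s} I →
    run-then (maxTime searchInit) cost₂ (run-straight searchInit bound (to-search {s} I)) λ {s} I →
    run-then (loopCost ((postₐ [ lit 0 ]) == lit 0) searchBody) cost₃ (search-run {s} I) λ {s} I →
    run-then (maxTime (iᵣ ≔ lit 0)) cost₄ (run-straight (iᵣ ≔ lit 0) bound (to-start {s} I)) λ {s} I →
    run-then (loopCost (reg iᵣ << reg nᵣ) startBody) cost₅ (start-run {s} I) λ {s} I →
    run-then (maxTime (iᵣ ≔ lit 0)) cost₆ (run-straight (iᵣ ≔ lit 0) bound (to-arcs {s} I)) λ {s} I →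
    run-then (loopCost (reg iᵣ << reg mᵣ) arcsBody) cost₇ (arcs-run {s} I) λ {s} I →
    run-then (maxTime (iᵣ ≔ reg countᵣ)) cost₈ (run-straight (iᵣ ≔ reg countᵣ) bound (to-tree {s} I)) λ {s} I →
    run-then (loopCost (lit 1 << reg iᵣ) treeBody) cost₉ (tree-run {s} I) λ {s} I →
    run-then (maxTime (iᵣ ≔ lit 2)) cost₁₀ (run-straight (iᵣ ≔ lit 2) bound (to-ears {s} I)) λ {s} I →
    run-then (loopCost (reg iᵣ << inc (reg countᵣ)) earsBody) cost₁₁ (ears-run {s} I) λ {s} I →
    run-then (maxTime (iᵣ ≔ lit 0)) cost₁₂ (run-straight (iᵣ ≔ lit 0) bound (to-pairs {s} I)) λ {s} I →
    run-then (loopCost (reg iᵣ << reg mᵣ) pairsBody) cost₁₃ (pairs-run {s} I) λ {s} I →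
    run-then (maxTime (iᵣ ≔ lit 1)) cost₁₄ (run-straight (iᵣ ≔ lit 1) bound (to-output {s} I)) λ {s} I →
    output-run {s} I

  -- Matching `Same` against `refl` turns statements about the final state into statements about the
  -- input.
  finished : ∀ {s} → OutputAt s × regs s iᵣ ≡ regs s nᵣ →
    (∀ u v → u < n₀ → v < n₀ → Star (Arc m₀ tl₀ hd₀ λ e → arrs s outₐ e ≢ 0) u v) ×
    (∀ X → (∀ u v → u < n₀ → v < n₀ → Star (Arc m₀ tl₀ hd₀ λ e → X e ≢ 0) u v) →
      4 * ∑ m₀ ([_≢0] ∘ arrs s outₐ) ≤ 7 * ∑ m₀ ([_≢0] ∘ X))
  finished {s} (((G , same refl refl refl refl) , T , (L , H , C) , P , O , _) , i≡n) =
    strongly-connected , approximation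
    where
    open Quality G T L H C P
      (subst (λ k → Output (regs s mᵣ) k (arrs s tlₐ) (arrs s parₐ) (arrs s bcₐ) (arrs s tgtₐ) (arrs s entryₐ) (arrs s outₐ))
        i≡n O)

-- Subsets and walks in terms of natural numbers

∑-shift : ∀ k f → ∑ (suc k) f ≡ f 0 + ∑ k (f ∘ suc)
∑-shift zero    f = sym (+-identityʳ (f 0))
∑-shift (suc k) f = trans (cong (_+ f (suc k)) (∑-shift k f)) (+-assoc (f 0) _ _)

mem : ∀ {m} → Subset m → ℕ → ℕ
mem []ᵥ      _       = 0
mem (b ∷ᵥ _) zero    = if b then 1 else 0
mem (_ ∷ᵥ S) (suc i) = mem S i

∣∣≡∑-mem : ∀ {m} (S : Subset m) → ∣ S ∣ ≡ ∑ m ([_≢0] ∘ mem S)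
∣∣≡∑-mem []ᵥ = refl
∣∣≡∑-mem {suc m} (true ∷ᵥ S)  = trans (cong suc (∣∣≡∑-mem S)) (sym (∑-shift m ([_≢0] ∘ mem (true ∷ᵥ S))))
∣∣≡∑-mem {suc m} (false ∷ᵥ S) = trans (∣∣≡∑-mem S) (sym (∑-shift m ([_≢0] ∘ mem (false ∷ᵥ S))))

∈⇒mem : ∀ {m} {S : Subset m} {e} → e ∈ S → mem S (toℕ e) ≢ 0
∈⇒mem here        ()
∈⇒mem (there e∈S) = ∈⇒mem e∈S

∣tabulate∣ : ∀ m (f : ℕ → ℕ) → ∣ tabulate {n = m} (λ e → 0 <ᵇ f (toℕ e)) ∣ ≡ ∑ m ([_≢0] ∘ f)
∣tabulate∣ zero    f = refl
∣tabulate∣ (suc m) f with f 0 in eq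
... | zero  = trans (∣tabulate∣ m (f ∘ suc))
  (sym (trans (∑-shift m ([_≢0] ∘ f)) (cong (λ a → [ a ≢0] + ∑ m ([_≢0] ∘ f ∘ suc)) eq)))
... | suc _ = trans (cong suc (∣tabulate∣ m (f ∘ suc)))
  (sym (trans (∑-shift m ([_≢0] ∘ f)) (cong (λ a → [ a ≢0] + ∑ m ([_≢0] ∘ f ∘ suc)) eq)))

∈-output : ∀ {m} s (e : Fin m) → arrs s outₐ (toℕ e) ≢ 0 → e ∈ output m s
∈-output {m} s e out = lookup⇒[]= e (output m s) (trans (lookup∘tabulate _ e) (positive _ out))
  where
  positive : ∀ a → a ≢ 0 → (0 <ᵇ a) ≡ true
  positive zero    h = contradiction refl h
  positive (suc _) _ = refl

fill-toℕ : ∀ {m} (f : Fin m → ℕ) e → fill f (toℕ e) ≡ f e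
fill-toℕ {m} f e with toℕ e <? m
... | yes lt = cong f (fromℕ<-toℕ e lt)
... | no ≮   = contradiction (toℕ<n e) ≮

-- This yields `1 ≤ α m n`, by which a bound linear in `m` implies the stated one.
least-lower : ∀ {P : ℕ → Set} (P? : Decidable P) i k → i ≤ least P? i k
least-lower P? i zero    = ≤-refl
least-lower P? i (suc k) with does (P? i)
... | true  = ≤-refl
... | false = ≤-trans (n≤1+n i) (least-lower P? (suc i) k)

module _ {n m : ℕ} (G : Digraph n m) where
  tails heads : ℕ → ℕ
  tails = fill λ e → toℕ (proj₁ (ends G e))
  heads = fill λ e → toℕ (proj₂ (ends G e))

  walk-ℕ : ∀ {S : Subset m} {X : ℕ → Set} → (∀ {e} → e ∈ S → X (toℕ e)) → ∀ {u v} →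
    Reachable (ends G) S u v → Star (Arc m tails heads X) (toℕ u) (toℕ v)
  walk-ℕ X⊇S = gmap toℕ λ (e , e∈S , eq) → toℕ e , toℕ<n e , X⊇S e∈S ,
    trans (fill-toℕ _ e) (cong (toℕ ∘ proj₁) eq) , trans (fill-toℕ _ e) (cong (toℕ ∘ proj₂) eq)

  -- The end points enter through equations because the inner vertices of the walk are numbers,
  -- decoded arc by arc.
  walk-Fin : ∀ {S : Subset m} {X : ℕ → Set} → (∀ {e} → X (toℕ e) → e ∈ S) → ∀ {a b} →
    Star (Arc m tails heads X) a b → ∀ {u v} → toℕ u ≡ a → toℕ v ≡ b → Reachable (ends G) S u v
  walk-Fin S⊇X ε u≡ v≡ with toℕ-injective (trans u≡ (sym v≡))
  ... | refl = ε
  walk-Fin {S} {X} S⊇X ((i , i<m , Xi , refl , refl) ◅ w) {u} u≡ v≡ =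
    (e , S⊇X (subst X (sym e≡i) Xi) , cong (_, proj₂ (ends G e)) tail≡u) ◅
    walk-Fin S⊇X w (trans (sym (fill-toℕ _ e)) (cong heads e≡i)) v≡
    where
    e = fromℕ< i<m
    e≡i = toℕ-fromℕ< i<m
    tail≡u : proj₁ (ends G e) ≡ u
    tail≡u = toℕ-injective (trans (sym (fill-toℕ _ e)) (trans (cong tails e≡i) (sym u≡)))

  fill<n : ∀ (f : Fin m → Fin n) i → i < m → fill (toℕ ∘ f) i < n
  fill<n f i i<m = subst (λ i → fill (toℕ ∘ f) i < n) (toℕ-fromℕ< i<m)
    (subst (_< n) (sym (fill-toℕ (toℕ ∘ f) (fromℕ< i<m))) (toℕ<n _))

  walks-ℕ : ∀ {S : Subset m} {X : ℕ → Set} → SCSS G S → (∀ {e} → e ∈ S → X (toℕ e)) →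
    ∀ u v → u < n → v < n → Star (Arc m tails heads X) u v
  walks-ℕ conn X⊇S u v u<n v<n = subst₂ (Star _) (toℕ-fromℕ< u<n) (toℕ-fromℕ< v<n)
    (walk-ℕ X⊇S (conn (fromℕ< u<n) (fromℕ< v<n)))

  module _ (n>0 : 0 < n) (sc : StronglyConnected G) where
    input-graph : Graph n m tails heads
    input-graph = record
      { n>0 = n>0
      ; tl<n = fill<n (proj₁ ∘ ends G)
      ; hd<n = fill<n (proj₂ ∘ ends G)
      ; connected = walks-ℕ sc λ _ → tt
      }

    open Execution n m tails heads
    open Phases n m tails heads

    input-ready : ListsAt (input G)
    input-ready = (input-graph , same refl refl refl refl) , lists-start (λ _ → refl) , z≤n ,
      (λ _ → refl) , (λ _ → refl) , (λ _ → refl) , (λ _ → refl) , (λ _ → refl) , (λ _ → refl) , (λ _ → refl) , tt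

    output-correct : ∀ {s} → OutputAt s × regs s iᵣ ≡ regs s nᵣ →
      SCSS G (output m s) × 4 * ∣ output m s ∣ ≤ 7 * OPT G
    output-correct {s} done =
      (λ u v → walk-Fin (λ {e} → ∈-output s e) (proj₁ (finished {s} done) (toℕ u) (toℕ v) (toℕ<n u) (toℕ<n v)) refl refl) ,
      subst₂ (λ a b → 4 * a ≤ 7 * b) (sym (∣tabulate∣ m (arrs s outₐ)))
        (trans (sym (∣∣≡∑-mem S)) (proj₂ (proj₂ holds)))
        -- The competitor is the characteristic function of an optimal subset `S`.
        (proj₂ (finished {s} done) (mem S) (walks-ℕ (proj₁ (proj₂ holds)) ∈⇒mem))
      where
      open IsLeastFrom (OPT-isLeast G sc)
      S = proj₁ holds

    -- Strong connectivity bounds `n` by `m + 1`, which makes time linear in `n + m` linear in `m`.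
    -- A single vertex without arcs is the exception, whence `1 ≤ m`.
    linear : 1 ≤ m → suc (n + m) ≤ 4 * m
    linear m≥1 = begin
      suc (n + m)       ≤⟨ s≤s (+-monoˡ-≤ m n≤1+m) ⟩
      2 + m + m         ≤⟨ +-monoˡ-≤ m (+-monoˡ-≤ m (*-monoʳ-≤ 2 m≥1)) ⟩
      2 * m + m + m     ≡⟨ solve 1 (λ m → con 2 :* m :+ m :+ m := con 4 :* m) refl m ⟩
      4 * m             ∎
      where
      open ≤-Reasoning
      open +-*-Solver
      n≤1+m : n ≤ suc m
      n≤1+m = subst (λ k → n ≤ suc k) (∑-1 m) (vertices≤arcs input-graph (λ _ → 1) (walks-ℕ sc λ _ ()))

theorem6p2 : ∃ λ (p : Program) → ∃ λ (c : ℕ) →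
    ∀ {n m : ℕ} .{{_ : NonZero n}} (G : Digraph n m) → StronglyConnected G →
    ∃ λ (s : State) → ∃ λ (t : ℕ) →
    ⟨ p , input G ⟩⇓⟨ s , t ⟩
    × SCSS G (output m s)
    × 4 * ∣ output m s ∣ ≤ 7 * OPT G
    × (1 ≤ m → t ≤ c * (m * α m n))
theorem6p2 = sparsify , totalCost * 4 , λ {n} {m} G sc → solution n m G sc
  where
  solution : ∀ n m .{{_ : NonZero n}} (G : Digraph n m) → StronglyConnected G →
    ∃ λ s → ∃ λ t → ⟨ sparsify , input G ⟩⇓⟨ s , t ⟩ × SCSS G (output m s) ×
    4 * ∣ output m s ∣ ≤ 7 * OPT G × (1 ≤ m → t ≤ totalCost * 4 * (m * α m n))
  solution n m G sc = conclude (Phases.sparsify-run n m (tails G) (heads G) {input G} (input-ready G n>0 sc))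
    where
    n>0 = >-nonZero⁻¹ n
    conclude : Run sparsify (input G) (totalCost * suc (n + m)) (λ s →
        Execution.OutputAt n m (tails G) (heads G) s × regs s iᵣ ≡ regs s nᵣ) → _
    conclude (s , t , run , t≤ , done) =
      s , t , run , proj₁ (output-correct G n>0 sc {s} done) , proj₂ (output-correct G n>0 sc {s} done) , λ m≥1 → begin
        t                        ≤⟨ t≤ ⟩
        totalCost * suc (n + m)         ≤⟨ *-monoʳ-≤ totalCost (linear G n>0 sc m≥1) ⟩
        totalCost * (4 * m)             ≡⟨ sym (*-assoc totalCost 4 m) ⟩
        totalCost * 4 * m               ≤⟨ *-monoʳ-≤ (totalCost * 4) (m≤m*n m (α m n) {{>-nonZero (least-lower (ExceedsLog? m n) 1 n)}}) ⟩
        totalCost * 4 * (m * α m n)     ∎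
      where open ≤-Reasoning
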